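{- For every integer $n\geq 1$, \[ \tilde k_{2n}(q) = \sum_{\sigma \in \mathcal{M}^c(2n)} T_{G(\sigma)}(1,q). \] In particular, $\tilde k_{2n}(q)$ is a polynomial in $q$ with nonnegative integer coefficients.
   Context: Let $q$ be a formal variable and $[i]_q=\frac{1-q^i}{1-q}=1+q+\dots+q^{i-1}$. The moments $m_n(q)$ ($n\ge 0$) of the $q$-semicircular law are defined by the formal continued fraction \[\sum_{n\ge0} m_n(q)z^n = \cfrac{1}{1-\cfrac{[1]_q z^2}{1-\cfrac{[2]_q z^2}{1-\ddots}}}\] (so $m_{n}(q)=0$ for $n$ odd). The cumulants $k_n(q)$, $n\ge1$, are defined by the formal power series identity $\sum_{n\ge1} k_n(q)\frac{z^n}{n!}=\log\big(\sum_{n\ge0} m_n(q)\frac{z^n}{n!}\big)$, and $\tilde k_{2n}(q)=k_{2n}(q)/(q-1)^{n-1}$. A matching of $\{1,\dots,2n\}$ is a set partition all of whose blocks (called arches) have size $2$; $\mathcal{M}(2n)$ denotes the set of these. A matching $\sigma$ is connected if no proper nonempty interval $\{1,\dots,j\}$, more precisely no proper subinterval of $\{1,\dots,2n\}$, is a union of blocks of $\sigma$; $\mathcal{M}^c(2n)$ denotes the set of connected matchings. The crossing graph $G(\sigma)$ of a matching $\sigma$ has vertex set the set of arches of $\sigma$, with an edge between arches $\{i,j\}$ and $\{k,\ell\}$ if and only if $i<k<j<\ell$ (the arches cross). $T_G(x,y)$ denotes the Tutte polynomial of a graph $G$. -}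

module Defs where

open import Data.Nat as ℕ using (ℕ; zero; suc; _∸_; _<ᵇ_; _≡ᵇ_; _≤ᵇ_)
open import Data.Nat.Combinatorics using (_C_)
open import Data.Integer as ℤ using (ℤ; +_; -_)
open import Data.Bool using (Bool; true; false; _∧_; _∨_; not; if_then_else_)
open import Data.List using (List; []; _∷_; map; foldr; concatMap; upTo; length; filter; _++_; replicate; zip)
open import Data.Bool.ListAction using (any; all)
open import Data.Product using (_×_; _,_; proj₁; proj₂)
open import Relation.Binary.PropositionalEquality using (_≡_)
open import Relation.Nullary.Decidable using (does)
open import Data.Bool.Properties using (T?)
open import Data.Bool using (T)

-- Polynomials in q with integer coefficients: coefficient lists,
-- constant term first.  Equality is coefficientwise (trailing zeros
-- are irrelevant).

Poly : Set
Poly = List ℤ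

coeff : Poly → ℕ → ℤ
coeff []      _       = + 0
coeff (c ∷ p) zero    = c
coeff (c ∷ p) (suc i) = coeff p i

infix 4 _≈_
_≈_ : Poly → Poly → Set
p ≈ r = ∀ i → coeff p i ≡ coeff r i

infixl 6 _⊕_ _⊖_
infixl 7 _⊗_ _·_

_⊕_ : Poly → Poly → Poly
[]      ⊕ r       = r
(c ∷ p) ⊕ []      = c ∷ p
(c ∷ p) ⊕ (d ∷ r) = (c ℤ.+ d) ∷ (p ⊕ r)

_·_ : ℤ → Poly → Poly
c · p = map (c ℤ.*_) p

⊖_ : Poly → Poly
⊖ p = (- + 1) · p

_⊖_ : Poly → Poly → Poly
p ⊖ r = p ⊕ (⊖ r)

_⊗_ : Poly → Poly → Poly
[]      ⊗ r = []
(c ∷ p) ⊗ r = (c · r) ⊕ (+ 0 ∷ (p ⊗ r))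

𝟘 : Poly
𝟘 = []

𝟙 : Poly
𝟙 = + 1 ∷ []

𝕢 : Poly
𝕢 = + 0 ∷ + 1 ∷ []

_^_ : Poly → ℕ → Poly
p ^ zero  = 𝟙
p ^ suc n = p ⊗ (p ^ n)

ΣP : List Poly → Poly
ΣP = foldr _⊕_ 𝟘

[_]q : ℕ → Poly
[ i ]q = replicate i (+ 1)

fromℕs : List ℕ → Poly
fromℕs = map +_

-- Moments of the q-semicircular law.
-- The formal continued fraction is encoded by its tails
--   F_h(z) = 1 / (1 - [h+1]_q z^2 F_{h+1}(z)),   h ≥ 0,
-- i.e. F_h = 1 + [h+1]_q z^2 F_{h+1} F_h, with F_h(z) = Σ_n a h n z^n.
-- This system determines the coefficients a h n uniquely (by recursion
-- on n), and  Σ_n m_n z^n = F_0(z).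

IsQSemicircleCF : (ℕ → ℕ → Poly) → Set
IsQSemicircleCF a =
  (∀ h → a h 0 ≈ 𝟙) ×
  (∀ h → a h 1 ≈ 𝟘) ×
  (∀ h n → a h (suc (suc n)) ≈
      [ suc h ]q ⊗ ΣP (map (λ i → a (suc h) i ⊗ a h (n ∸ i)) (upTo (suc n))))

-- Cumulants: K(z) = Σ_{n≥1} k_n z^n/n! is log M(z), M(z) = Σ m_n z^n/n!
-- (m_0 = 1).  The formal logarithm is characterised by K(0) = 0 and
-- K' = M'/M, i.e. M' = K' M; comparing coefficients of z^n/n!:
--   m_{n+1} = Σ_{i=0}^{n} C(n,i) k_{i+1} m_{n-i}     (n ≥ 0).

IsCumulants : (ℕ → Poly) → (ℕ → Poly) → Set
IsCumulants m k = ∀ n →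
  m (suc n) ≈ ΣP (map (λ i → (+ (n C i)) · (k (suc i) ⊗ m (n ∸ i))) (upTo (suc n)))

-- Graphs on vertex set {0,…,v-1} given by an edge list, and the Tutte
-- polynomial via its subset expansion
--   T_G(x,y) = Σ_{A ⊆ E} (x-1)^{r(E)-r(A)} (y-1)^{|A|-r(A)},
-- r(A) = |V| - c(V,A), c = number of connected components.

Edge : Set
Edge = ℕ × ℕ

sublists : {A : Set} → List A → List (List A)
sublists []       = [] ∷ []
sublists (x ∷ xs) = sublists xs ++ map (x ∷_) (sublists xs)

reach : List Edge → ℕ → ℕ → ℕ → Bool
reach A zero    i j = i ≡ᵇ j
reach A (suc s) i j = reach A s i j ∨
  any (λ e → ((proj₁ e ≡ᵇ j) ∧ reach A s i (proj₂ e)) ∨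
             ((proj₂ e ≡ᵇ j) ∧ reach A s i (proj₁ e))) A

-- number of connected components of (V, A), |V| = v: count the vertices
-- that are the least vertex of their component
components : ℕ → List Edge → ℕ
components v A =
  length (filter (λ i → T? (all (λ j → not (reach A v j i)) (upTo i))) (upTo v))

rank : ℕ → List Edge → ℕ
rank v A = v ∸ components v A

tutte : ℕ → List Edge → Poly → Poly → Poly
tutte v E x y = ΣP (map (λ A →
    ((x ⊖ 𝟙) ^ (rank v E ∸ rank v A)) ⊗ ((y ⊖ 𝟙) ^ (length A ∸ rank v A)))
  (sublists E))

-- Matchings of {1,…,2n}: a matching is a list of arches (i , j), i < j.
-- Enumeration: the least remaining point is matched with any other.

picks : {A : Set} → List A → List (A × List A)
picks []       = []
picks (x ∷ xs) = (x , xs) ∷ map (λ p → proj₁ p , x ∷ proj₂ p) (picks xs)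

matchingsOf : ℕ → List ℕ → List (List Edge)
matchingsOf zero    []       = [] ∷ []
matchingsOf zero    (_ ∷ _)  = []
matchingsOf (suc k) []       = []
matchingsOf (suc k) (x ∷ xs) =
  concatMap (λ p → map ((x , proj₁ p) ∷_) (matchingsOf k (proj₂ p))) (picks xs)

matchings : ℕ → List (List Edge)
matchings n = matchingsOf n (map suc (upTo (n ℕ.+ n)))

inI : ℕ → ℕ → ℕ → Bool
inI a b x = (a ≤ᵇ x) ∧ (x ≤ᵇ b)

unionOfBlocks : List Edge → ℕ → ℕ → Bool
unionOfBlocks σ a b = all (λ e → inI a b (proj₁ e) ≡B inI a b (proj₂ e)) σ
  where
  _≡B_ : Bool → Bool → Bool
  true  ≡B y = y
  false ≡B y = not y

isConnected : ℕ → List Edge → Bool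
isConnected n σ =
  all (λ a → all (λ b →
        not ((a ≤ᵇ b) ∧ not ((a ≡ᵇ 1) ∧ (b ≡ᵇ (n ℕ.+ n))) ∧ unionOfBlocks σ a b))
      (map suc (upTo (n ℕ.+ n))))
    (map suc (upTo (n ℕ.+ n)))

connectedMatchings : ℕ → List (List Edge)
connectedMatchings n = filter (λ σ → T? (isConnected n σ)) (matchings n)

crosses : Edge → Edge → Bool
crosses (i , j) (k , l) =
  ((i <ᵇ k) ∧ (k <ᵇ j) ∧ (j <ᵇ l)) ∨ ((k <ᵇ i) ∧ (i <ᵇ l) ∧ (l <ᵇ j))

-- crossing graph G(σ): vertices are the arches, numbered 0,…,|σ|-1 in
-- list order; edges (s , t), s < t, between crossing arches
crossingEdges : List Edge → List Edge
crossingEdges σ =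
  concatMap (λ s → concatMap (λ t →
      if crosses (proj₂ s) (proj₂ t) then (proj₁ s , proj₁ t) ∷ [] else [])
    (filter (λ t → T? (proj₁ s <ᵇ proj₁ t)) ind))
  ind
  where
  ind : List (ℕ × Edge)
  ind = zip (upTo (length σ)) σ

tutteCrossing1q : List Edge → Poly
tutteCrossing1q σ = tutte (length σ) (crossingEdges σ) 𝟙 𝕢

-- By Touchard's formula m_{2n} = Σ_σ q^{cr σ}, over all matchings σ.  Writing q = 1 + w and expanding
-- q^{cr σ} over the sets D of edges of the crossing graph of σ, then splitting off the component of
-- the first arch in the graph (σ , D), gives the recursion that characterises cumulants; hence
-- k_{2n} = Σ_σ Σ_D w^{|D|}, where D runs over the connected spanning subgraphs of the crossing graph.
-- The inner sum vanishes unless σ is connected, in which case it is w^{n-1} T(1 , q); by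
-- deletion–contraction it is always w^{n-1} times a polynomial in q with nonnegative coefficients.
--
-- Touchard's formula is obtained from the oscillator relation a a* - a* a = q^N: the weighted sum
-- over matchings is the vacuum expectation of (a + a*)^{2n}, which is also the sum over weighted
-- Dyck paths described by the continued fraction.
module Submission where

open import Defs
open import Data.Nat as ℕ using (ℕ; zero; suc; _+_; _∸_; _≤_; _<_; z≤n; s≤s; _<ᵇ_; _≡ᵇ_; _⊔_; _⊓_; pred)
import Data.Nat.Properties as ℕ
open import Data.Nat.Combinatorics using (_C_; nCk+nC[k+1]≡[n+1]C[k+1]; k>n⇒nCk≡0; nCk≡nC[n∸k]; nCn≡1)
open import Data.Nat.Tactic.RingSolver using (solve-∀)
open import Data.Integer as ℤ using ()
import Data.Integer.Properties as ℤ
open import Data.Bool using (Bool; true; false; _∧_; _∨_; not; if_then_else_; T)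
open import Data.Bool.ListAction using (any; all)
import Data.Bool.Properties as Bool
open import Data.List using (List; []; _∷_; map; foldr; concatMap; upTo; length; _++_; zip; filterᵇ)
open import Data.List.Properties using (++-assoc; map-++; map-∘; map-applyUpTo; length-++; length-map; length-upTo)
open import Data.List.Membership.Propositional using (_∈_)
open import Data.List.Membership.Propositional.Properties using (∈-upTo⁺; ∈-upTo⁻; ∈-++⁺ˡ; ∈-++⁺ʳ; ∈-map⁺)
open import Data.List.Relation.Unary.All as All using (All; []; _∷_)
import Data.List.Relation.Unary.All.Properties as All
open import Data.List.Relation.Unary.AllPairs as AllPairs using (AllPairs; []; _∷_)
import Data.List.Relation.Unary.AllPairs.Properties as AllPairs
open import Data.List.Relation.Unary.Any using (here; there)
open import Data.Product using (_×_; ∃; _,_; proj₁; proj₂)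
open import Data.Sum using (_⊎_; inj₁; inj₂)
open import Data.Unit using (⊤; tt)
open import Data.Empty using (⊥-elim)
open import Relation.Nullary using (¬_; yes; no)
open import Relation.Binary.PropositionalEquality as ≡ using (_≡_; _≢_; refl; cong; cong₂; subst; subst₂)
import Relation.Binary.Reasoning.Setoid as SetoidReasoning
open import Algebra.Bundles using (CommutativeRing)
import Algebra.Properties.Group as GroupProperties
import Algebra.Properties.Monoid.Mult as Mult
import Algebra.Solver.Ring.NaturalCoefficients.Default as SemiringSolver
open import Function using (_∘_; id)
open import Level using (0ℓ)

-- The sums live over an arbitrary commutative ring with a parameter `w`; `w = q - 1` is substituted
-- only at the end. Touchard's formula cannot be proved by induction on matchings alone: deleting
-- the first arch loses its crossings. Words with markers remember where the deleted arches end, and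
-- this enlarged family of words is closed under the recursion that the oscillator relation
-- produces. Graphs are handled through labellings of their vertices, merged along one edge at a
-- time, so that a sum over edge sets becomes a recursion on the edge list. Two translations are the
-- price: labels have to be compared with the search `reach` that defines `components`, and
-- connectedness of the crossing graph with the absence of proper block intervals. The subset
-- expansion of T(1 , q) is written in powers of `q - 1` and so hides the signs of its coefficients.
-- Nonnegativity is therefore derived from the connected sums themselves and not from the Tutte
-- formula.

private variable
  A B : Set

-- Power series and the ring of polynomials

module Convolution (R : CommutativeRing 0ℓ 0ℓ) where
  open CommutativeRing R renaming (_≈_ to _≋_; _+_ to _⊞_; _*_ to _⊠_; refl to ≋-refl)
    hiding (zero; distribˡ)
  open CommutativeRing R using () renaming (distribˡ to ⊠-distribˡ)
  open SemiringSolver commutativeSemiring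
  open SetoidReasoning setoid

  -- The Cauchy product, by recursion on the left series, so that no index is subtracted; `∑-conv`
  -- relates it to sums with `n ∸ i`.
  conv : (ℕ → Carrier) → (ℕ → Carrier) → ℕ → Carrier
  conv f g zero    = f 0 ⊠ g 0
  conv f g (suc n) = f 0 ⊠ g (suc n) ⊞ conv (f ∘ suc) g n

  conv-cong : ∀ {f f′ g g′} → (∀ i → f i ≋ f′ i) → (∀ i → g i ≋ g′ i) → ∀ n → conv f g n ≋ conv f′ g′ n
  conv-cong p r zero    = *-cong (p 0) (r 0)
  conv-cong p r (suc n) = +-cong (*-cong (p 0) (r (suc n))) (conv-cong (p ∘ suc) r n)

  -- The mirror image of the defining recursion, from which commutativity follows.
  conv-snoc : ∀ f g n → conv f g (suc n) ≋ conv f (g ∘ suc) n ⊞ f (suc n) ⊠ g 0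
  conv-snoc f g zero    = ≋-refl
  conv-snoc f g (suc n) = trans (+-congˡ (conv-snoc (f ∘ suc) g n)) (sym (+-assoc _ _ _))

  conv-comm : ∀ f g n → conv f g n ≋ conv g f n
  conv-comm f g zero    = *-comm _ _
  conv-comm f g (suc n) = begin
    f 0 ⊠ g (suc n) ⊞ conv (f ∘ suc) g n ≈⟨ +-cong (*-comm _ _) (conv-comm (f ∘ suc) g n) ⟩
    g (suc n) ⊠ f 0 ⊞ conv g (f ∘ suc) n ≈⟨ +-comm _ _ ⟩
    conv g (f ∘ suc) n ⊞ g (suc n) ⊠ f 0 ≈⟨ conv-snoc g f n ⟨
    conv g f (suc n)                     ∎

  conv-distribʳ : ∀ f g h n → conv (λ i → f i ⊞ g i) h n ≋ conv f h n ⊞ conv g h n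
  conv-distribʳ f g h zero    = distribʳ _ _ _
  conv-distribʳ f g h (suc n) = begin
    (f 0 ⊞ g 0) ⊠ h (suc n) ⊞ conv (λ i → f (suc i) ⊞ g (suc i)) h n
      ≈⟨ +-congˡ (conv-distribʳ (f ∘ suc) (g ∘ suc) h n) ⟩
    (f 0 ⊞ g 0) ⊠ h (suc n) ⊞ (conv (f ∘ suc) h n ⊞ conv (g ∘ suc) h n)
      ≈⟨ solve 5 (λ a b c d e → (a :+ b) :* c :+ (d :+ e) := (a :* c :+ d) :+ (b :* c :+ e)) ≋-refl
               (f 0) (g 0) (h (suc n)) _ _ ⟩
    conv f h (suc n) ⊞ conv g h (suc n) ∎

  conv-scale : ∀ c f g n → conv (λ i → c ⊠ f i) g n ≋ c ⊠ conv f g n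
  conv-scale c f g zero    = *-assoc _ _ _
  conv-scale c f g (suc n) =
    trans (+-cong (*-assoc _ _ _) (conv-scale c (f ∘ suc) g n)) (sym (⊠-distribˡ _ _ _))

  conv-assoc : ∀ f g h n → conv (conv f g) h n ≋ conv f (conv g h) n
  conv-assoc f g h zero    = *-assoc _ _ _
  conv-assoc f g h (suc n) = begin
    f 0 ⊠ g 0 ⊠ h (suc n) ⊞ conv (λ i → f 0 ⊠ g (suc i) ⊞ conv (f ∘ suc) g i) h n
      ≈⟨ +-congˡ (conv-distribʳ (λ i → f 0 ⊠ g (suc i)) (conv (f ∘ suc) g) h n) ⟩
    f 0 ⊠ g 0 ⊠ h (suc n) ⊞ (conv (λ i → f 0 ⊠ g (suc i)) h n ⊞ conv (conv (f ∘ suc) g) h n)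
      ≈⟨ +-congˡ (+-cong (conv-scale (f 0) (g ∘ suc) h n) (conv-assoc (f ∘ suc) g h n)) ⟩
    f 0 ⊠ g 0 ⊠ h (suc n) ⊞ (f 0 ⊠ conv (g ∘ suc) h n ⊞ conv (f ∘ suc) (conv g h) n)
      ≈⟨ solve 5 (λ a b c d e → a :* b :* c :+ (a :* d :+ e) := a :* (b :* c :+ d) :+ e) ≋-refl
               (f 0) (g 0) (h (suc n)) _ _ ⟩
    conv f (conv g h) (suc n) ∎

  conv-zeroˡ : ∀ g n → conv (λ _ → 0#) g n ≋ 0#
  conv-zeroˡ g zero    = zeroˡ _
  conv-zeroˡ g (suc n) = trans (+-cong (zeroˡ _) (conv-zeroˡ g n)) (+-identityˡ _)

module ℤConv = Convolution ℤ.+-*-commutativeRing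
open ℤConv using () renaming (conv to ℤconv)

-- Coefficient lists as a commutative ring

coeff-⊕ : ∀ p r i → coeff (p ⊕ r) i ≡ coeff p i ℤ.+ coeff r i
coeff-⊕ []      r       i       = ≡.sym (ℤ.+-identityˡ _)
coeff-⊕ (c ∷ p) []      zero    = ≡.sym (ℤ.+-identityʳ _)
coeff-⊕ (c ∷ p) []      (suc i) = ≡.sym (ℤ.+-identityʳ _)
coeff-⊕ (c ∷ p) (d ∷ r) zero    = refl
coeff-⊕ (c ∷ p) (d ∷ r) (suc i) = coeff-⊕ p r i

coeff-· : ∀ c p i → coeff (c · p) i ≡ c ℤ.* coeff p i
coeff-· c []      i       = ≡.sym (ℤ.*-zeroʳ c)
coeff-· c (d ∷ p) zero    = refl
coeff-· c (d ∷ p) (suc i) = coeff-· c p i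

coeff-⊖ : ∀ p i → coeff (⊖ p) i ≡ ℤ.- coeff p i
coeff-⊖ p i = ≡.trans (coeff-· ℤ.-1ℤ p i) (ℤ.-1*i≡-i (coeff p i))

-- Equality of polynomials is coefficientwise, so this reduces the laws of `_⊗_` to those of
-- convolution over the integers.
coeff-⊗ : ∀ p r i → coeff (p ⊗ r) i ≡ ℤconv (coeff p) (coeff r) i
coeff-⊗ []      r i       = ≡.sym (ℤConv.conv-zeroˡ (coeff r) i)
coeff-⊗ (c ∷ p) r zero    =
  ≡.trans (coeff-⊕ (c · r) _ 0) (≡.trans (ℤ.+-identityʳ _) (coeff-· c r 0))
coeff-⊗ (c ∷ p) r (suc i) =
  ≡.trans (coeff-⊕ (c · r) _ (suc i)) (cong₂ ℤ._+_ (coeff-· c r (suc i)) (coeff-⊗ p r i))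

⊗-comm : ∀ p r → p ⊗ r ≈ r ⊗ p
⊗-comm p r i = ≡.trans (coeff-⊗ p r i)
  (≡.trans (ℤConv.conv-comm (coeff p) (coeff r) i) (≡.sym (coeff-⊗ r p i)))

⊗-cong : ∀ {p p′ r r′} → p ≈ p′ → r ≈ r′ → p ⊗ r ≈ p′ ⊗ r′
⊗-cong {p} {p′} {r} {r′} e f i = ≡.trans (coeff-⊗ p r i)
  (≡.trans (ℤConv.conv-cong e f i) (≡.sym (coeff-⊗ p′ r′ i)))

⊗-assoc : ∀ p r s → (p ⊗ r) ⊗ s ≈ p ⊗ (r ⊗ s)
⊗-assoc p r s i = ≡.trans (coeff-⊗ (p ⊗ r) s i)
  (≡.trans (ℤConv.conv-cong (coeff-⊗ p r) (λ _ → refl) i)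
  (≡.trans (ℤConv.conv-assoc (coeff p) (coeff r) (coeff s) i)
  (≡.trans (ℤConv.conv-cong (λ _ → refl) (λ j → ≡.sym (coeff-⊗ r s j)) i)
           (≡.sym (coeff-⊗ p (r ⊗ s) i)))))

⊗-identityˡ : ∀ p → 𝟙 ⊗ p ≈ p
⊗-identityˡ p i = ≡.trans (coeff-⊕ (ℤ.+ 1 · p) (ℤ.+ 0 ∷ []) i)
  (≡.trans (cong₂ ℤ._+_ (≡.trans (coeff-· (ℤ.+ 1) p i) (ℤ.*-identityˡ _)) (coeff-0 i)) (ℤ.+-identityʳ _))
  where
  coeff-0 : ∀ i → coeff (ℤ.+ 0 ∷ []) i ≡ ℤ.+ 0
  coeff-0 zero    = refl
  coeff-0 (suc i) = refl

⊗-distribʳ : ∀ s p r → (p ⊕ r) ⊗ s ≈ (p ⊗ s) ⊕ (r ⊗ s)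
⊗-distribʳ s p r i = ≡.trans (coeff-⊗ (p ⊕ r) s i)
  (≡.trans (ℤConv.conv-cong (coeff-⊕ p r) (λ _ → refl) i)
  (≡.trans (ℤConv.conv-distribʳ (coeff p) (coeff r) (coeff s) i)
  (≡.sym (≡.trans (coeff-⊕ (p ⊗ s) (r ⊗ s) i) (cong₂ ℤ._+_ (coeff-⊗ p s i) (coeff-⊗ r s i))))))

⊕-cong : ∀ {p p′ r r′} → p ≈ p′ → r ≈ r′ → p ⊕ r ≈ p′ ⊕ r′
⊕-cong {p} {p′} {r} {r′} e f i =
  ≡.trans (coeff-⊕ p r i) (≡.trans (cong₂ ℤ._+_ (e i) (f i)) (≡.sym (coeff-⊕ p′ r′ i)))

⊕-comm : ∀ p r → p ⊕ r ≈ r ⊕ p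
⊕-comm p r i = ≡.trans (coeff-⊕ p r i) (≡.trans (ℤ.+-comm (coeff p i) (coeff r i)) (≡.sym (coeff-⊕ r p i)))

⊕-assoc : ∀ p r s → (p ⊕ r) ⊕ s ≈ p ⊕ (r ⊕ s)
⊕-assoc p r s i = ≡.trans (coeff-⊕ (p ⊕ r) s i) (≡.trans (cong (ℤ._+ _) (coeff-⊕ p r i))
  (≡.trans (ℤ.+-assoc (coeff p i) _ _)
  (≡.sym (≡.trans (coeff-⊕ p (r ⊕ s) i) (cong (ℤ._+_ (coeff p i)) (coeff-⊕ r s i))))))

⊖-inverseʳ : ∀ p → p ⊕ (⊖ p) ≈ 𝟘
⊖-inverseʳ p i = ≡.trans (coeff-⊕ p (⊖ p) i)
  (≡.trans (cong (ℤ._+_ (coeff p i)) (coeff-⊖ p i)) (ℤ.+-inverseʳ (coeff p i)))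

polyRing : CommutativeRing 0ℓ 0ℓ
polyRing = record
  { Carrier = Poly ; _≈_ = _≈_ ; _+_ = _⊕_ ; _*_ = _⊗_ ; -_ = ⊖_ ; 0# = 𝟘 ; 1# = 𝟙
  ; isCommutativeRing = record
    { isRing = record
      { +-isAbelianGroup = record
        { isGroup = record
          { isMonoid = record
            { isSemigroup = record
              { isMagma = record
                { isEquivalence = record
                  { refl = λ _ → refl ; sym = λ e i → ≡.sym (e i) ; trans = λ e f i → ≡.trans (e i) (f i) }
                ; ∙-cong = λ {p} {p′} {r} {r′} → ⊕-cong {p} {p′} {r} {r′} }
              ; assoc = ⊕-assoc }
            ; identity = (λ _ _ → refl) , (λ p → ⊕-comm p 𝟘) }
          ; inverse = (λ p i → ≡.trans (⊕-comm (⊖ p) p i) (⊖-inverseʳ p i)) , ⊖-inverseʳ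
          ; ⁻¹-cong = λ {p} {r} e i →
              ≡.trans (coeff-⊖ p i) (≡.trans (cong ℤ.-_ (e i)) (≡.sym (coeff-⊖ r i))) }
        ; comm = ⊕-comm }
      ; *-cong = λ {p} {p′} {r} {r′} → ⊗-cong {p} {p′} {r} {r′}
      ; *-assoc = ⊗-assoc
      ; *-identity = ⊗-identityˡ , (λ p i → ≡.trans (⊗-comm p 𝟙 i) (⊗-identityˡ p i))
      ; distrib = (λ s p r i → ≡.trans (⊗-comm s (p ⊕ r) i) (≡.trans (⊗-distribʳ s p r i)
                     (⊕-cong {p ⊗ s} {s ⊗ p} {r ⊗ s} {s ⊗ r} (⊗-comm p s) (⊗-comm r s) i)))
                , ⊗-distribʳ }
    ; *-comm = ⊗-comm } }

-- Finite sums and matchings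

module Sums (R : CommutativeRing 0ℓ 0ℓ) where
  open CommutativeRing R renaming (_≈_ to _≋_; _+_ to _⊞_; _*_ to _⊠_; refl to ≋-refl; zero to ⊠-zero)
  open SemiringSolver commutativeSemiring
  open SetoidReasoning setoid
  open Convolution R using (conv)

  ∑ : List A → (A → Carrier) → Carrier
  ∑ xs F = foldr _⊞_ 0# (map F xs)

  ∑-cong : ∀ (xs : List A) {F G : A → Carrier} → (∀ x → F x ≋ G x) → ∑ xs F ≋ ∑ xs G
  ∑-cong []       e = ≋-refl
  ∑-cong (x ∷ xs) e = +-cong (e x) (∑-cong xs e)

  ∑-congᴬ : ∀ {P : A → Set} {xs : List A} {F G : A → Carrier} →
            All P xs → (∀ x → P x → F x ≋ G x) → ∑ xs F ≋ ∑ xs G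
  ∑-congᴬ []       e = ≋-refl
  ∑-congᴬ (p ∷ ps) e = +-cong (e _ p) (∑-congᴬ ps e)

  ∑-++ : ∀ (xs ys : List A) {F : A → Carrier} → ∑ (xs ++ ys) F ≋ ∑ xs F ⊞ ∑ ys F
  ∑-++ []       ys = sym (+-identityˡ _)
  ∑-++ (x ∷ xs) ys = trans (+-congˡ (∑-++ xs ys)) (sym (+-assoc _ _ _))

  ∑-map : ∀ (f : A → B) xs {F : B → Carrier} → ∑ (map f xs) F ≋ ∑ xs (F ∘ f)
  ∑-map f []       = ≋-refl
  ∑-map f (x ∷ xs) = +-congˡ (∑-map f xs)

  ∑-concatMap : ∀ (f : A → List B) xs {F : B → Carrier} → ∑ (concatMap f xs) F ≋ ∑ xs (λ x → ∑ (f x) F)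
  ∑-concatMap f []       = ≋-refl
  ∑-concatMap f (x ∷ xs) = trans (∑-++ (f x) (concatMap f xs)) (+-congˡ (∑-concatMap f xs))

  ∑-⊞ : ∀ (xs : List A) (F G : A → Carrier) → ∑ xs (λ x → F x ⊞ G x) ≋ ∑ xs F ⊞ ∑ xs G
  ∑-⊞ []       F G = sym (+-identityˡ _)
  ∑-⊞ (x ∷ xs) F G = trans (+-congˡ (∑-⊞ xs F G))
    (solve 4 (λ a b c d → (a :+ b) :+ (c :+ d) := (a :+ c) :+ (b :+ d)) ≋-refl _ _ _ _)

  ∑-scale : ∀ c (xs : List A) (F : A → Carrier) → ∑ xs (λ x → c ⊠ F x) ≋ c ⊠ ∑ xs F
  ∑-scale c []       F = sym (zeroʳ c)
  ∑-scale c (x ∷ xs) F = trans (+-congˡ (∑-scale c xs F)) (sym (distribˡ c _ _))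

  ∑-scaleʳ : ∀ c (xs : List A) (F : A → Carrier) → ∑ xs (λ x → F x ⊠ c) ≋ ∑ xs F ⊠ c
  ∑-scaleʳ c []       F = sym (zeroˡ c)
  ∑-scaleʳ c (x ∷ xs) F = trans (+-congˡ (∑-scaleʳ c xs F)) (sym (distribʳ c _ _))

  ∑-zero : ∀ (xs : List A) {F : A → Carrier} → (∀ x → F x ≋ 0#) → ∑ xs F ≋ 0#
  ∑-zero []       e = ≋-refl
  ∑-zero (x ∷ xs) e = trans (+-cong (e x) (∑-zero xs e)) (+-identityˡ _)

  ∑-swap : ∀ (xs : List A) (ys : List B) (F : A → B → Carrier) →
           ∑ xs (λ x → ∑ ys (F x)) ≋ ∑ ys (λ y → ∑ xs (λ x → F x y))
  ∑-swap []       ys F = sym (∑-zero ys (λ _ → ≋-refl))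
  ∑-swap (x ∷ xs) ys F = trans (+-congˡ (∑-swap xs ys F)) (sym (∑-⊞ ys (F x) _))

  ∑-upTo-suc : ∀ n (F : ℕ → Carrier) → ∑ (upTo (suc n)) F ≋ F 0 ⊞ ∑ (upTo n) (F ∘ suc)
  ∑-upTo-suc n F = +-congˡ (trans (reflexive (cong (λ l → ∑ l F) (≡.sym (map-applyUpTo id suc n))))
                                  (∑-map suc (upTo n)))

  ∑-conv : ∀ f g n → ∑ (upTo (suc n)) (λ i → f i ⊠ g (n ∸ i)) ≋ conv f g n
  ∑-conv f g zero    = +-identityʳ _
  ∑-conv f g (suc n) = trans (∑-upTo-suc (suc n) (λ i → f i ⊠ g (suc n ∸ i))) (+-congˡ (∑-conv (f ∘ suc) g n))

  pow : Carrier → ℕ → Carrier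
  pow x zero    = 1#
  pow x (suc n) = x ⊠ pow x n

  pow-+ : ∀ x m n → pow x (m + n) ≋ pow x m ⊠ pow x n
  pow-+ x zero    n = sym (*-identityˡ _)
  pow-+ x (suc m) n = trans (*-congˡ (pow-+ x m n)) (sym (*-assoc _ _ _))

-- Counting, edge lists and the enumeration of matchings

count : {A : Set} → (A → Bool) → List A → ℕ
count p []       = 0
count p (x ∷ xs) = (if p x then 1 else 0) + count p xs

count-congᴬ : ∀ {A : Set} {P : A → Set} {p r : A → Bool} {xs} →
              All P xs → (∀ x → P x → p x ≡ r x) → count p xs ≡ count r xs
count-congᴬ []       e = refl
count-congᴬ (a ∷ as) e = cong₂ _+_ (cong (λ b → if b then 1 else 0) (e _ a)) (count-congᴬ as e)

row : {A : Set} → (A → A → Bool) → A → List A → List (A × A)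
row c x = concatMap (λ y → if c x y then (x , y) ∷ [] else [])

-- The edge list of the graph of a symmetric relation `c`: every unordered pair of positions is
-- tested once, with the earlier element first.
pairs : {A : Set} → (A → A → Bool) → List A → List (A × A)
pairs c []       = []
pairs c (x ∷ xs) = row c x xs ++ pairs c xs

length-row : ∀ {A : Set} (c : A → A → Bool) x ys → length (row c x ys) ≡ count (c x) ys
length-row c x []       = refl
length-row c x (y ∷ ys) with c x y
... | true  = cong suc (length-row c x ys)
... | false = length-row c x ys

crossPairs : List Edge → List (Edge × Edge)
crossPairs = pairs crosses

data Pick {A : Set} (x : A) : List A → List A → Set where
  here  : ∀ {xs} → Pick x (x ∷ xs) xs
  there : ∀ {y xs ys} → Pick x xs ys → Pick x (y ∷ xs) (y ∷ ys)

data Pairing : List ℕ → List Edge → Set where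
  []  : Pairing [] []
  _∷_ : ∀ {x y xs ys σ} → Pick y xs ys → Pairing ys σ → Pairing (x ∷ xs) ((x , y) ∷ σ)

picks-Pick : ∀ {A : Set} (xs : List A) → All (λ p → Pick (proj₁ p) xs (proj₂ p)) (picks xs)
picks-Pick []       = []
picks-Pick (x ∷ xs) = here ∷ All.map⁺ (All.map there (picks-Pick xs))

Pick-length : ∀ {A : Set} {y : A} {xs ys} → Pick y xs ys → length xs ≡ suc (length ys)
Pick-length here      = refl
Pick-length (there p) = cong suc (Pick-length p)

Pick-All : ∀ {A : Set} {P : A → Set} {y xs ys} → Pick y xs ys → All P xs → P y × All P ys
Pick-All here      (p ∷ ps) = p , ps
Pick-All (there i) (p ∷ ps) = proj₁ (Pick-All i ps) , p ∷ proj₂ (Pick-All i ps)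

Pairing-All : ∀ {P : ℕ → Set} {xs σ} → Pairing xs σ → All P xs → All (λ e → P (proj₁ e) × P (proj₂ e)) σ
Pairing-All []      []       = []
Pairing-All (i ∷ r) (p ∷ ps) = (p , proj₁ (Pick-All i ps)) ∷ Pairing-All r (proj₂ (Pick-All i ps))

concatMap-congᴬ : ∀ {A B : Set} {f g : A → List B} {P : A → Set} {xs} →
                  All P xs → (∀ x → P x → f x ≡ g x) → concatMap f xs ≡ concatMap g xs
concatMap-congᴬ []       e = refl
concatMap-congᴬ (p ∷ ps) e = cong₂ _++_ (e _ p) (concatMap-congᴬ ps e)

-- `matchingsOf` needs exactly half the length of the list. Here the number is only a bound on the
-- depth of the recursion, so that `pairings` can depend on the list alone. Lists of odd length
-- occur when points are split in two, and they have no pairings.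
pairingsUpTo : ℕ → List ℕ → List (List Edge)
pairingsUpTo _       []       = [] ∷ []
pairingsUpTo zero    (_ ∷ _)  = []
pairingsUpTo (suc k) (x ∷ xs) =
  concatMap (λ p → map ((x , proj₁ p) ∷_) (pairingsUpTo k (proj₂ p))) (picks xs)

private
  shorter : ∀ {A : Set} {k} {y : A} {xs ys} → Pick y xs ys → suc (length xs) ≤ suc k + suc k → length ys ≤ k + k
  shorter {k = k} {xs = xs} i le = ℕ.≤-pred (ℕ.≤-pred
    (subst (_≤ suc (suc (k + k))) (cong suc (Pick-length i))
        (subst (suc (length xs) ≤_) (cong suc (ℕ.+-suc k k)) le)))

pairingsUpTo-fuel : ∀ k k′ xs → length xs ≤ k + k → length xs ≤ k′ + k′ → pairingsUpTo k xs ≡ pairingsUpTo k′ xs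
pairingsUpTo-fuel k       k′       []       _  _   = refl
pairingsUpTo-fuel (suc k) (suc k′) (x ∷ xs) le le′ = concatMap-congᴬ (picks-Pick xs) λ p i →
  cong (map ((x , proj₁ p) ∷_)) (pairingsUpTo-fuel k k′ (proj₂ p) (shorter i le) (shorter i le′))

pairings : List ℕ → List (List Edge)
pairings xs = pairingsUpTo (length xs) xs

pairings-∷ : ∀ x xs → pairings (x ∷ xs) ≡
             concatMap (λ p → map ((x , proj₁ p) ∷_) (pairings (proj₂ p))) (picks xs)
pairings-∷ x xs = concatMap-congᴬ (picks-Pick xs) λ p i → cong (map ((x , proj₁ p) ∷_))
  (pairingsUpTo-fuel (length xs) (length (proj₂ p)) (proj₂ p)
    (ℕ.≤-trans (ℕ.n≤1+n _) (ℕ.≤-trans (ℕ.≤-reflexive (≡.sym (Pick-length i))) (ℕ.m≤m+n _ _)))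
    (ℕ.m≤m+n _ _))

matchingsOf-pairings : ∀ k xs → length xs ≡ k + k → matchingsOf k xs ≡ pairings xs
matchingsOf-pairings k xs le = ≡.trans (go k xs le)
  (pairingsUpTo-fuel k (length xs) xs (ℕ.≤-reflexive le) (ℕ.m≤m+n _ _))
  where
  go : ∀ k xs → length xs ≡ k + k → matchingsOf k xs ≡ pairingsUpTo k xs
  go zero    []       _  = refl
  go (suc k) (x ∷ xs) le = concatMap-congᴬ (picks-Pick xs) λ p i → cong (map ((x , proj₁ p) ∷_))
    (go k (proj₂ p) (ℕ.suc-injective (≡.trans (≡.sym (Pick-length i))
      (ℕ.suc-injective (≡.trans le (cong suc (ℕ.+-suc k k)))))))

pairings-Pairing : ∀ xs → All (Pairing xs) (pairings xs)
pairings-Pairing xs = go (length xs) xs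
  where
  go : ∀ k xs → All (Pairing xs) (pairingsUpTo k xs)
  go k       []       = [] ∷ []
  go zero    (x ∷ xs) = []
  go (suc k) (x ∷ xs) = All.concat⁺
      (All.map⁺ (All.map (λ i → All.map⁺ (All.map (i ∷_) (go k _))) (picks-Pick xs)))

module PairingSums (R : CommutativeRing 0ℓ 0ℓ) where
  open CommutativeRing R renaming (_≈_ to _≋_; _+_ to _⊞_; _*_ to _⊠_; refl to ≋-refl; zero to ⊠-zero)
  open SetoidReasoning setoid
  open Sums R

  ∑-pairings-∷ : ∀ x xs (F : List Edge → Carrier) →
                 ∑ (pairings (x ∷ xs)) F ≋ ∑ (picks xs) (λ (y , ys) → ∑ (pairings ys) (λ σ → F ((x , y) ∷ σ)))
  ∑-pairings-∷ x xs F = begin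
    ∑ (pairings (x ∷ xs)) F
      ≈⟨ reflexive (cong (λ l → ∑ l F) (pairings-∷ x xs)) ⟩
    ∑ (concatMap (λ p → map ((x , proj₁ p) ∷_) (pairings (proj₂ p))) (picks xs)) F
      ≈⟨ ∑-concatMap _ (picks xs) ⟩
    ∑ (picks xs) (λ (y , ys) → ∑ (map ((x , y) ∷_) (pairings ys)) F)
      ≈⟨ ∑-cong (picks xs) (λ (y , ys) → ∑-map _ (pairings ys)) ⟩
    ∑ (picks xs) (λ (y , ys) → ∑ (pairings ys) (λ σ → F ((x , y) ∷ σ))) ∎

-- Touchard's formula

<ᵇ-true : ∀ {m n} → m < n → (m <ᵇ n) ≡ true
<ᵇ-true {zero}  (s≤s _)       = refl
<ᵇ-true {suc m} (s≤s (s≤s p)) = <ᵇ-true {m} (s≤s p)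

<ᵇ-false : ∀ {m n} → n ≤ m → (m <ᵇ n) ≡ false
<ᵇ-false z≤n     = refl
<ᵇ-false (s≤s p) = <ᵇ-false p

-- A word stands for a partially built matching: a marker is the position of the
-- right end of an arch whose left end has already been removed from the word.
data Item : Set where
  point marker : ℕ → Item

label : Item → ℕ
label (point x)  = x
label (marker x) = x

points : List Item → List ℕ
points []             = []
points (point x ∷ w)  = x ∷ points w
points (marker _ ∷ w) = points w

over : ℕ → Edge → Bool
over m (i , j) = (i <ᵇ m) ∧ (m <ᵇ j)

markersUnder : List Item → Edge → ℕ
markersUnder []             e = 0
markersUnder (point _ ∷ w)  e = markersUnder w e
markersUnder (marker m ∷ w) e = (if over m e then 1 else 0) + markersUnder w e

markersCovered : List Item → List Edge → ℕ
markersCovered w []      = 0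
markersCovered w (e ∷ σ) = markersUnder w e + markersCovered w σ

Closed : Set
Closed = ℕ × ℕ × List Item

-- (k , y , w′): the point y of w, preceded by k markers, becomes a marker in w′
closings : List Item → List Closed
closings []             = []
closings (point x ∷ w)  = (0 , x , marker x ∷ w) ∷ map (λ (k , y , w′) → k , y , point x ∷ w′) (closings w)
closings (marker m ∷ w) = map (λ (k , y , w′) → suc k , y , marker m ∷ w′) (closings w)

data Closing : List Item → ℕ → ℕ → List Item → Set where
  here       : ∀ {x w} → Closing (point x ∷ w) 0 x (marker x ∷ w)
  thereP     : ∀ {x w k y w′} → Closing w k y w′ → Closing (point x ∷ w) k y (point x ∷ w′)
  thereM     : ∀ {m w k y w′} → Closing w k y w′ → Closing (marker m ∷ w) (suc k) y (marker m ∷ w′)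

closings-Closing : ∀ w → All (λ (k , y , w′) → Closing w k y w′) (closings w)
closings-Closing []             = []
closings-Closing (point x ∷ w)  = here ∷ All.map⁺ (All.map thereP (closings-Closing w))
closings-Closing (marker m ∷ w) = All.map⁺ (All.map thereM (closings-Closing w))

Closing-labels : ∀ {w k y w′} → Closing w k y w′ → map label w′ ≡ map label w
Closing-labels here       = refl
Closing-labels (thereP c) = cong (_ ∷_) (Closing-labels c)
Closing-labels (thereM c) = cong (_ ∷_) (Closing-labels c)

Closing-points : ∀ {w k y w′} → Closing w k y w′ → length (points w) ≡ suc (length (points w′))
Closing-points here       = refl
Closing-points (thereP c) = cong suc (Closing-points c)
Closing-points (thereM c) = Closing-points c

Closing-label : ∀ {P : ℕ → Set} {w k y w′} → Closing w k y w′ → All P (map label w) → P y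
Closing-label here       (p ∷ _)  = p
Closing-label (thereP c) (_ ∷ ps) = Closing-label c ps
Closing-label (thereM c) (_ ∷ ps) = Closing-label c ps

picks-closings : ∀ w → picks (points w) ≡ map (λ (k , y , w′) → y , points w′) (closings w)
picks-closings []             = refl
picks-closings (point x ∷ w)  = cong ((x , points w) ∷_)
  (≡.trans (cong (map _) (picks-closings w)) (≡.trans (≡.sym (map-∘ (closings w))) (map-∘ (closings w))))
picks-closings (marker m ∷ w) = ≡.trans (picks-closings w) (map-∘ (closings w))

markersUnder-close : ∀ {w k y w′} → Closing w k y w′ → ∀ e →
                     markersUnder w′ e ≡ (if over y e then 1 else 0) + markersUnder w e
markersUnder-close here               e = refl
markersUnder-close (thereP c)         e = markersUnder-close c e
markersUnder-close (thereM {m} {w} {y = y} c) e = ≡.trans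
  (cong ((if over m e then 1 else 0) +_) (markersUnder-close c e))
  (swap (if over m e then 1 else 0) (if over y e then 1 else 0) (markersUnder w e))
  where
  swap : ∀ a b c → a + (b + c) ≡ b + (a + c)
  swap = solve-∀

markersCovered-close : ∀ {w k y w′} → Closing w k y w′ → ∀ σ →
                       markersCovered w′ σ ≡ count (over y) σ + markersCovered w σ
markersCovered-close c       []      = refl
markersCovered-close {w} {y = y} {w′} c (e ∷ σ) = ≡.trans
  (cong₂ _+_ (markersUnder-close c e) (markersCovered-close c σ))
  (swap (if over y e then 1 else 0) (markersUnder w e) (count (over y) σ) (markersCovered w σ))
  where
  swap : ∀ a b c d → (a + b) + (c + d) ≡ (a + c) + (b + d)
  swap = solve-∀

markersUnder-beyond : ∀ x y w → All (y <_) (map label w) → markersUnder w (x , y) ≡ 0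
markersUnder-beyond x y []             []       = refl
markersUnder-beyond x y (point _ ∷ w)  (_ ∷ ps) = markersUnder-beyond x y w ps
markersUnder-beyond x y (marker m ∷ w) (p ∷ ps) =
  cong₂ (λ b n → (if b then 1 else 0) + n)
    (≡.trans (cong ((x <ᵇ m) ∧_) (<ᵇ-false (ℕ.<⇒≤ p))) (Bool.∧-zeroʳ _)) (markersUnder-beyond x y w ps)

-- All labels lie beyond `x` and increase, so a marker is under the arch from `x` to `y` exactly
-- when it precedes `y` in the word, and `k` counts these markers.
markersUnder-closed : ∀ {x w k y w′} → Closing w k y w′ → All (x <_) (map label w) →
                      AllPairs _<_ (map label w) → markersUnder w (x , y) ≡ k
markersUnder-closed here       _       (a ∷ _)  = markersUnder-beyond _ _ _ a
markersUnder-closed (thereP c) (_ ∷ p) (_ ∷ as) = markersUnder-closed c p as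
markersUnder-closed (thereM c) (x<m ∷ p) (a ∷ as) =
  cong₂ (λ b n → (if b then 1 else 0) + n)
    (cong₂ _∧_ (<ᵇ-true x<m) (<ᵇ-true (Closing-label c a)))
    (markersUnder-closed c p as)

crosses-first : ∀ {x y} e → x < proj₁ e → crosses (x , y) e ≡ over y e
crosses-first {x} {y} (k , l) x<k = ≡.trans
  (cong₂ (λ a b → (a ∧ (k <ᵇ y) ∧ (y <ᵇ l)) ∨ (b ∧ (x <ᵇ l) ∧ (l <ᵇ y)))
    (<ᵇ-true x<k) (<ᵇ-false (ℕ.<⇒≤ x<k)))
  (Bool.∨-identityʳ _)

crossings : List Edge → ℕ
crossings σ = length (crossPairs σ)

crossings-∷ : ∀ e σ → crossings (e ∷ σ) ≡ count (crosses e) σ + crossings σ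
crossings-∷ e σ = ≡.trans (length-++ (row crosses e σ)) (cong (_+ crossings σ) (length-row crosses e σ))

-- A marker ends an arch whose left end lies before the rest of the word, so that arch crosses `e`
-- exactly when the marker lies under `e`. The exponent thus counts the crossings inside `σ` and
-- those of `σ` with the removed arches.
weightExp : List Item → List Edge → ℕ
weightExp w σ = crossings σ + markersCovered w σ

points-All : ∀ {P : ℕ → Set} w → All P (map label w) → All P (points w)
points-All []             []       = []
points-All (point _ ∷ w)  (p ∷ ps) = p ∷ points-All w ps
points-All (marker _ ∷ w) (_ ∷ ps) = points-All w ps

-- The crossings of the new arch with removed arches are the `k` markers that it passes; its
-- crossings with `σ` are not lost, because they return as the arches of `σ` over the new marker
-- `y`.
weightExp-close : ∀ {x w k y w′ σ} → Closing w k y w′ → All (x <_) (map label w) →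
                  AllPairs _<_ (map label w) → Pairing (points w′) σ →
                  weightExp (point x ∷ w) ((x , y) ∷ σ) ≡ k + weightExp w′ σ
weightExp-close {x} {w} {k} {y} {w′} {σ} c x<w asc r = begin
  crossings ((x , y) ∷ σ) + markersCovered (point x ∷ w) ((x , y) ∷ σ)
    ≡⟨ cong₂ _+_ (crossings-∷ (x , y) σ) (cong (_+ _) (markersUnder-closed c x<w asc)) ⟩
  (count (crosses (x , y)) σ + crossings σ) + (k + markersCovered (point x ∷ w) σ)
    ≡⟨ cong₂ (λ a b → (a + crossings σ) + (k + b))
         (count-congᴬ (Pairing-All r (points-All w′ (subst (All (x <_)) (≡.sym (Closing-labels c)) x<w)))
           (λ e p → crosses-first e (proj₁ p))) (same σ) ⟩
  (count (over y) σ + crossings σ) + (k + markersCovered w σ)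
    ≡⟨ shuffle (count (over y) σ) (crossings σ) k (markersCovered w σ) ⟩
  k + (crossings σ + (count (over y) σ + markersCovered w σ))
    ≡⟨ cong (λ a → k + (crossings σ + a)) (markersCovered-close c σ) ⟨
  k + weightExp w′ σ ∎
  where
  open ≡.≡-Reasoning
  same : ∀ σ → markersCovered (point x ∷ w) σ ≡ markersCovered w σ
  same []      = refl
  same (e ∷ σ) = cong (markersUnder w e +_) (same σ)
  shuffle : ∀ a b k c → (a + b) + (k + c) ≡ k + (b + (a + c))
  shuffle = solve-∀

weightExp-marker : ∀ m w σ → All (λ e → m < proj₁ e) σ → weightExp (marker m ∷ w) σ ≡ weightExp w σ
weightExp-marker m w σ m<σ = cong (crossings σ +_) (go σ m<σ)
  where
  go : ∀ σ → All (λ e → m < proj₁ e) σ → markersCovered (marker m ∷ w) σ ≡ markersCovered w σ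
  go []            []       = refl
  go ((i , j) ∷ σ) (p ∷ ps) =
    cong₂ _+_ (cong (λ b → (if b ∧ (m <ᵇ j) then 1 else 0) + markersUnder w (i , j)) (<ᵇ-false (ℕ.<⇒≤ p)))
        (go σ ps)

module Moments (R : CommutativeRing 0ℓ 0ℓ) (q : CommutativeRing.Carrier R) where
  open CommutativeRing R renaming (_≈_ to _≋_; _+_ to _⊞_; _*_ to _⊠_; refl to ≋-refl; zero to ⊠-zero)
  open SemiringSolver commutativeSemiring
  open SetoidReasoning setoid
  open Convolution R
  open Sums R
  open PairingSums R

  bracket : ℕ → Carrier
  bracket zero    = 0#
  bracket (suc h) = 1# ⊞ q ⊠ bracket h

  -- At level `h` this is the oscillator relation: `a a*` has eigenvalue `bracket (suc h)`, `a* a`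
  -- has `bracket h`, and `q^N` has `pow q h`.
  bracket-suc : ∀ h → bracket (suc h) ≋ bracket h ⊞ pow q h
  bracket-suc zero    = solve 1 (λ q → con 1 :+ q :* con 0 := con 0 :+ con 1) ≋-refl q
  bracket-suc (suc h) = trans (+-congˡ (*-congˡ (bracket-suc h)))
    (solve 3 (λ q b p → con 1 :+ q :* (b :+ p) := con 1 :+ q :* b :+ q :* p) ≋-refl q (bracket h) (pow q h))

  -- The matrix entry ⟨h| w |0⟩ of the q-oscillator: a point acts as a + a*, a marker as q^N.
  amplitude : List Item → ℕ → Carrier
  amplitude []             zero    = 1#
  amplitude []             (suc h) = 0#
  amplitude (point _ ∷ w)  h       = amplitude w (suc h) ⊞ bracket h ⊠ amplitude w (pred h)
  amplitude (marker _ ∷ w) h       = pow q h ⊠ amplitude w h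

  -- Commuting a to the right: a (a + a*) = (a + a*) a + q^N, a q^N = q q^N a and a |0⟩ = 0.
  amplitude-lower : ∀ w h → amplitude w (suc h) ≋
                    ∑ (closings w) (λ (k , y , w′) → pow q k ⊠ amplitude w′ h)
  amplitude-lower []             h = ≋-refl
  amplitude-lower (marker m ∷ w) h = begin
    q ⊠ pow q h ⊠ amplitude w (suc h)
      ≈⟨ *-congˡ (amplitude-lower w h) ⟩
    q ⊠ pow q h ⊠ ∑ (closings w) (λ (k , y , w′) → pow q k ⊠ amplitude w′ h)
      ≈⟨ ∑-scale _ (closings w) _ ⟨
    ∑ (closings w) (λ (k , y , w′) → q ⊠ pow q h ⊠ (pow q k ⊠ amplitude w′ h))
      ≈⟨ ∑-cong (closings w) (λ (k , y , w′) →
           solve 4 (λ q a b c → q :* a :* (b :* c) := q :* b :* (a :* c)) ≋-refl q _ _ _) ⟩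
    ∑ (closings w) (λ (k , y , w′) → q ⊠ pow q k ⊠ (pow q h ⊠ amplitude w′ h))
      ≈⟨ ∑-map _ (closings w) ⟨
    ∑ (closings (marker m ∷ w)) (λ (k , y , w′) → pow q k ⊠ amplitude w′ h) ∎
  amplitude-lower (point x ∷ w) h = begin
    amplitude w (suc (suc h)) ⊞ bracket (suc h) ⊠ amplitude w h
      ≈⟨ +-cong (amplitude-lower w (suc h)) (*-congʳ (bracket-suc h)) ⟩
    S (suc h) ⊞ (bracket h ⊞ pow q h) ⊠ amplitude w h
      -- The summand with `pow q h` is set apart: it belongs to the closing of `x` itself, which
      -- passes no marker and puts a marker at the front of the word.
      ≈⟨ solve 4 (λ s b p v → s :+ (b :+ p) :* v := con 1 :* (p :* v) :+ (s :+ b :* v)) ≋-refl _ _ _ _ ⟩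
    1# ⊠ (pow q h ⊠ amplitude w h) ⊞ (S (suc h) ⊞ bracket h ⊠ amplitude w h)
      ≈⟨ +-congˡ (+-congˡ (lowered h)) ⟩
    1# ⊠ (pow q h ⊠ amplitude w h) ⊞ (S (suc h) ⊞ bracket h ⊠ S (pred h))
      ≈⟨ +-congˡ (+-congˡ (∑-scale _ (closings w) _)) ⟨
    1# ⊠ (pow q h ⊠ amplitude w h) ⊞
      (S (suc h) ⊞ ∑ (closings w) (λ (k , y , w′) → bracket h ⊠ (pow q k ⊠ amplitude w′ (pred h))))
      ≈⟨ +-congˡ (∑-⊞ (closings w) _ _) ⟨
    1# ⊠ (pow q h ⊠ amplitude w h) ⊞
      ∑ (closings w) (λ (k , y , w′) → pow q k ⊠ amplitude w′ (suc h) ⊞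
          bracket h ⊠ (pow q k ⊠ amplitude w′ (pred h)))
      ≈⟨ +-congˡ (∑-cong (closings w) (λ (k , y , w′) →
           solve 4 (λ p a b c → p :* a :+ b :* (p :* c) := p :* (a :+ b :* c)) ≋-refl _ _ _ _)) ⟩
    1# ⊠ (pow q h ⊠ amplitude w h) ⊞
      ∑ (closings w) (λ (k , y , w′) → pow q k ⊠ amplitude (point x ∷ w′) h)
      ≈⟨ +-congˡ (∑-map _ (closings w)) ⟨
    ∑ (closings (point x ∷ w)) (λ (k , y , w′) → pow q k ⊠ amplitude w′ h) ∎
    where
    S : ℕ → Carrier
    S h = ∑ (closings w) (λ (k , y , w′) → pow q k ⊠ amplitude w′ h)
    -- At height zero the value of `pred` does not matter, because it is multiplied by
    -- `bracket zero`.
    lowered : ∀ h → bracket h ⊠ amplitude w h ≋ bracket h ⊠ S (pred h)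
    lowered zero    = trans (zeroˡ _) (sym (zeroˡ _))
    lowered (suc h) = *-congˡ (amplitude-lower w h)

  -- A leading marker acts on height 0 as 1 and lies under no arch. A leading point pairs with every
  -- other point, and `amplitude-lower` runs over the same closings. The closed word `w′` is not a
  -- subterm, hence the bound `n` on the number of points, which drops at each arch.
  touchard : ∀ n w → length (points w) ≤ n → AllPairs _<_ (map label w) →
             ∑ (pairings (points w)) (λ σ → pow q (weightExp w σ)) ≋ amplitude w 0
  touchard n []             le asc = +-identityʳ _
  touchard n (marker m ∷ w) le (m<w ∷ asc) = begin
    ∑ (pairings (points w)) (λ σ → pow q (weightExp (marker m ∷ w) σ))
      ≈⟨ ∑-congᴬ (pairings-Pairing (points w)) (λ σ r → reflexive (cong (pow q)
           (weightExp-marker m w σ (All.map proj₁ (Pairing-All r (points-All w m<w)))))) ⟩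
    ∑ (pairings (points w)) (λ σ → pow q (weightExp w σ)) ≈⟨ touchard n w le asc ⟩
    amplitude w 0 ≈⟨ *-identityˡ _ ⟨
    1# ⊠ amplitude w 0 ∎
  touchard (suc n) (point x ∷ w)  (s≤s le) (x<w ∷ asc) = begin
    ∑ (pairings (x ∷ points w)) F
      ≈⟨ ∑-pairings-∷ x (points w) F ⟩
    ∑ (picks (points w)) G
      ≈⟨ reflexive (cong (λ l → ∑ l G) (picks-closings w)) ⟩
    ∑ (map (λ (k , y , w′) → y , points w′) (closings w)) G
      ≈⟨ ∑-map _ (closings w) ⟩
    ∑ (closings w) (λ (k , y , w′) → ∑ (pairings (points w′)) (λ σ → F ((x , y) ∷ σ)))
      ≈⟨ ∑-congᴬ (closings-Closing w) (λ (k , y , w′) c → step c) ⟩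
    ∑ (closings w) (λ (k , y , w′) → pow q k ⊠ amplitude w′ 0)
      ≈⟨ amplitude-lower w 0 ⟨
    amplitude w 1
      ≈⟨ solve 2 (λ a b → a :+ con 0 :* b := a) ≋-refl (amplitude w 1) _ ⟨
    amplitude w 1 ⊞ 0# ⊠ amplitude w 0 ∎
    where
    F : List Edge → Carrier
    F σ = pow q (weightExp (point x ∷ w) σ)
    G : ℕ × List ℕ → Carrier
    G (y , ys) = ∑ (pairings ys) (λ σ → F ((x , y) ∷ σ))
    step : ∀ {k y w′} → Closing w k y w′ →
           ∑ (pairings (points w′)) (λ σ → F ((x , y) ∷ σ)) ≋ pow q k ⊠ amplitude w′ 0
    step {k} {y} {w′} c = begin
      ∑ (pairings (points w′)) (λ σ → F ((x , y) ∷ σ))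
        ≈⟨ ∑-congᴬ (pairings-Pairing (points w′)) (λ σ r → trans
             (reflexive (cong (pow q) (weightExp-close c x<w asc r))) (pow-+ q k _)) ⟩
      ∑ (pairings (points w′)) (λ σ → pow q k ⊠ pow q (weightExp w′ σ))
        ≈⟨ ∑-scale _ (pairings (points w′)) _ ⟩
      pow q k ⊠ ∑ (pairings (points w′)) (λ σ → pow q (weightExp w′ σ))
        ≈⟨ *-congˡ (touchard n w′ le′
             (subst (AllPairs _<_) (≡.sym (Closing-labels c)) asc)) ⟩
      pow q k ⊠ amplitude w′ 0 ∎
      where
      le′ : length (points w′) ≤ n
      le′ = ℕ.≤-trans (ℕ.n≤1+n _) (subst (_≤ n) (Closing-points c) le)

  touchard-points : ∀ xs → AllPairs _<_ xs →
                    ∑ (pairings xs) (λ σ → pow q (crossings σ)) ≋ amplitude (map point xs) 0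
  touchard-points xs asc = begin
    ∑ (pairings xs) (λ σ → pow q (crossings σ))
      ≈⟨ ∑-cong (pairings xs) (λ σ → reflexive (cong (pow q) (≡.sym (noMarkers σ)))) ⟩
    ∑ (pairings xs) (λ σ → pow q (weightExp (map point xs) σ))
      ≈⟨ reflexive (cong (λ l → ∑ (pairings l) (λ σ → pow q (weightExp (map point xs) σ)))
          (≡.sym (points-map xs))) ⟩
    ∑ (pairings (points (map point xs))) (λ σ → pow q (weightExp (map point xs) σ))
      ≈⟨ touchard (length (points (map point xs))) (map point xs) ℕ.≤-refl
          (subst (AllPairs _<_) (labels-map xs) asc) ⟩
    amplitude (map point xs) 0 ∎
    where
    points-map : ∀ xs → points (map point xs) ≡ xs
    points-map []       = refl
    points-map (x ∷ xs) = cong (x ∷_) (points-map xs)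
    labels-map : ∀ xs → xs ≡ map label (map point xs)
    labels-map []       = refl
    labels-map (x ∷ xs) = cong (x ∷_) (labels-map xs)
    under : ∀ xs e → markersUnder (map point xs) e ≡ 0
    under []       e = refl
    under (x ∷ xs) e = under xs e
    covered : ∀ σ → markersCovered (map point xs) σ ≡ 0
    covered []      = refl
    covered (e ∷ σ) = cong₂ _+_ (under xs e) (covered σ)
    noMarkers : ∀ σ → weightExp (map point xs) σ ≡ crossings σ
    noMarkers σ = ≡.trans (cong (crossings σ +_) (covered σ)) (ℕ.+-identityʳ _)

  module _ (a : ℕ → ℕ → Carrier) (a0 : ∀ h → a h 0 ≋ 1#) (a1 : ∀ h → a h 1 ≋ 0#)
           (a2 : ∀ h n → a h (suc (suc n)) ≋ bracket (suc h) ⊠ conv (a (suc h)) (a h) n) where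

    -- Generating functions, in the number of steps, of the weighted paths from height h down to 0,
    -- decomposed at the first descent below h.
    paths : ℕ → ℕ → Carrier
    paths zero    n       = a 0 n
    paths (suc h) zero    = 0#
    paths (suc h) (suc n) = bracket (suc h) ⊠ conv (a (suc h)) (paths h) n

    -- This is the decomposition at the first step, up or down. An excursion from `h` is empty,
    -- which gives the step down, or starts upwards by the continued fraction relation `a2`;
    -- associativity of convolution then regroups the excursion one level higher with the remaining
    -- path.
    paths-step : ∀ h n → paths h (suc n) ≋ paths (suc h) n ⊞ bracket h ⊠ paths (pred h) n
    paths-step zero zero = trans (a1 0) (solve 1 (λ b → con 0 := con 0 :+ con 0 :* b) ≋-refl (a 0 0))
    paths-step zero (suc n) = trans (a2 0 n) (solve 2 (λ a b → a := a :+ con 0 :* b) ≋-refl _ (a 0 (suc n)))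
    paths-step (suc h) zero = trans (*-congˡ (trans (*-congʳ (a0 (suc h))) (*-identityˡ _)))
        (sym (+-identityˡ _))
    paths-step (suc h) (suc zero) = begin
      b ⊠ (a (suc h) 0 ⊠ paths h 1 ⊞ a (suc h) 1 ⊠ paths h 0)
        ≈⟨ *-congˡ (+-cong (*-congʳ (a0 (suc h))) (*-congʳ (a1 (suc h)))) ⟩
      b ⊠ (1# ⊠ paths h 1 ⊞ 0# ⊠ paths h 0)
        ≈⟨ solve 5 (λ b x y c d → b :* (con 1 :* x :+ con 0 :* y) := c :* (d :* con 0) :+ b :* x) ≋-refl
             b (paths h 1) (paths h 0) (bracket (suc (suc h))) (a (suc (suc h)) 0) ⟩
      bracket (suc (suc h)) ⊠ (a (suc (suc h)) 0 ⊠ 0#) ⊞ b ⊠ paths h 1 ∎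
      where b = bracket (suc h)
    -- The first two coefficients of the excursion series are 1 and 0; the others are rewritten with
    -- `a2`.
    paths-step (suc h) (suc (suc n)) = begin
      b ⊠ (f 0 ⊠ p (suc (suc n)) ⊞ (f 1 ⊠ p (suc n) ⊞ conv (λ i → f (suc (suc i))) p n))
        ≈⟨ *-congˡ (+-cong (*-congʳ (a0 (suc h))) (+-cong (*-congʳ (a1 (suc h)))
             (trans (conv-cong (a2 (suc h)) (λ _ → ≋-refl) n) (conv-scale b′ (conv g f) p n)))) ⟩
      b ⊠ (1# ⊠ p (suc (suc n)) ⊞ (0# ⊠ p (suc n) ⊞ b′ ⊠ conv (conv g f) p n))
        ≈⟨ *-congˡ (+-congˡ (+-congˡ (*-congˡ (conv-assoc g f p n)))) ⟩
      b ⊠ (1# ⊠ p (suc (suc n)) ⊞ (0# ⊠ p (suc n) ⊞ b′ ⊠ conv g (conv f p) n))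
        ≈⟨ solve 6 (λ b b′ x y c z → b :* (con 1 :* x :+ (con 0 :* y :+ b′ :* c)) := b′
            :* (b :* c :+ z :* con 0) :+ b :* x)
             ≋-refl b b′ _ _ _ (g (suc n)) ⟩
      b′ ⊠ (b ⊠ conv g (conv f p) n ⊞ g (suc n) ⊠ 0#) ⊞ b ⊠ p (suc (suc n))
        ≈⟨ +-congʳ (*-congˡ (+-congʳ (scaleʳ n))) ⟨
      b′ ⊠ (conv g (λ i → b ⊠ conv f p i) n ⊞ g (suc n) ⊠ 0#) ⊞ b ⊠ p (suc (suc n))
        ≈⟨ +-congʳ (*-congˡ (conv-snoc g (paths (suc h)) n)) ⟨
      b′ ⊠ conv g (paths (suc h)) (suc n) ⊞ b ⊠ p (suc (suc n)) ∎
      where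
      b = bracket (suc h)
      b′ = bracket (suc (suc h))
      f = a (suc h)
      g = a (suc (suc h))
      p = paths h
      scaleʳ : ∀ n → conv g (λ i → b ⊠ conv f p i) n ≋ b ⊠ conv g (conv f p) n
      scaleʳ n = trans (conv-comm g _ n) (trans (conv-scale b (conv f p) g n) (*-congˡ (conv-comm _ g n)))

    amplitude-paths : ∀ xs h → amplitude (map point xs) h ≋ paths h (length xs)
    amplitude-paths []       zero    = sym (a0 0)
    amplitude-paths []       (suc h) = ≋-refl
    amplitude-paths (x ∷ xs) h       =
      trans (+-cong (amplitude-paths xs (suc h)) (*-congˡ (amplitude-paths xs (pred h))))
          (sym (paths-step h (length xs)))

    moment-crossings : ∀ xs → AllPairs _<_ xs →
                       ∑ (pairings xs) (λ σ → pow q (crossings σ)) ≋ a 0 (length xs)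
    moment-crossings xs asc = trans (touchard-points xs asc) (amplitude-paths xs 0)

-- Splitting lists and matchings

≡ᵇ-true : ∀ {m n} → m ≡ n → (m ≡ᵇ n) ≡ true
≡ᵇ-true {zero}  refl = refl
≡ᵇ-true {suc m} refl = ≡ᵇ-true {m} refl

≡ᵇ-false : ∀ {m n} → m ≢ n → (m ≡ᵇ n) ≡ false
≡ᵇ-false {zero}  {zero}  ne = ⊥-elim (ne refl)
≡ᵇ-false {zero}  {suc n} ne = refl
≡ᵇ-false {suc m} {zero}  ne = refl
≡ᵇ-false {suc m} {suc n} ne = ≡ᵇ-false {m} {n} (ne ∘ cong suc)

≡ᵇ-sound : ∀ {m n} → (m ≡ᵇ n) ≡ true → m ≡ n
≡ᵇ-sound {zero}  {zero}  e = refl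
≡ᵇ-sound {suc m} {suc n} e = cong suc (≡ᵇ-sound e)

≡ᵇ-sym : ∀ m n → (m ≡ᵇ n) ≡ (n ≡ᵇ m)
≡ᵇ-sym m n with m ℕ.≟ n
... | yes e = ≡.trans (≡ᵇ-true e) (≡.sym (≡ᵇ-true (≡.sym e)))
... | no ne = ≡.trans (≡ᵇ-false ne) (≡.sym (≡ᵇ-false (ne ∘ ≡.sym)))

splits : {A : Set} → List A → List (List A × List A)
splits []       = ([] , []) ∷ []
splits (x ∷ xs) = map (λ (ys , zs) → x ∷ ys , zs) (splits xs) ++ map (λ (ys , zs) → ys , x ∷ zs) (splits xs)

-- All splits except `(xs , [])`: the left part is strictly shorter than `xs`, as the induction on
-- cumulants requires.
properSplits : {A : Set} → List A → List (List A × List A)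
properSplits []       = []
properSplits (x ∷ xs) = map (λ (ys , zs) → x ∷ ys , zs) (properSplits xs) ++ map (λ (ys , zs) → ys , x ∷ zs)
    (splits xs)

data Split {A : Set} : List A → List A → List A → Set where
  []    : Split [] [] []
  left  : ∀ {x xs ys zs} → Split xs ys zs → Split (x ∷ xs) (x ∷ ys) zs
  right : ∀ {x xs ys zs} → Split xs ys zs → Split (x ∷ xs) ys (x ∷ zs)

splits-Split : ∀ {A : Set} (xs : List A) → All (λ (ys , zs) → Split xs ys zs) (splits xs)
splits-Split []       = [] ∷ []
splits-Split (x ∷ xs) = All.++⁺ (All.map⁺ (All.map left (splits-Split xs)))
    (All.map⁺ (All.map right (splits-Split xs)))

Split-length : ∀ {A : Set} {xs ys zs : List A} → Split xs ys zs → length ys ≤ length xs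
Split-length []        = z≤n
Split-length (left s)  = s≤s (Split-length s)
Split-length (right s) = ℕ.m≤n⇒m≤1+n (Split-length s)

properSplits-Split : ∀ {A : Set} (xs : List A) →
                     All (λ (ys , zs) → Split xs ys zs × length ys < length xs) (properSplits xs)
properSplits-Split []       = []
properSplits-Split (x ∷ xs) = All.++⁺
  (All.map⁺ (All.map (λ (s , lt) → left s , s≤s lt) (properSplits-Split xs)))
  (All.map⁺ (All.map (λ s → right s , s≤s (Split-length s)) (splits-Split xs)))

Split-All : ∀ {A : Set} {P : A → Set} {xs ys zs} → Split xs ys zs → All P xs → All P ys × All P zs
Split-All []        []       = [] , []
Split-All (left s)  (p ∷ ps) = p ∷ proj₁ (Split-All s ps) , proj₂ (Split-All s ps)
Split-All (right s) (p ∷ ps) = proj₁ (Split-All s ps) , p ∷ proj₂ (Split-All s ps)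

Split-AllPairs : ∀ {A : Set} {P : A → A → Set} {xs ys zs} → Split xs ys zs → AllPairs P xs →
    AllPairs P ys × AllPairs P zs
Split-AllPairs []        []       = [] , []
Split-AllPairs (left s)  (p ∷ ps) =
    proj₁ (Split-All s p) ∷ proj₁ (Split-AllPairs s ps) , proj₂ (Split-AllPairs s ps)
Split-AllPairs (right s) (p ∷ ps) =
    proj₁ (Split-AllPairs s ps) , proj₂ (Split-All s p) ∷ proj₂ (Split-AllPairs s ps)

Pick-AllPairs : ∀ {A : Set} {P : A → A → Set} {y xs ys} → Pick y xs ys → AllPairs P xs → AllPairs P ys
Pick-AllPairs here      (_ ∷ ps) = ps
Pick-AllPairs (there i) (p ∷ ps) = proj₂ (Pick-All i p) ∷ Pick-AllPairs i ps

Pairing-ascending : ∀ {xs σ} → Pairing xs σ → AllPairs _<_ xs → AllPairs (λ e f → proj₁ e < proj₁ f) σ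
Pairing-ascending []      []         = []
Pairing-ascending (i ∷ r) (x< ∷ asc) =
  All.map proj₁ (Pairing-All r (proj₂ (Pick-All i x<))) ∷ Pairing-ascending r (Pick-AllPairs i asc)

module SplitSums (R : CommutativeRing 0ℓ 0ℓ) where
  open CommutativeRing R renaming (_≈_ to _≋_; _+_ to _⊞_; _*_ to _⊠_; refl to ≋-refl; zero to ⊠-zero)
  open SemiringSolver commutativeSemiring
  open SetoidReasoning setoid
  open Sums R
  open PairingSums R

  ∑-splits-∷ : ∀ (x : A) xs (F : List A → List A → Carrier) →
               ∑ (splits (x ∷ xs)) (λ (ys , zs) → F ys zs) ≋
               ∑ (splits xs) (λ (ys , zs) → F (x ∷ ys) zs) ⊞ ∑ (splits xs) (λ (ys , zs) → F ys (x ∷ zs))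
  ∑-splits-∷ x xs F = trans (∑-++ (map _ (splits xs)) _) (+-cong (∑-map _ (splits xs)) (∑-map _ (splits xs)))

  ∑-splits-swap : ∀ (xs : List A) (F : List A → List A → Carrier) →
                  ∑ (splits xs) (λ (ys , zs) → F ys zs) ≋ ∑ (splits xs) (λ (ys , zs) → F zs ys)
  ∑-splits-swap []       F = ≋-refl
  ∑-splits-swap (x ∷ xs) F = begin
    ∑ (splits (x ∷ xs)) (λ (ys , zs) → F ys zs) ≈⟨ ∑-splits-∷ x xs F ⟩
    ∑ (splits xs) (λ (ys , zs) → F (x ∷ ys) zs) ⊞ ∑ (splits xs) (λ (ys , zs) → F ys (x ∷ zs))
      ≈⟨ +-cong (∑-splits-swap xs _) (∑-splits-swap xs _) ⟩
    ∑ (splits xs) (λ (ys , zs) → F (x ∷ zs) ys) ⊞ ∑ (splits xs) (λ (ys , zs) → F zs (x ∷ ys))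
      ≈⟨ +-comm _ _ ⟩
    ∑ (splits xs) (λ (ys , zs) → F zs (x ∷ ys)) ⊞ ∑ (splits xs) (λ (ys , zs) → F (x ∷ zs) ys)
      ≈⟨ ∑-splits-∷ x xs (λ ys zs → F zs ys) ⟨
    ∑ (splits (x ∷ xs)) (λ (ys , zs) → F zs ys) ∎

  ∑-splits-proper : ∀ (xs : List A) (F : List A → List A → Carrier) →
                    ∑ (splits xs) (λ (ys , zs) → F ys zs) ≋ F xs [] ⊞
                        ∑ (properSplits xs) (λ (ys , zs) → F ys zs)
  ∑-splits-proper []       F = ≋-refl
  ∑-splits-proper (x ∷ xs) F = begin
    ∑ (splits (x ∷ xs)) (λ (ys , zs) → F ys zs)
      ≈⟨ ∑-splits-∷ x xs F ⟩
    ∑ (splits xs) (λ (ys , zs) → F (x ∷ ys) zs) ⊞ ∑ (splits xs) (λ (ys , zs) → F ys (x ∷ zs))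
      ≈⟨ +-congʳ (∑-splits-proper xs (λ ys → F (x ∷ ys))) ⟩
    (F (x ∷ xs) [] ⊞ ∑ (properSplits xs) (λ (ys , zs) → F (x ∷ ys) zs)) ⊞
        ∑ (splits xs) (λ (ys , zs) → F ys (x ∷ zs))
      ≈⟨ +-assoc _ _ _ ⟩
    F (x ∷ xs) [] ⊞ (∑ (properSplits xs) (λ (ys , zs) → F (x ∷ ys) zs) ⊞
        ∑ (splits xs) (λ (ys , zs) → F ys (x ∷ zs)))
      ≈⟨ +-congˡ (trans (∑-++ (map _ (properSplits xs)) _)
          (+-cong (∑-map _ (properSplits xs)) (∑-map _ (splits xs)))) ⟨
    F (x ∷ xs) [] ⊞ ∑ (properSplits (x ∷ xs)) (λ (ys , zs) → F ys zs) ∎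

  -- Choosing a part and then an element of it amounts to choosing the element first and then
  -- distributing the others.
  ∑-splits-picks : ∀ (xs : List A) (F : A → List A → List A → Carrier) →
                   ∑ (splits xs) (λ (ys , zs) → ∑ (picks ys) (λ (y , ys′) → F y ys′ zs)) ≋
                   ∑ (picks xs) (λ (y , xs′) → ∑ (splits xs′) (λ (ys , zs) → F y ys zs))
  ∑-splits-picks []       F = +-identityˡ _
  ∑-splits-picks {A} (x ∷ xs) F = begin
    ∑ (splits (x ∷ xs)) (λ (ys , zs) → ∑ (picks ys) (λ (y , ys′) → F y ys′ zs))
      ≈⟨ ∑-splits-∷ x xs (λ ys zs → ∑ (picks ys) (λ (y , ys′) → F y ys′ zs)) ⟩
    ∑ (splits xs) (λ (ys , zs) → F x ys zs ⊞ ∑ (map _ (picks ys)) (λ (y , ys′) → F y ys′ zs)) ⊞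
    ∑ (splits xs) (λ (ys , zs) → ∑ (picks ys) (λ (y , ys′) → F y ys′ (x ∷ zs)))
      ≈⟨ +-congʳ (trans (∑-cong (splits xs) (λ (ys , zs) → +-congˡ (∑-map _ (picks ys))))
          (∑-⊞ (splits xs) _ _)) ⟩
    (∑ (splits xs) (λ (ys , zs) → F x ys zs) ⊞
     ∑ (splits xs) (λ (ys , zs) → ∑ (picks ys) (λ (y , ys′) → F y (x ∷ ys′) zs))) ⊞
    ∑ (splits xs) (λ (ys , zs) → ∑ (picks ys) (λ (y , ys′) → F y ys′ (x ∷ zs)))
      ≈⟨ +-cong (+-congˡ (∑-splits-picks xs (λ y ys → F y (x ∷ ys))))
          (∑-splits-picks xs (λ y ys zs → F y ys (x ∷ zs))) ⟩
    (∑ (splits xs) (λ (ys , zs) → F x ys zs) ⊞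
     ∑ (picks xs) (λ (y , xs′) → ∑ (splits xs′) (λ (ys , zs) → F y (x ∷ ys) zs))) ⊞
    ∑ (picks xs) (λ (y , xs′) → ∑ (splits xs′) (λ (ys , zs) → F y ys (x ∷ zs)))
      ≈⟨ +-assoc _ _ _ ⟩
    ∑ (splits xs) (λ (ys , zs) → F x ys zs) ⊞
    (∑ (picks xs) (λ (y , xs′) → ∑ (splits xs′) (λ (ys , zs) → F y (x ∷ ys) zs)) ⊞
     ∑ (picks xs) (λ (y , xs′) → ∑ (splits xs′) (λ (ys , zs) → F y ys (x ∷ zs))))
      ≈⟨ +-congˡ (∑-⊞ (picks xs) _ _) ⟨
    ∑ (splits xs) (λ (ys , zs) → F x ys zs) ⊞
    ∑ (picks xs) (λ (y , xs′) → ∑ (splits xs′) (λ (ys , zs) → F y (x ∷ ys) zs) ⊞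
                                ∑ (splits xs′) (λ (ys , zs) → F y ys (x ∷ zs)))
      ≈⟨ +-congˡ (trans (∑-map _ (picks xs)) (∑-cong (picks xs) (λ (y , xs′) → ∑-splits-∷ x xs′ (F y)))) ⟨
    ∑ (picks (x ∷ xs)) (λ (y , xs′) → ∑ (splits xs′) (λ (ys , zs) → F y ys zs)) ∎

  -- Distributing the arches over two sides distributes their end points, and pairings of two
  -- complementary sets of points combine into one. The induction follows the arch at `x` to the
  -- left (`L`) or to the right (`M`).
  ∑-pairings-splits : ∀ n xs → length xs ≤ n → (H : List Edge → List Edge → Carrier) →
                      ∑ (pairings xs) (λ σ → ∑ (splits σ) (λ (τ , ρ) → H τ ρ)) ≋
                      ∑ (splits xs) (λ (ys , zs) → ∑ (pairings ys) (λ τ → ∑ (pairings zs) (H τ)))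
  ∑-pairings-splits n       []       le       H = +-congʳ (+-congʳ (sym (+-identityʳ _)))
  ∑-pairings-splits (suc n) (x ∷ xs) (s≤s le) H = begin
    ∑ (pairings (x ∷ xs)) (λ σ → ∑ (splits σ) (λ (τ , ρ) → H τ ρ))
      ≈⟨ ∑-pairings-∷ x xs _ ⟩
    ∑ (picks xs) (λ (y , ys) → ∑ (pairings ys) (λ σ → ∑ (splits ((x , y) ∷ σ)) (λ (τ , ρ) → H τ ρ)))
      ≈⟨ ∑-congᴬ (picks-Pick xs) (λ (y , ys) i → trans
           (trans (∑-cong (pairings ys) (λ σ → ∑-splits-∷ (x , y) σ H)) (∑-⊞ (pairings ys) _ _))
           (+-cong (∑-pairings-splits n ys (bound i) (λ τ → H ((x , y) ∷ τ)))
                   (∑-pairings-splits n ys (bound i) (λ τ ρ → H τ ((x , y) ∷ ρ))))) ⟩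
    ∑ (picks xs) (λ (y , xs′) → ∑ (splits xs′) (λ (ys , zs) → L y ys zs) ⊞
        ∑ (splits xs′) (λ (ys , zs) → M y zs ys))
      ≈⟨ ∑-⊞ (picks xs) _ _ ⟩
    ∑ (picks xs) (λ (y , xs′) → ∑ (splits xs′) (λ (ys , zs) → L y ys zs)) ⊞
    ∑ (picks xs) (λ (y , xs′) → ∑ (splits xs′) (λ (ys , zs) → M y zs ys))
      ≈⟨ +-congˡ (∑-cong (picks xs) (λ (y , xs′) → ∑-splits-swap xs′ (λ ys zs → M y zs ys))) ⟩
    ∑ (picks xs) (λ (y , xs′) → ∑ (splits xs′) (λ (ys , zs) → L y ys zs)) ⊞
    ∑ (picks xs) (λ (y , xs′) → ∑ (splits xs′) (λ (ys , zs) → M y ys zs))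
      ≈⟨ +-cong (∑-splits-picks xs L) (∑-splits-picks xs M) ⟨
    ∑ (splits xs) (λ (ys , zs) → ∑ (picks ys) (λ (y , ys′) → L y ys′ zs)) ⊞
    ∑ (splits xs) (λ (ys , zs) → ∑ (picks ys) (λ (y , ys′) → M y ys′ zs))
      ≈⟨ +-congˡ (∑-splits-swap xs (λ ys zs → ∑ (picks ys) (λ (y , ys′) → M y ys′ zs))) ⟩
    ∑ (splits xs) (λ (ys , zs) → ∑ (picks ys) (λ (y , ys′) → L y ys′ zs)) ⊞
    ∑ (splits xs) (λ (ys , zs) → ∑ (picks zs) (λ (y , zs′) → M y zs′ ys))
      ≈⟨ +-cong (∑-cong (splits xs) (λ (ys , zs) → ∑-pairings-∷ x ys _))
                (∑-cong (splits xs) (λ (ys , zs) → trans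
                  (∑-cong (pairings ys) (λ τ → ∑-pairings-∷ x zs (H τ)))
                  (∑-swap (pairings ys) (picks zs) _))) ⟨
    ∑ (splits xs) (λ (ys , zs) → ∑ (pairings (x ∷ ys)) (λ τ → ∑ (pairings zs) (H τ))) ⊞
    ∑ (splits xs) (λ (ys , zs) → ∑ (pairings ys) (λ τ → ∑ (pairings (x ∷ zs)) (H τ)))
      ≈⟨ ∑-splits-∷ x xs (λ ys zs → ∑ (pairings ys) (λ τ → ∑ (pairings zs) (H τ))) ⟨
    ∑ (splits (x ∷ xs)) (λ (ys , zs) → ∑ (pairings ys) (λ τ → ∑ (pairings zs) (H τ))) ∎
    where
    -- `M` takes the side containing the arch at `x` first, so that `∑-splits-picks`, which picks
    -- from the left part, serves both cases.
    L M : ℕ → List ℕ → List ℕ → Carrier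
    L y ys zs = ∑ (pairings ys) (λ τ → ∑ (pairings zs) (λ ρ → H ((x , y) ∷ τ) ρ))
    M y zs ys = ∑ (pairings ys) (λ τ → ∑ (pairings zs) (λ ρ → H τ ((x , y) ∷ ρ)))
    bound : ∀ {y ys} → Pick y xs ys → length ys ≤ n
    bound i = ℕ.≤-trans (ℕ.n≤1+n _) (subst (_≤ n) (Pick-length i) le)

-- Connected spanning subgraphs

-- A labelling ℓ encodes the partition of the vertices into its fibres.
merge : (A → ℕ) → A × A → A → ℕ
merge ℓ (s , t) x = if ℓ x ≡ᵇ (ℓ s ⊔ ℓ t) then ℓ s ⊓ ℓ t else ℓ x

replace : ℕ → ℕ → ℕ → ℕ
replace c d x = if x ≡ᵇ c then d else x

replace-≡ : ∀ {c d x} → x ≡ c → replace c d x ≡ d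
replace-≡ {c} {d} {x} e = cong (λ b → if b then d else x) (≡ᵇ-true e)

replace-≢ : ∀ {c d x} → x ≢ c → replace c d x ≡ x
replace-≢ {c} {d} {x} e = cong (λ b → if b then d else x) (≡ᵇ-false e)

replace-kernel : ∀ c d x y → (replace c d x ≡ᵇ replace c d y) ≡
                 (x ≡ᵇ y) ∨ (((x ≡ᵇ c) ∨ (x ≡ᵇ d)) ∧ ((y ≡ᵇ c) ∨ (y ≡ᵇ d)))
replace-kernel c d x y with x ℕ.≟ c | y ℕ.≟ c
... | yes p | yes r
  rewrite replace-≡ {d = d} p | replace-≡ {d = d} r | ≡ᵇ-true {d} refl | ≡ᵇ-true (≡.trans p (≡.sym r)) = refl
... | yes refl | no r
  rewrite replace-≡ {x} {d} refl | replace-≢ {d = d} r | ≡ᵇ-false (r ∘ ≡.sym) | ≡ᵇ-true {x} refl | ≡ᵇ-false r =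
  ≡ᵇ-sym d y
... | no p | yes refl
  rewrite replace-≡ {y} {d} refl | replace-≢ {d = d} p | ≡ᵇ-false p | ≡ᵇ-true {y} refl =
      ≡.sym (Bool.∧-identityʳ _)
... | no p | no r rewrite replace-≢ {d = d} p | replace-≢ {d = d} r | ≡ᵇ-false p | ≡ᵇ-false r with x ℕ.≟ d
...   | no x≢d rewrite ≡ᵇ-false x≢d = ≡.sym (Bool.∨-identityʳ _)
...   | yes refl rewrite ≡ᵇ-true {x} refl | ≡ᵇ-sym y x = ≡.sym (Bool.∨-idem _)

-- The minimum that survives a merge is invisible here: two vertices agree afterwards when they
-- agreed before or both belong to the classes being joined, whichever label is kept.
merge-kernel : ∀ (ℓ : A → ℕ) s t x y → (merge ℓ (s , t) x ≡ᵇ merge ℓ (s , t) y) ≡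
  (ℓ x ≡ᵇ ℓ y) ∨ (((ℓ x ≡ᵇ ℓ s) ∨ (ℓ x ≡ᵇ ℓ t)) ∧ ((ℓ y ≡ᵇ ℓ s) ∨ (ℓ y ≡ᵇ ℓ t)))
merge-kernel ℓ s t x y with ℕ.≤-total (ℓ s) (ℓ t)
... | inj₁ s≤t rewrite ℕ.m≤n⇒m⊔n≡n s≤t | ℕ.m≤n⇒m⊓n≡m s≤t = ≡.trans (replace-kernel (ℓ t) (ℓ s) (ℓ x) (ℓ y))
  (cong₂ (λ b c → (ℓ x ≡ᵇ ℓ y) ∨ (b ∧ c)) (Bool.∨-comm (ℓ x ≡ᵇ ℓ t) _) (Bool.∨-comm (ℓ y ≡ᵇ ℓ t) _))
... | inj₂ t≤s rewrite ℕ.m≥n⇒m⊔n≡m t≤s | ℕ.m≥n⇒m⊓n≡n t≤s = replace-kernel (ℓ s) (ℓ t) (ℓ x) (ℓ y)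

merge-kernel-cong : ∀ {P : A → Set} (ℓ ℓ′ : A → ℕ) s t → P s → P t →
  (∀ x y → P x → P y → (ℓ x ≡ᵇ ℓ y) ≡ (ℓ′ x ≡ᵇ ℓ′ y)) →
  ∀ x y → P x → P y → (merge ℓ (s , t) x ≡ᵇ merge ℓ (s , t) y) ≡ (merge ℓ′ (s , t) x ≡ᵇ merge ℓ′ (s , t) y)
merge-kernel-cong ℓ ℓ′ s t Ps Pt same x y Px Py = ≡.trans (merge-kernel ℓ s t x y) (≡.trans
  (cong₂ _∨_ (same x y Px Py) (cong₂ _∧_ (cong₂ _∨_ (same x s Px Ps) (same x t Px Pt))
                                         (cong₂ _∨_ (same y s Py Ps) (same y t Py Pt))))
  (≡.sym (merge-kernel ℓ′ s t x y)))

∨-true : ∀ b {c} → b ∨ c ≡ true → b ≡ true ⊎ c ≡ true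
∨-true true  e = inj₁ refl
∨-true false e = inj₂ e

∧-true : ∀ b {c} → b ∧ c ≡ true → b ≡ true × c ≡ true
∧-true true e = refl , e

merge-≡ : ∀ (ℓ : A → ℕ) s t {x y} → merge ℓ (s , t) x ≡ merge ℓ (s , t) y →
          ℓ x ≡ ℓ y ⊎ ((ℓ x ≡ ℓ s ⊎ ℓ x ≡ ℓ t) × (ℓ y ≡ ℓ s ⊎ ℓ y ≡ ℓ t))
merge-≡ ℓ s t {x} {y} e with ∨-true (ℓ x ≡ᵇ ℓ y) (≡.trans (≡.sym (merge-kernel ℓ s t x y)) (≡ᵇ-true e))
... | inj₁ p = inj₁ (≡ᵇ-sound p)
... | inj₂ p = inj₂ (either (proj₁ both) , either (proj₂ both))
  where
  both = ∧-true ((ℓ x ≡ᵇ ℓ s) ∨ (ℓ x ≡ᵇ ℓ t)) p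
  either : ∀ {a b c} → (a ≡ᵇ b) ∨ (a ≡ᵇ c) ≡ true → a ≡ b ⊎ a ≡ c
  either {a} {b} r with ∨-true (a ≡ᵇ b) r
  ... | inj₁ e = inj₁ (≡ᵇ-sound e)
  ... | inj₂ e = inj₂ (≡ᵇ-sound e)

merge-preserves : ∀ (ℓ : A → ℕ) e {x y} → ℓ x ≡ ℓ y → merge ℓ e x ≡ merge ℓ e y
merge-preserves ℓ (s , t) = cong (λ n → if n ≡ᵇ (ℓ s ⊔ ℓ t) then ℓ s ⊓ ℓ t else n)

merge-joins : ∀ (ℓ : A → ℕ) s t → merge ℓ (s , t) s ≡ merge ℓ (s , t) t
merge-joins ℓ s t = ≡ᵇ-sound (≡.trans (merge-kernel ℓ s t s t)
  (≡.trans (cong₂ (λ b c → (ℓ s ≡ᵇ ℓ t) ∨ ((b ∨ (ℓ s ≡ᵇ ℓ t)) ∧ ((ℓ t ≡ᵇ ℓ s) ∨ c))) (≡ᵇ-true {ℓ s} refl)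
      (≡ᵇ-true {ℓ t} refl))
    (≡.trans (cong (λ c → (ℓ s ≡ᵇ ℓ t) ∨ c) (Bool.∨-zeroʳ (ℓ t ≡ᵇ ℓ s))) (Bool.∨-zeroʳ _))))

constant : (A → ℕ) → List A → Bool
constant ℓ []      = true
constant ℓ (v ∷ V) = all (λ u → ℓ u ≡ᵇ ℓ v) V

Saturated : (A → Bool) → (A → ℕ) → Set
Saturated χ ℓ = ∀ x y → ℓ x ≡ ℓ y → χ x ≡ χ y

-- `P` confines the statement to the vertices of the graph; for instance, a left end determines an
-- arch only among the arches of one matching.
merge-saturated : ∀ {P : A → Set} {χ : A → Bool} {ℓ s t} → P s → P t →
  (∀ x y → P x → P y → ℓ x ≡ ℓ y → χ x ≡ χ y) → χ s ≡ χ t →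
  ∀ x y → P x → P y → merge ℓ (s , t) x ≡ merge ℓ (s , t) y → χ x ≡ χ y
merge-saturated {P = P} {χ} {ℓ} {s} {t} Ps Pt sat e x y Px Py m with merge-≡ ℓ s t m
... | inj₁ p       = sat x y Px Py p
... | inj₂ (p , r) = ≡.trans (toS Px p) (≡.sym (toS Py r))
  where
  toS : ∀ {z} → P z → ℓ z ≡ ℓ s ⊎ ℓ z ≡ ℓ t → χ z ≡ χ s
  toS Pz (inj₁ p) = sat _ _ Pz Ps p
  toS Pz (inj₂ p) = ≡.trans (sat _ _ Pz Pt p) (≡.sym e)

merge-Saturated : ∀ {χ : A → Bool} {ℓ s t} → Saturated χ ℓ → χ s ≡ χ t → Saturated χ (merge ℓ (s , t))
merge-Saturated {χ = χ} sat e x y =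
    merge-saturated {P = λ _ → ⊤} {χ = χ} tt tt (λ x y _ _ → sat x y) e x y tt tt

all-cong : ∀ {P : A → Set} {p r : A → Bool} {xs} → All P xs → (∀ x → P x → p x ≡ r x) → all p xs ≡ all r xs
all-cong []       e = refl
all-cong (p ∷ ps) e = cong₂ _∧_ (e _ p) (all-cong ps e)

all-map : ∀ (p : B → Bool) (f : A → B) xs → all p (map f xs) ≡ all (p ∘ f) xs
all-map p f []       = refl
all-map p f (x ∷ xs) = cong (p (f x) ∧_) (all-map p f xs)

both : (A → Bool) → A × A → Bool
both χ (s , t) = χ s ∧ χ t

filterᵇ-++ : ∀ (p : A → Bool) xs {ys} → filterᵇ p (xs ++ ys) ≡ filterᵇ p xs ++ filterᵇ p ys
filterᵇ-++ p []       = refl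
filterᵇ-++ p (x ∷ xs) with p x
... | true  = cong (x ∷_) (filterᵇ-++ p xs)
... | false = filterᵇ-++ p xs

filterᵇ-congᴬ : ∀ {P : A → Set} {p r : A → Bool} {xs} → All P xs → (∀ x → P x → p x ≡ r x) → filterᵇ p xs ≡
    filterᵇ r xs
filterᵇ-congᴬ []       e = refl
filterᵇ-congᴬ {p = p} {r} {x ∷ xs} (a ∷ as) e with p x | r x | e x a
... | true  | .true  | refl = cong (x ∷_) (filterᵇ-congᴬ as e)
... | false | .false | refl = filterᵇ-congᴬ as e

pairs-filter : ∀ (c : A → A → Bool) (χ : A → Bool) xs → pairs c (filterᵇ χ xs) ≡ filterᵇ (both χ) (pairs c xs)
pairs-filter c χ []       = refl
pairs-filter {A} c χ (x ∷ xs) with χ x in eq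
... | true  = ≡.trans (cong₂ _++_ (rowIn xs) (pairs-filter c χ xs)) (≡.sym (filterᵇ-++ (both χ) (row c x xs)))
  where
  rowIn : ∀ ys → row c x (filterᵇ χ ys) ≡ filterᵇ (both χ) (row c x ys)
  rowIn []       = refl
  rowIn (y ∷ ys) with χ y in eqy | c x y in eqc
  ... | true  | true  rewrite eq | eqy | eqc = cong ((x , y) ∷_) (rowIn ys)
  ... | true  | false rewrite eqc = rowIn ys
  ... | false | true  rewrite eq | eqy = rowIn ys
  ... | false | false = rowIn ys
... | false = ≡.trans (pairs-filter c χ xs)
    (≡.sym (≡.trans (filterᵇ-++ (both χ) (row c x xs)) (cong (_++ _) (rowOut xs))))
  where
  rowOut : ∀ ys → filterᵇ (both χ) (row c x ys) ≡ []
  rowOut []       = refl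
  rowOut (y ∷ ys) with c x y
  ... | true rewrite eq = rowOut ys
  ... | false = rowOut ys

_≡?_ : Bool → Bool → Bool
true  ≡? b = b
false ≡? b = not b

all-lookup : ∀ (p : A → Bool) {xs x} → all p xs ≡ true → x ∈ xs → p x ≡ true
all-lookup p {y ∷ ys} e (here refl) = proj₁ (∧-true (p y) e)
all-lookup p {y ∷ ys} e (there i)   = all-lookup p (proj₂ (∧-true (p y) e)) i

all-true : ∀ {p : A → Bool} {xs} → All (λ x → p x ≡ true) xs → all p xs ≡ true
all-true []       = refl
all-true (e ∷ es) = cong₂ _∧_ e (all-true es)

constant-lookup : ∀ (ℓ : A → ℕ) {V x y} → constant ℓ V ≡ true → x ∈ V → y ∈ V → ℓ x ≡ ℓ y
constant-lookup ℓ {v ∷ V} e x∈ y∈ = ≡.trans (root x∈) (≡.sym (root y∈))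
  where
  root : ∀ {z} → z ∈ v ∷ V → ℓ z ≡ ℓ v
  root (here refl) = refl
  root (there i)   = ≡ᵇ-sound (all-lookup _ e i)

constant-true : ∀ (ℓ : A → ℕ) {V} → (∀ {x y} → x ∈ V → y ∈ V → ℓ x ≡ ℓ y) → constant ℓ V ≡ true
constant-true ℓ {[]}    e = refl
constant-true ℓ {v ∷ V} e = all-true (All.tabulate (λ i → ≡ᵇ-true (e (there i) (here refl))))

pairs-All : ∀ {P : A → Set} (c : A → A → Bool) {xs} → All P xs → All (λ (s , t) → P s × P t) (pairs c xs)
pairs-All c []       = []
pairs-All {A} {P} c {x ∷ xs} (p ∷ ps) = All.++⁺ (go ps) (pairs-All c ps)
  where
  go : ∀ {ys} → All P ys → All (λ (s , t) → P s × P t) (row c x ys)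
  go []       = []
  go {y ∷ ys} (r ∷ rs) with c x y
  ... | true  = (p , r) ∷ go rs
  ... | false = go rs

filterᵇ-All : ∀ (p : A → Bool) xs → All (λ x → p x ≡ true) (filterᵇ p xs)
filterᵇ-All p []       = []
filterᵇ-All p (x ∷ xs) with p x in eq
... | true  = eq ∷ filterᵇ-All p xs
... | false = filterᵇ-All p xs

-- The colourings of a list in two colours, extended by `true` to the whole type. Vertices are
-- recognised by `key`, since `A` comes without decidable equality. A root outside the list is
-- `true` in all of them.
colourings : (A → ℕ) → List A → List (A → Bool)
colourings key []       = (λ _ → true) ∷ []
colourings key (x ∷ xs) = colourings key xs ++
  map (λ χ y → if key y ≡ᵇ key x then false else χ y) (colourings key xs)

colourings-Saturated : ∀ (key : A → ℕ) xs → All (λ χ → Saturated χ key) (colourings key xs)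
colourings-Saturated key []       = (λ _ _ _ → refl) ∷ []
colourings-Saturated key (x ∷ xs) = All.++⁺ (colourings-Saturated key xs)
  (All.map⁺ (All.map (λ sat y z e → cong₂ (λ b c → if b then false else c) (cong (_≡ᵇ key x) e) (sat y z e))
    (colourings-Saturated key xs)))

colourings-outside : ∀ (key : A → ℕ) x {xs} → All (λ y → key x ≢ key y) xs →
    All (λ χ → χ x ≡ true) (colourings key xs)
colourings-outside key x []       = refl ∷ []
colourings-outside key x (p ∷ ps) = All.++⁺ (colourings-outside key x ps)
  (All.map⁺ (All.map (λ {χ} e → ≡.trans (cong (λ b → if b then false else χ x) (≡ᵇ-false p)) e)
      (colourings-outside key x ps)))

module GraphSums (R : CommutativeRing 0ℓ 0ℓ) (w : CommutativeRing.Carrier R) where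
  open CommutativeRing R renaming (_≈_ to _≋_; _+_ to _⊞_; _*_ to _⊠_; refl to ≋-refl; zero to ⊠-zero)
  open SemiringSolver commutativeSemiring
  open SetoidReasoning setoid
  open Sums R
  open SplitSums R

  indicator : Bool → Carrier
  indicator b = if b then 1# else 0#

  -- ∑ w^|D| over the D ⊆ E that connect all of V when vertices with equal labels are identified.
  connected : List A → (A → ℕ) → List (A × A) → Carrier
  connected V ℓ []      = indicator (constant ℓ V)
  connected V ℓ (e ∷ E) = connected V ℓ E ⊞ w ⊠ connected V (merge ℓ e) E

  -- Merging and the final test look at labels only through their equality. This permits replacing
  -- the left ends of arches by vertex numbers.
  connected-kernel : ∀ {P : A → Set} V {ℓ ℓ′ : A → ℕ} E → All P V → All (λ (s , t) → P s × P t) E →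
    (∀ x y → P x → P y → (ℓ x ≡ᵇ ℓ y) ≡ (ℓ′ x ≡ᵇ ℓ′ y)) → connected V ℓ E ≡ connected V ℓ′ E
  connected-kernel []      []      PV PE same = refl
  connected-kernel (v ∷ V) []      (Pv ∷ PV) PE same = cong indicator (all-cong PV (λ u Pu → same u v Pu Pv))
  connected-kernel V {ℓ} {ℓ′} ((s , t) ∷ E) PV ((Ps , Pt) ∷ PE) same = cong₂ (λ a b → a ⊞ w ⊠ b)
    (connected-kernel V E PV PE same)
    (connected-kernel V E PV PE (merge-kernel-cong ℓ ℓ′ s t Ps Pt same))

  connected-map : ∀ (f : A → B) V (ℓ : B → ℕ) E →
    connected (map f V) ℓ (map (λ (s , t) → f s , f t) E) ≡ connected V (ℓ ∘ f) E
  connected-map f []      ℓ []      = refl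
  connected-map f (v ∷ V) ℓ []      = cong indicator (all-map _ f V)
  connected-map f V       ℓ (e ∷ E) = cong₂ (λ a b → a ⊞ w ⊠ b) (connected-map f V ℓ E) (connected-map f V _ E)

  -- Edges within the colour classes of `χ` never give one label to vertices of different colours,
  -- so `x` and `y` stay apart in every subgraph.
  connected-zero : ∀ (χ : A → Bool) {V x y} → x ∈ V → y ∈ V → χ x ≢ χ y →
    ∀ {ℓ} → Saturated χ ℓ → ∀ E → All (λ (s , t) → χ s ≡ χ t) E → connected V ℓ E ≋ 0#
  connected-zero χ {V} x∈ y∈ ne {ℓ} sat []       []       with constant ℓ V in eq
  ... | true  = ⊥-elim (ne (sat _ _ (constant-lookup ℓ eq x∈ y∈)))
  ... | false = ≋-refl
  connected-zero χ x∈ y∈ ne sat (e ∷ E) (p ∷ ps) = trans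
    (+-cong (connected-zero χ x∈ y∈ ne sat E ps)
            (*-congˡ (connected-zero χ x∈ y∈ ne (merge-Saturated sat p) E ps)))
    (solve 1 (λ w → con 0 :+ w :* con 0 := con 0) ≋-refl w)

  -- ∑ w^|D| over the D ⊆ E for which the component of v is the set of vertices coloured true.
  rooted : List A → A → (A → Bool) → (A → ℕ) → List (A × A) → Carrier
  rooted V v χ ℓ []      = indicator (all (λ x → χ x ≡? (ℓ x ≡ᵇ ℓ v)) V)
  rooted V v χ ℓ (e ∷ E) = rooted V v χ ℓ E ⊞ w ⊠ rooted V v χ (merge ℓ e) E

  ≡?-sound : ∀ b {c} → (b ≡? c) ≡ true → b ≡ c
  ≡?-sound true          e = ≡.sym e
  ≡?-sound false {false} e = refl

  -- Equal labels stay equal under further merging, so a component can never contain just one of `x`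
  -- and `y`.
  rooted-zero : ∀ {V} {v : A} {χ x y} → x ∈ V → y ∈ V → χ x ≢ χ y →
                ∀ {ℓ} → ℓ x ≡ ℓ y → ∀ E → rooted V v χ ℓ E ≋ 0#
  rooted-zero {V = V} {v} {χ} {x} {y} x∈ y∈ ne {ℓ} e [] with all (λ x → χ x ≡? (ℓ x ≡ᵇ ℓ v)) V in eq
  ... | true  = ⊥-elim (ne (≡.trans (≡?-sound (χ x) (all-lookup (λ x → χ x ≡? (ℓ x ≡ᵇ ℓ v)) eq x∈))
      (≡.trans (cong (_≡ᵇ ℓ v) e)
                  (≡.sym (≡?-sound (χ y) (all-lookup (λ x → χ x ≡? (ℓ x ≡ᵇ ℓ v)) eq y∈))))))
  ... | false = ≋-refl
  rooted-zero x∈ y∈ ne {ℓ} e (f ∷ E) = trans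
    (+-cong (rooted-zero x∈ y∈ ne e E) (*-congˡ (rooted-zero x∈ y∈ ne (merge-preserves ℓ f e) E)))
    (solve 1 (λ w → con 0 :+ w :* con 0 := con 0) ≋-refl w)

  -- An edge between the two colours cannot be chosen. Edges inside the `true` colour have to
  -- connect it, and those inside the `false` colour are free, each contributing the factor
  -- `1# ⊞ w`.
  rooted-splits : ∀ (v : A) V χ → χ v ≡ true → ∀ {ℓ} → Saturated χ ℓ →
    ∀ E → All (λ (s , t) → s ∈ v ∷ V × t ∈ v ∷ V) E →
    rooted (v ∷ V) v χ ℓ E ≋
    connected (v ∷ filterᵇ χ V) ℓ (filterᵇ (both χ) E) ⊠ pow (1# ⊞ w) (length (filterᵇ (both (not ∘ χ)) E))
  rooted-splits v V χ χv {ℓ} sat [] [] = trans (reflexive (cong indicator (≡.trans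
      (cong₂ (λ b c → (b ≡? c) ∧ all (λ x → χ x ≡? (ℓ x ≡ᵇ ℓ v)) V) χv (≡ᵇ-true {ℓ v} refl)) (go V))))
    (sym (*-identityʳ _))
    where
    go : ∀ V → all (λ x → χ x ≡? (ℓ x ≡ᵇ ℓ v)) V ≡ all (λ x → ℓ x ≡ᵇ ℓ v) (filterᵇ χ V)
    go []      = refl
    go (x ∷ V) with χ x in eq
    ... | true  = cong ((ℓ x ≡ᵇ ℓ v) ∧_) (go V)
    ... | false = cong₂ (λ b c → not b ∧ c)
        (≡ᵇ-false {ℓ x} (λ e → true≢false (≡.trans (≡.sym χv) (≡.trans (≡.sym (sat x v e)) eq)))) (go V)
      where
      true≢false : true ≢ false
      true≢false ()
  rooted-splits v V χ χv {ℓ} sat ((s , t) ∷ E) ((s∈ , t∈) ∷ ins) with χ s in eqs | χ t in eqt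
  ... | true  | true  = begin
    rooted (v ∷ V) v χ ℓ E ⊞ w ⊠ rooted (v ∷ V) v χ (merge ℓ (s , t)) E
      ≈⟨ +-cong (rooted-splits v V χ χv sat E ins)
                (*-congˡ (rooted-splits v V χ χv (merge-Saturated sat (≡.trans eqs (≡.sym eqt))) E ins)) ⟩
    _ ⊠ _ ⊞ w ⊠ (_ ⊠ _)
      ≈⟨ solve 4 (λ a p w b → a :* p :+ w :* (b :* p) := (a :+ w :* b) :* p) ≋-refl _ _ w _ ⟩
    _ ∎
  ... | false | false = begin
    rooted (v ∷ V) v χ ℓ E ⊞ w ⊠ rooted (v ∷ V) v χ (merge ℓ (s , t)) E
      ≈⟨ +-cong (rooted-splits v V χ χv sat E ins)
           (*-congˡ (trans (rooted-splits v V χ χv (merge-Saturated sat (≡.trans eqs (≡.sym eqt))) E ins)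
             (*-congʳ (reflexive same)))) ⟩
    _ ⊠ _ ⊞ w ⊠ (_ ⊠ _)
      ≈⟨ solve 3 (λ a p w → a :* p :+ w :* (a :* p) := a :* ((con 1 :+ w) :* p)) ≋-refl _ _ w ⟩
    _ ∎
    where
    apart : ∀ {x y} → χ x ≡ true → χ y ≡ false → (ℓ x ≡ᵇ ℓ y) ≡ false
    apart {x} {y} p r = ≡ᵇ-false (λ e → absurd (≡.trans (≡.sym p) (≡.trans (sat x y e) r)))
      where
      absurd : true ≢ false
      absurd ()
    same : connected (v ∷ filterᵇ χ V) (merge ℓ (s , t)) (filterᵇ (both χ) E) ≡
        connected (v ∷ filterᵇ χ V) ℓ (filterᵇ (both χ) E)
    -- By saturation no `true` vertex shares a label with `s` or `t`, so this merge changes no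
    -- equality of labels among the `true` vertices.
    same = connected-kernel {P = λ x → χ x ≡ true} (v ∷ filterᵇ χ V) (filterᵇ (both χ) E) (χv ∷ filterᵇ-All χ V)
      (All.map (λ {e} → ∧-true (χ (proj₁ e))) (filterᵇ-All (both χ) E))
      (λ x y px py → ≡.trans (merge-kernel ℓ s t x y) (≡.trans
        (cong (λ b → (ℓ x ≡ᵇ ℓ y) ∨ (b ∧ ((ℓ y ≡ᵇ ℓ s) ∨ (ℓ y ≡ᵇ ℓ t))))
            (cong₂ _∨_ (apart px eqs) (apart px eqt)))
        (Bool.∨-identityʳ _)))
  ... | true  | false = trans
    (+-cong (rooted-splits v V χ χv sat E ins)
        (*-congˡ (rooted-zero s∈ t∈ (split eqs eqt) (merge-joins ℓ s t) E)))
    (solve 2 (λ a w → a :+ w :* con 0 := a) ≋-refl _ w)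
    where
    split : χ s ≡ true → χ t ≡ false → χ s ≢ χ t
    split p r e with ≡.trans (≡.sym p) (≡.trans e r)
    ... | ()
  ... | false | true  = trans
    (+-cong (rooted-splits v V χ χv sat E ins)
        (*-congˡ (rooted-zero s∈ t∈ (split eqs eqt) (merge-joins ℓ s t) E)))
    (solve 2 (λ a w → a :+ w :* con 0 := a) ≋-refl _ w)
    where
    split : χ s ≡ false → χ t ≡ true → χ s ≢ χ t
    split p r e with ≡.trans (≡.sym p) (≡.trans e r)
    ... | ()

-- The exponential formula

filterᵇ-cons : ∀ {p : A → Bool} {x} xs → p x ≡ true → filterᵇ p (x ∷ xs) ≡ x ∷ filterᵇ p xs
filterᵇ-cons {p = p} {x} xs e with p x
filterᵇ-cons xs refl | true = refl

filterᵇ-skip : ∀ {p : A → Bool} {x} xs → p x ≡ false → filterᵇ p (x ∷ xs) ≡ filterᵇ p xs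
filterᵇ-skip {p = p} {x} xs e with p x
filterᵇ-skip xs refl | false = refl

module Exponential (R : CommutativeRing 0ℓ 0ℓ) (w : CommutativeRing.Carrier R) where
  open CommutativeRing R renaming (_≈_ to _≋_; _+_ to _⊞_; _*_ to _⊠_; refl to ≋-refl; zero to ⊠-zero)
  open SemiringSolver commutativeSemiring
  open SetoidReasoning setoid
  open Sums R
  open PairingSums R
  open SplitSums R
  open GraphSums R w
  open Mult +-monoid using (×-homo-+; ×-congˡ; ×-congʳ) renaming (_×_ to _ˣ_)
  open GroupProperties +-group using (∙-cancelʳ)

  q : Carrier
  q = 1# ⊞ w

  ∑-colourings-splits : ∀ (key : A → ℕ) V → AllPairs (λ x y → key x ≢ key y) V →
      (F : List A → List A → Carrier) →
    ∑ (colourings key V) (λ χ → F (filterᵇ χ V) (filterᵇ (not ∘ χ) V)) ≋ ∑ (splits V) (λ (S , T) → F S T)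
  ∑-colourings-splits key []      []        F = ≋-refl
  ∑-colourings-splits key (x ∷ V) (ne ∷ un) F = begin
    ∑ (colourings key (x ∷ V)) (G (x ∷ V))
      ≈⟨ ∑-++ (colourings key V) _ ⟩
    ∑ (colourings key V) (G (x ∷ V)) ⊞ ∑ (map _ (colourings key V)) (G (x ∷ V))
      ≈⟨ +-cong (∑-congᴬ (colourings-outside key x ne)
          (λ χ e → reflexive (cong₂ F (filterᵇ-cons V e) (filterᵇ-skip V (cong not e)))))
                (trans (∑-map _ (colourings key V))
                    (∑-cong (colourings key V) (λ χ → reflexive (cong₂ F (drop χ) (keep χ))))) ⟩
    ∑ (colourings key V) (λ χ → F (x ∷ filterᵇ χ V) (filterᵇ (not ∘ χ) V)) ⊞
    ∑ (colourings key V) (λ χ → F (filterᵇ χ V) (x ∷ filterᵇ (not ∘ χ) V))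
      ≈⟨ +-cong (∑-colourings-splits key V un (λ S → F (x ∷ S)))
          (∑-colourings-splits key V un (λ S T → F S (x ∷ T))) ⟩
    ∑ (splits V) (λ (S , T) → F (x ∷ S) T) ⊞ ∑ (splits V) (λ (S , T) → F S (x ∷ T))
      ≈⟨ ∑-splits-∷ x V F ⟨
    ∑ (splits (x ∷ V)) (λ (S , T) → F S T) ∎
    where
    G : List _ → (_ → Bool) → Carrier
    G V χ = F (filterᵇ χ V) (filterᵇ (not ∘ χ) V)
    recolour : (_ → Bool) → _ → Bool
    recolour χ y = if key y ≡ᵇ key x then false else χ y
    atX : ∀ χ → recolour χ x ≡ false
    atX χ = cong (λ b → if b then false else χ x) (≡ᵇ-true {key x} refl)
    off : ∀ χ y → key x ≢ key y → recolour χ y ≡ χ y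
    off χ y ne = cong (λ b → if b then false else χ y) (≡ᵇ-false (ne ∘ ≡.sym))
    drop : ∀ χ → filterᵇ (recolour χ) (x ∷ V) ≡ filterᵇ χ V
    drop χ = ≡.trans (filterᵇ-skip V (atX χ)) (filterᵇ-congᴬ ne (off χ))
    keep : ∀ χ → filterᵇ (not ∘ recolour χ) (x ∷ V) ≡ x ∷ filterᵇ (not ∘ χ) V
    keep χ = ≡.trans (filterᵇ-cons V (cong not (atX χ)))
        (cong (x ∷_) (filterᵇ-congᴬ ne (λ y → cong not ∘ off χ y)))

  -- Exactly one of the enumerated colourings agrees with `f` on all of `V`.
  ∑-colourings-indicator : ∀ (key : A → ℕ) V → AllPairs (λ x y → key x ≢ key y) V → (f : A → Bool) →
    ∑ (colourings key V) (λ χ → indicator (all (λ x → χ x ≡? f x) V)) ≋ 1#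
  ∑-colourings-indicator key []      []        f = +-identityʳ _
  ∑-colourings-indicator key (x ∷ V) (ne ∷ un) f = begin
    ∑ (colourings key (x ∷ V)) (λ χ → indicator (all (λ x → χ x ≡? f x) (x ∷ V)))
      ≈⟨ ∑-++ (colourings key V) _ ⟩
    ∑ (colourings key V) (λ χ → indicator ((χ x ≡? f x) ∧ all (λ x → χ x ≡? f x) V)) ⊞
        ∑ (map _ (colourings key V)) _
      ≈⟨ +-cong (∑-congᴬ (colourings-outside key x ne)
          (λ χ e → reflexive (cong (λ b → indicator ((b ≡? f x) ∧ all (λ x → χ x ≡? f x) V)) e)))
                (trans (∑-map _ (colourings key V))
                    (∑-cong (colourings key V) (λ χ → reflexive (cong₂ (λ b c → indicator ((b ≡? f x) ∧ c))
                   (cong (λ b → if b then false else χ x) (≡ᵇ-true {key x} refl))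
                   (all-cong ne (λ y ne → cong (λ b → (if b then false else χ y) ≡? f y)
                       (≡ᵇ-false (ne ∘ ≡.sym)))))))) ⟩
    ∑ (colourings key V) (λ χ → indicator (f x ∧ all (λ x → χ x ≡? f x) V)) ⊞
    ∑ (colourings key V) (λ χ → indicator (not (f x) ∧ all (λ x → χ x ≡? f x) V))
      ≈⟨ cases (f x) ⟩
    1# ∎
    where
    cases : ∀ b → ∑ (colourings key V) (λ χ → indicator (b ∧ all (λ x → χ x ≡? f x) V)) ⊞
                  ∑ (colourings key V) (λ χ → indicator (not b ∧ all (λ x → χ x ≡? f x) V)) ≋ 1#
    cases true  = trans (+-cong (∑-colourings-indicator key V un f)
        (∑-zero (colourings key V) (λ _ → ≋-refl))) (+-identityʳ _)
    cases false = trans (+-cong (∑-zero (colourings key V) (λ _ → ≋-refl))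
        (∑-colourings-indicator key V un f)) (+-identityˡ _)

  -- Each edge set determines the component of `v` and hence a single colouring. Every edge set is
  -- thus counted once, and the sum of `w` to the number of edges over all edge sets is a power of
  -- `q`.
  ∑-rooted : ∀ (key : A → ℕ) v V → All (λ y → key v ≢ key y) V → AllPairs (λ x y → key x ≢ key y) V → ∀ ℓ E →
             ∑ (colourings key V) (λ χ → rooted (v ∷ V) v χ ℓ E) ≋ pow q (length E)
  ∑-rooted key v V ne un ℓ [] = trans
    (∑-congᴬ (colourings-outside key v ne) (λ χ e → reflexive (cong indicator
      (cong₂ (λ b c → (b ≡? c) ∧ all (λ x → χ x ≡? (ℓ x ≡ᵇ ℓ v)) V) e (≡ᵇ-true {ℓ v} refl)))))
    (∑-colourings-indicator key V un (λ x → ℓ x ≡ᵇ ℓ v))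
  ∑-rooted key v V ne un ℓ (e ∷ E) = begin
    ∑ (colourings key V) (λ χ → rooted (v ∷ V) v χ ℓ (e ∷ E))
      ≈⟨ trans (∑-⊞ (colourings key V) _ _) (+-congˡ (∑-scale w (colourings key V) _)) ⟩
    ∑ (colourings key V) (λ χ → rooted (v ∷ V) v χ ℓ E) ⊞
        w ⊠ ∑ (colourings key V) (λ χ → rooted (v ∷ V) v χ (merge ℓ e) E)
      ≈⟨ +-cong (∑-rooted key v V ne un ℓ E) (*-congˡ (∑-rooted key v V ne un (merge ℓ e) E)) ⟩
    pow q (length E) ⊞ w ⊠ pow q (length E)
      ≈⟨ solve 2 (λ w p → p :+ w :* p := (con 1 :+ w) :* p) ≋-refl w _ ⟩
    q ⊠ pow q (length E) ∎

  -- Edge sets are grouped by the vertex set of the component of `v`; by `pairs-filter` the edges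
  -- inside one colour are the edge list of the subgraph induced on that colour.
  ∑-connected-splits : ∀ (key : A → ℕ) (c : A → A → Bool) v V → AllPairs (λ x y → key x ≢ key y) (v ∷ V) →
    pow q (length (pairs c (v ∷ V))) ≋
    ∑ (splits V) (λ (S , T) → connected (v ∷ S) key (pairs c (v ∷ S)) ⊠ pow q (length (pairs c T)))
  ∑-connected-splits key c v V (ne ∷ un) = begin
    pow q (length (pairs c (v ∷ V)))
      ≈⟨ ∑-rooted key v V ne un key (pairs c (v ∷ V)) ⟨
    ∑ (colourings key V) (λ χ → rooted (v ∷ V) v χ key (pairs c (v ∷ V)))
      ≈⟨ ∑-congᴬ (All.zip (colourings-outside key v ne , colourings-Saturated key V)) (λ χ (χv , sat) → trans
           (rooted-splits v V χ χv sat (pairs c (v ∷ V)) (pairs-All c (All.tabulate id)))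
           (reflexive (cong₂ (λ D E → connected (v ∷ filterᵇ χ V) key D ⊠ pow q (length E))
             (≡.trans (≡.sym (pairs-filter c χ (v ∷ V))) (cong (pairs c) (filterᵇ-cons V χv)))
             (≡.trans (≡.sym (pairs-filter c (not ∘ χ) (v ∷ V)))
                 (cong (pairs c) (filterᵇ-skip V (cong not χv))))))) ⟩
    ∑ (colourings key V) (λ χ → F (filterᵇ χ V) (filterᵇ (not ∘ χ) V))
      ≈⟨ ∑-colourings-splits key V un F ⟩
    ∑ (splits V) (λ (S , T) → F S T) ∎
    where
    F : List _ → List _ → Carrier
    F S T = connected (v ∷ S) key (pairs c (v ∷ S)) ⊠ pow q (length (pairs c T))

  connectedWeight : List Edge → Carrier
  connectedWeight σ = connected σ proj₁ (crossPairs σ)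

  crossingMoment connectedMoment : List ℕ → Carrier
  crossingMoment  xs = ∑ (pairings xs) (λ σ → pow q (crossings σ))
  connectedMoment xs = ∑ (pairings xs) connectedWeight

  -- The component of the first arch splits the other arches. `∑-pairings-splits` turns this into a
  -- splitting of points, and `∑-splits-picks` puts the partner `y` of `x` on the side of the
  -- component.
  crossingMoment-splits : ∀ x xs → AllPairs _<_ (x ∷ xs) →
    crossingMoment (x ∷ xs) ≋ ∑ (splits xs) (λ (ys , zs) → connectedMoment (x ∷ ys) ⊠ crossingMoment zs)
  crossingMoment-splits x xs (x< ∷ asc) = begin
    crossingMoment (x ∷ xs)
      ≈⟨ ∑-pairings-∷ x xs _ ⟩
    ∑ (picks xs) (λ (y , ys) → ∑ (pairings ys) (λ σ → pow q (crossings ((x , y) ∷ σ))))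
      ≈⟨ ∑-congᴬ (picks-Pick xs) (λ (y , ys) i → begin
           ∑ (pairings ys) (λ σ → pow q (crossings ((x , y) ∷ σ)))
             ≈⟨ ∑-congᴬ (pairings-Pairing ys) (λ σ r → ∑-connected-splits proj₁ crosses (x , y) σ
                  (AllPairs.map ℕ.<⇒≢ (Pairing-ascending (i ∷ r) (x< ∷ asc)))) ⟩
           ∑ (pairings ys) (λ σ → ∑ (splits σ) (λ (τ , ρ) → H y τ ρ))
             ≈⟨ ∑-pairings-splits (length ys) ys ℕ.≤-refl (H y) ⟩
           ∑ (splits ys) (λ (us , zs) → ∑ (pairings us) (λ τ → ∑ (pairings zs) (H y τ)))
             ≈⟨ ∑-cong (splits ys) (λ (us , zs) → trans
                  (∑-cong (pairings us) (λ τ → ∑-scale _ (pairings zs) _)) (∑-scaleʳ _ (pairings us) _)) ⟩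
           ∑ (splits ys) (λ (us , zs) → ∑ (pairings us) (λ τ → connectedWeight ((x , y) ∷ τ))
               ⊠ crossingMoment zs) ∎) ⟩
    ∑ (picks xs) (λ (y , ys) → ∑ (splits ys) (λ (us , zs) →
      ∑ (pairings us) (λ τ → connectedWeight ((x , y) ∷ τ)) ⊠ crossingMoment zs))
      ≈⟨ ∑-splits-picks xs (λ y us zs →
          ∑ (pairings us) (λ τ → connectedWeight ((x , y) ∷ τ)) ⊠ crossingMoment zs) ⟨
    ∑ (splits xs) (λ (us , zs) → ∑ (picks us) (λ (y , us′) →
      ∑ (pairings us′) (λ τ → connectedWeight ((x , y) ∷ τ)) ⊠ crossingMoment zs))
      ≈⟨ ∑-cong (splits xs) (λ (us , zs) →
          trans (*-congʳ (∑-pairings-∷ x us connectedWeight)) (sym (∑-scaleʳ _ (picks us) _))) ⟨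
    ∑ (splits xs) (λ (us , zs) → connectedMoment (x ∷ us) ⊠ crossingMoment zs) ∎
    where
    H : ℕ → List Edge → List Edge → Carrier
    H y τ ρ = connectedWeight ((x , y) ∷ τ) ⊠ pow q (crossings ρ)

  -- Both sequences satisfy the same recursion. In the term of the full split the cofactor is `m 0`,
  -- which is 1; all other terms involve shorter lists, agree by induction and cancel.
  connectedMoment-unique : ∀ (m k : ℕ → Carrier) → m 0 ≋ 1# →
    (∀ xs → AllPairs _<_ xs → crossingMoment xs ≋ m (length xs)) →
    (∀ {A : Set} (xs : List A) → m (suc (length xs)) ≋
        ∑ (splits xs) (λ (ys , zs) → k (suc (length ys)) ⊠ m (length zs))) →
    ∀ n x xs → length xs ≤ n → AllPairs _<_ (x ∷ xs) → connectedMoment (x ∷ xs) ≋ k (suc (length xs))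
  connectedMoment-unique m k m0 moment cumulant = go
    where
    go : ∀ n x xs → length xs ≤ n → AllPairs _<_ (x ∷ xs) → connectedMoment (x ∷ xs) ≋ k (suc (length xs))
    go n x xs le (x< ∷ asc) = begin
      connectedMoment (x ∷ xs)      ≈⟨ *-identityʳ _ ⟨
      connectedMoment (x ∷ xs) ⊠ 1# ≈⟨ ∙-cancelʳ rest _ _ (begin
        connectedMoment (x ∷ xs) ⊠ 1# ⊞ rest
          ≈⟨ +-cong (*-congˡ (+-identityʳ 1#)) (∑-congᴬ (properSplits-Split xs) (λ (ys , zs) (s , lt) →
               *-cong (smaller n le s lt) (moment zs (proj₂ (Split-AllPairs s asc))))) ⟨
        connectedMoment (x ∷ xs) ⊠ crossingMoment [] ⊞
          ∑ (properSplits xs) (λ (ys , zs) → connectedMoment (x ∷ ys) ⊠ crossingMoment zs)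
          ≈⟨ ∑-splits-proper xs (λ ys zs → connectedMoment (x ∷ ys) ⊠ crossingMoment zs) ⟨
        ∑ (splits xs) (λ (ys , zs) → connectedMoment (x ∷ ys) ⊠ crossingMoment zs)
          ≈⟨ crossingMoment-splits x xs (x< ∷ asc) ⟨
        crossingMoment (x ∷ xs)
          ≈⟨ moment (x ∷ xs) (x< ∷ asc) ⟩
        m (suc (length xs))
          ≈⟨ cumulant xs ⟩
        ∑ (splits xs) (λ (ys , zs) → k (suc (length ys)) ⊠ m (length zs))
          ≈⟨ ∑-splits-proper xs (λ ys zs → k (suc (length ys)) ⊠ m (length zs)) ⟩
        k (suc (length xs)) ⊠ m 0 ⊞ rest
          ≈⟨ +-congʳ (*-congˡ m0) ⟩
        k (suc (length xs)) ⊠ 1# ⊞ rest ∎) ⟩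
      k (suc (length xs)) ⊠ 1#      ≈⟨ *-identityʳ _ ⟩
      k (suc (length xs)) ∎
      where
      rest : Carrier
      rest = ∑ (properSplits xs) (λ (ys , zs) → k (suc (length ys)) ⊠ m (length zs))
      smaller : ∀ n {ys zs} → length xs ≤ n → Split xs ys zs → length ys < length xs →
          connectedMoment (x ∷ ys) ≋ k (suc (length ys))
      smaller zero    le s lt = ⊥-elim (ℕ.n≮0 (ℕ.<-≤-trans lt le))
      smaller (suc n) le s lt = go n x _ (ℕ.≤-pred (ℕ.≤-trans lt le))
          (proj₁ (Split-All s x<) ∷ proj₁ (Split-AllPairs s asc))

  -- Binomial coefficients count splits by the length of the left part, and Pascal's rule is the
  -- recursion of `splits`. The bound `N` is left free because the two halves of the recursion use
  -- different bounds; the surplus terms vanish.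
  ∑-binomial-splits : ∀ (xs : List A) N → length xs < N → (g : ℕ → ℕ → Carrier) →
    ∑ (upTo N) (λ i → (length xs C i) ˣ g i (length xs ∸ i)) ≋
        ∑ (splits xs) (λ (ys , zs) → g (length ys) (length zs))
  ∑-binomial-splits []       (suc N) lt g = trans (∑-upTo-suc N (λ i → (0 C i) ˣ g i (0 ∸ i)))
    (+-cong (+-identityʳ _) (∑-zero (upTo N) (λ i → ×-congˡ {g (suc i) 0} (k>n⇒nCk≡0 (s≤s (z≤n {i}))))))
  ∑-binomial-splits (x ∷ xs) (suc N) (s≤s lt) g = begin
    ∑ (upTo (suc N)) (λ i → (suc n C i) ˣ g i (suc n ∸ i))
      ≈⟨ ∑-upTo-suc N _ ⟩
    (suc n C 0) ˣ g 0 (suc n) ⊞ ∑ (upTo N) (λ i → (suc n C suc i) ˣ g (suc i) (n ∸ i))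
      ≈⟨ +-cong (×-congˡ {g 0 (suc n)} (≡.trans (C-0 (suc n)) (≡.sym (C-0 n))))
           (∑-cong (upTo N) (λ i → trans (×-congˡ {g (suc i) (n ∸ i)} (≡.sym (nCk+nC[k+1]≡[n+1]C[k+1] n i)))
             (trans (×-homo-+ (g (suc i) (n ∸ i)) (n C i) (n C suc i)) (+-congˡ (shift i))))) ⟩
    (n C 0) ˣ g 0 (suc n) ⊞ ∑ (upTo N)
        (λ i → (n C i) ˣ g (suc i) (n ∸ i) ⊞ (n C suc i) ˣ g (suc i) (suc (n ∸ suc i)))
      ≈⟨ +-congˡ (∑-⊞ (upTo N) _ _) ⟩
    (n C 0) ˣ g 0 (suc n) ⊞ (∑ (upTo N) (λ i → (n C i) ˣ g (suc i) (n ∸ i)) ⊞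
                            ∑ (upTo N) (λ i → (n C suc i) ˣ g (suc i) (suc (n ∸ suc i))))
      ≈⟨ solve 3 (λ a b c → a :+ (b :+ c) := b :+ (a :+ c)) ≋-refl _ _ _ ⟩
    ∑ (upTo N) (λ i → (n C i) ˣ g (suc i) (n ∸ i)) ⊞
      ((n C 0) ˣ g 0 (suc n) ⊞ ∑ (upTo N) (λ i → (n C suc i) ˣ g (suc i) (suc (n ∸ suc i))))
      ≈⟨ +-congˡ (∑-upTo-suc N (λ i → (n C i) ˣ g i (suc (n ∸ i)))) ⟨
    ∑ (upTo N) (λ i → (n C i) ˣ g (suc i) (n ∸ i)) ⊞ ∑ (upTo (suc N)) (λ i → (n C i) ˣ g i (suc (n ∸ i)))
      ≈⟨ +-cong (∑-binomial-splits xs N lt (λ i → g (suc i)))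
                (∑-binomial-splits xs (suc N) (ℕ.m<n⇒m<1+n lt) (λ i j → g i (suc j))) ⟩
    ∑ (splits xs) (λ (ys , zs) → g (suc (length ys)) (length zs)) ⊞
        ∑ (splits xs) (λ (ys , zs) → g (length ys) (suc (length zs)))
      ≈⟨ ∑-splits-∷ x xs (λ ys zs → g (length ys) (length zs)) ⟨
    ∑ (splits (x ∷ xs)) (λ (ys , zs) → g (length ys) (length zs)) ∎
    where
    n = length xs
    C-0 : ∀ n → n C 0 ≡ 1
    C-0 n = ≡.trans (nCk≡nC[n∸k] {k = 0} {n = n} z≤n) (nCn≡1 n)
    -- The two second arguments differ once truncated subtraction sets in, and there the binomial
    -- coefficient is zero.
    shift : ∀ i → (n C suc i) ˣ g (suc i) (n ∸ i) ≋ (n C suc i) ˣ g (suc i) (suc (n ∸ suc i))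
    shift i with suc i ℕ.≤? n
    ... | yes i<n = reflexive (cong (λ j → (n C suc i) ˣ g (suc i) j) (ℕ.+-∸-assoc 1 i<n))
    ... | no  i≮n = trans (×-congˡ {g (suc i) (n ∸ i)} (k>n⇒nCk≡0 (ℕ.≰⇒> i≮n)))
        (sym (×-congˡ {g (suc i) (suc (n ∸ suc i))} (k>n⇒nCk≡0 (ℕ.≰⇒> i≮n))))

-- Counting connected components

true≢false : true ≢ false
true≢false ()

count-upTo-suc : ∀ (p : ℕ → Bool) n → count p (upTo (suc n)) ≡ (if p 0 then 1 else 0) + count (p ∘ suc) (upTo n)
count-upTo-suc p n = cong ((if p 0 then 1 else 0) +_)
  (≡.trans (cong (count p) (≡.sym (map-applyUpTo id suc n))) (go (upTo n)))
  where
  go : ∀ xs → count p (map suc xs) ≡ count (p ∘ suc) xs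
  go []       = refl
  go (x ∷ xs) = cong ((if p (suc x) then 1 else 0) +_) (go xs)

count-≤ : ∀ (p : A → Bool) xs → count p xs ≤ length xs
count-≤ p []       = z≤n
count-≤ p (x ∷ xs) with p x
... | true  = s≤s (count-≤ p xs)
... | false = ℕ.m≤n⇒m≤1+n (count-≤ p xs)

count-zero : ∀ {p : A → Bool} {xs} → All (λ x → p x ≡ false) xs → count p xs ≡ 0
count-zero []       = refl
count-zero (e ∷ es) = cong₂ (λ b n → (if b then 1 else 0) + n) e (count-zero es)

count-zero⁻ : ∀ (p : A → Bool) xs → count p xs ≡ 0 → All (λ x → p x ≡ false) xs
count-zero⁻ p []       e = []
count-zero⁻ p (x ∷ xs) e with p x in eq
... | false = eq ∷ count-zero⁻ p xs e

count-filter : ∀ (p : A → Bool) xs → length (filterᵇ p xs) ≡ count p xs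
count-filter p []       = refl
count-filter p (x ∷ xs) with p x
... | true  = cong suc (count-filter p xs)
... | false = count-filter p xs

count-grows : ∀ {p r : A → Bool} xs → (∀ x → p x ≡ true → r x ≡ true) →
              All (λ x → r x ≡ p x) xs × count p xs ≡ count r xs ⊎ count p xs < count r xs
count-grows []       mono = inj₁ ([] , refl)
count-grows {p = p} {r} (x ∷ xs) mono with p x in eqp | r x in eqr | count-grows xs mono
... | true  | true  | inj₁ (es , e) = inj₁ (≡.trans eqr (≡.sym eqp) ∷ es , cong suc e)
... | true  | true  | inj₂ lt       = inj₂ (s≤s lt)
... | true  | false | _             = ⊥-elim (true≢false (≡.trans (≡.sym (mono x eqp)) eqr))
... | false | true  | inj₁ (es , e) = inj₂ (s≤s (ℕ.≤-reflexive e))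
... | false | true  | inj₂ lt       = inj₂ (ℕ.m≤n⇒m≤1+n lt)
... | false | false | inj₁ (es , e) = inj₁ (≡.trans eqr (≡.sym eqp) ∷ es , e)
... | false | false | inj₂ lt       = inj₂ lt

count-add : ∀ {p r s : A → Bool} xs →
    (∀ x → (if p x then 1 else 0) ≡ (if r x then 1 else 0) + (if s x then 1 else 0)) →
            count p xs ≡ count r xs + count s xs
count-add []       e = refl
count-add {p = p} {r} {s} (x ∷ xs) e = ≡.trans (cong₂ _+_ (e x) (count-add {p = p} {r} {s} xs e))
  (swap (if r x then 1 else 0) (if s x then 1 else 0) (count r xs) (count s xs))
  where
  swap : ∀ a b c d → (a + b) + (c + d) ≡ (a + c) + (b + d)
  swap = solve-∀

count-point : ∀ {m n} → m < n → count (_≡ᵇ m) (upTo n) ≡ 1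
count-point {zero}  {suc n} lt =
    ≡.trans (count-upTo-suc (_≡ᵇ 0) n) (cong suc (count-zero (All.tabulate {xs = upTo n} (λ _ → refl))))
count-point {suc m} {suc n} (s≤s lt) = ≡.trans (count-upTo-suc (_≡ᵇ suc m) n) (count-point lt)

-- Every class carries its least vertex as label: `ℓ i` belongs to the class of `i` and is at most
-- each of its members. Hence `roots` counts classes. Keeping the minimum in `merge` preserves this.
Canonical : (ℕ → ℕ) → Set
Canonical ℓ = (∀ i → ℓ i ≤ i) × (∀ i → ℓ (ℓ i) ≡ ℓ i)

roots : (ℕ → ℕ) → ℕ → ℕ
roots ℓ n = count (λ i → ℓ i ≡ᵇ i) (upTo n)

⊓-label : ∀ (ℓ : ℕ → ℕ) s t → Canonical ℓ → ℓ (ℓ s ⊓ ℓ t) ≡ ℓ s ⊓ ℓ t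
⊓-label ℓ s t (_ , idem) with ℕ.⊓-sel (ℓ s) (ℓ t)
... | inj₁ e = ≡.trans (cong ℓ e) (≡.trans (idem s) (≡.sym e))
... | inj₂ e = ≡.trans (cong ℓ e) (≡.trans (idem t) (≡.sym e))

⊔-label : ∀ (ℓ : ℕ → ℕ) s t → Canonical ℓ → ℓ (ℓ s ⊔ ℓ t) ≡ ℓ s ⊔ ℓ t
⊔-label ℓ s t (_ , idem) with ℕ.⊔-sel (ℓ s) (ℓ t)
... | inj₁ e = ≡.trans (cong ℓ e) (≡.trans (idem s) (≡.sym e))
... | inj₂ e = ≡.trans (cong ℓ e) (≡.trans (idem t) (≡.sym e))

merge-Canonical : ∀ ℓ e → Canonical ℓ → Canonical (merge ℓ e)
merge-Canonical ℓ (s , t) can@(le , idem) = le′ , idem′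
  where
  M = ℓ s ⊔ ℓ t
  m = ℓ s ⊓ ℓ t
  m≤M : m ≤ M
  m≤M = ℕ.≤-trans (ℕ.m⊓n≤m (ℓ s) (ℓ t)) (ℕ.m≤m⊔n (ℓ s) (ℓ t))
  le′ : ∀ i → merge ℓ (s , t) i ≤ i
  le′ i with ℓ i ℕ.≟ M
  ... | yes e = subst (_≤ i) (≡.sym (replace-≡ e)) (ℕ.≤-trans m≤M (subst (_≤ i) e (le i)))
  ... | no ne = subst (_≤ i) (≡.sym (replace-≢ ne)) (le i)
  idem′ : ∀ i → merge ℓ (s , t) (merge ℓ (s , t) i) ≡ merge ℓ (s , t) i
  idem′ i with ℓ i ℕ.≟ M
  ... | no ne = ≡.trans (cong (replace M m ∘ ℓ) (replace-≢ ne)) (cong (replace M m) (idem i))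
  ... | yes e = ≡.trans (cong (replace M m ∘ ℓ) (replace-≡ e))
      (≡.trans (cong (replace M m) (⊓-label ℓ s t can)) (≡.trans fixed (≡.sym (replace-≡ e))))
    where
    fixed : replace M m m ≡ m
    fixed with m ℕ.≟ M
    ... | yes e = replace-≡ e
    ... | no ne = replace-≢ ne

merge-same : ∀ (ℓ : A → ℕ) {s t} → ℓ s ≡ ℓ t → ∀ x → merge ℓ (s , t) x ≡ ℓ x
merge-same ℓ {s} {t} e x rewrite e | ℕ.⊔-idem (ℓ t) | ℕ.⊓-idem (ℓ t) with ℓ x ℕ.≟ ℓ t
... | yes p = ≡.trans (replace-≡ p) (≡.sym p)
... | no ne = replace-≢ ne

-- The larger of the two labels is the one root that disappears.
merge-roots : ∀ ℓ {s t n} → Canonical ℓ → ℓ s ≢ ℓ t → s < n → t < n → roots ℓ n ≡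
    suc (roots (merge ℓ (s , t)) n)
merge-roots ℓ {s} {t} {n} can@(le , idem) ne s<n t<n =
  ≡.trans (count-add {p = λ i → ℓ i ≡ᵇ i} {_≡ᵇ M} {λ i → merge ℓ (s , t) i ≡ᵇ i} (upTo n) atVertex)
          (cong (_+ roots (merge ℓ (s , t)) n)
              (count-point (ℕ.⊔-lub (ℕ.≤-<-trans (le s) s<n) (ℕ.≤-<-trans (le t) t<n))))
  where
  M = ℓ s ⊔ ℓ t
  m = ℓ s ⊓ ℓ t
  m≢M : m ≢ M
  m≢M e with ℕ.≤-total (ℓ s) (ℓ t)
  ... | inj₁ p = ne (≡.trans (≡.sym (ℕ.m≤n⇒m⊓n≡m p)) (≡.trans e (ℕ.m≤n⇒m⊔n≡n p)))
  ... | inj₂ p = ne (≡.sym (≡.trans (≡.sym (ℕ.m≥n⇒m⊓n≡n p)) (≡.trans e (ℕ.m≥n⇒m⊔n≡m p))))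
  ⟨_⟩ : Bool → ℕ
  ⟨ b ⟩ = if b then 1 else 0
  atVertex : ∀ i → ⟨ ℓ i ≡ᵇ i ⟩ ≡ ⟨ i ≡ᵇ M ⟩ + ⟨ merge ℓ (s , t) i ≡ᵇ i ⟩
  atVertex i with ℓ i ℕ.≟ M
  ... | no ne = ≡.sym (cong₂ (λ b c → ⟨ b ⟩ + ⟨ c ≡ᵇ i ⟩)
                  (≡ᵇ-false (λ e → ne (≡.trans (cong ℓ e) (⊔-label ℓ s t can)))) (replace-≢ ne))
  ... | yes p with i ℕ.≟ M
  ...   | yes i≡M = ≡.trans (cong ⟨_⟩ (≡ᵇ-true (≡.trans p (≡.sym i≡M)))) (≡.sym (cong₂ (λ b c → ⟨ b ⟩ + ⟨ c ⟩)
                      (≡ᵇ-true i≡M) (≡ᵇ-false (λ e → m≢M (≡.trans (≡.sym (replace-≡ p)) (≡.trans e i≡M))))))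
  ...   | no i≢M  = ≡.trans (cong ⟨_⟩ (≡ᵇ-false (λ e → i≢M (≡.trans (≡.sym e) p))))
      (≡.sym (cong₂ (λ b c → ⟨ b ⟩ + ⟨ c ⟩)
                      (≡ᵇ-false i≢M) (≡ᵇ-false (λ e → m≢M (≡.trans (≡.sym (⊓-label ℓ s t can))
                        (≡.trans (cong ℓ (≡.trans (≡.sym (replace-≡ p)) e)) p))))))

label-0 : ∀ {ℓ} → Canonical ℓ → ℓ 0 ≡ 0
label-0 (le , _) = ℕ.n≤0⇒n≡0 (le 0)

roots-suc : ∀ {ℓ} n → Canonical ℓ → roots ℓ (suc n) ≡ suc (count (λ i → ℓ (suc i) ≡ᵇ suc i) (upTo n))
roots-suc {ℓ} n can = ≡.trans (count-upTo-suc (λ i → ℓ i ≡ᵇ i) n)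
    (cong (λ b → (if b then 1 else 0) + count (λ i → ℓ (suc i) ≡ᵇ suc i) (upTo n)) (≡ᵇ-true (label-0 can)))

constant-roots : ∀ {ℓ} n → Canonical ℓ → constant ℓ (upTo (suc n)) ≡ true → roots ℓ (suc n) ≡ 1
constant-roots {ℓ} n can c = ≡.trans (roots-suc n can)
    (cong suc (count-zero {xs = upTo n} (All.tabulate λ {i} i∈ → ≡ᵇ-false λ e →
  ℕ.0≢1+n (≡.trans (≡.sym (label-0 can))
      (≡.trans (constant-lookup ℓ {upTo (suc n)} c (here refl) (∈-upTo⁺ (s≤s (∈-upTo⁻ i∈)))) e)))))

roots-constant : ∀ {ℓ} n → Canonical ℓ → roots ℓ (suc n) ≡ 1 → constant ℓ (upTo (suc n)) ≡ true
roots-constant {ℓ} n can@(le , idem) r =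
    constant-true ℓ (λ x∈ y∈ → ≡.trans (label0 (∈-upTo⁻ x∈)) (≡.sym (label0 (∈-upTo⁻ y∈))))
  where
  nonroot : All (λ i → (ℓ (suc i) ≡ᵇ suc i) ≡ false) (upTo n)
  nonroot = count-zero⁻ _ (upTo n) (ℕ.suc-injective (≡.trans (≡.sym (roots-suc n can)) r))
  label0 : ∀ {x} → x < suc n → ℓ x ≡ 0
  label0 {x} x<n with ℓ x in eq
  ... | zero  = refl
  ... | suc i = ⊥-elim (true≢false
      (≡.trans (≡.sym (≡ᵇ-true (≡.trans (cong ℓ (≡.sym eq)) (≡.trans (idem x) eq))))
                  (All.lookup nonroot (∈-upTo⁺ (ℕ.≤-pred (ℕ.≤-<-trans (subst (_≤ x) eq (le x)) x<n))))))

mergeAll : (A → ℕ) → List (A × A) → A → ℕ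
mergeAll ℓ []      = ℓ
mergeAll ℓ (e ∷ D) = mergeAll (merge ℓ e) D

mergeAll-preserves : ∀ (ℓ : A → ℕ) D {x y} → ℓ x ≡ ℓ y → mergeAll ℓ D x ≡ mergeAll ℓ D y
mergeAll-preserves ℓ []      e = e
mergeAll-preserves ℓ (f ∷ D) e = mergeAll-preserves (merge ℓ f) D (merge-preserves ℓ f e)

mergeAll-joins : ∀ {A : Set} (ℓ : A → ℕ) D →
    All (λ (e : A × A) → mergeAll ℓ D (proj₁ e) ≡ mergeAll ℓ D (proj₂ e)) D
mergeAll-joins ℓ []            = []
mergeAll-joins ℓ ((s , t) ∷ D) =
    mergeAll-preserves (merge ℓ (s , t)) D (merge-joins ℓ s t) ∷ mergeAll-joins (merge ℓ (s , t)) D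

mergeAll-saturated : ∀ {P : A → Set} {χ : A → Bool} {ℓ} → (∀ x y → P x → P y → ℓ x ≡ ℓ y → χ x ≡ χ y) →
  ∀ {D} → All (λ (s , t) → P s × P t) D → All (λ (s , t) → χ s ≡ χ t) D →
  ∀ x y → P x → P y → mergeAll ℓ D x ≡ mergeAll ℓ D y → χ x ≡ χ y
mergeAll-saturated         sat []               []       = sat
mergeAll-saturated {χ = χ} sat ((Ps , Pt) ∷ PD) (e ∷ es) =
    mergeAll-saturated {χ = χ} (merge-saturated {χ = χ} Ps Pt sat e) PD es

mergeAll-Saturated : ∀ {χ : A → Bool} {ℓ} → Saturated χ ℓ → ∀ {D} → All (λ (s , t) → χ s ≡ χ t) D →
    Saturated χ (mergeAll ℓ D)
mergeAll-Saturated sat []       = sat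
mergeAll-Saturated sat (e ∷ es) = mergeAll-Saturated (merge-Saturated sat e) es

mergeAll-Canonical : ∀ {ℓ} D → Canonical ℓ → Canonical (mergeAll ℓ D)
mergeAll-Canonical []      can = can
mergeAll-Canonical (e ∷ D) can = mergeAll-Canonical D (merge-Canonical _ e can)

EdgesBelow : ℕ → List Edge → Set
EdgesBelow n = All (λ (s , t) → s < n × t < n)

-- An edge joins at most two classes. For connected `D` this bounds the number of edges from below,
-- so that the truncated subtraction in the Tutte exponent is exact.
roots-mergeAll : ∀ {ℓ n D} → Canonical ℓ → EdgesBelow n D → roots ℓ n ≤ length D + roots (mergeAll ℓ D) n
roots-mergeAll {D = []}          can []       = ℕ.≤-refl
roots-mergeAll {ℓ} {n} {(s , t) ∷ D} can ((s< , t<) ∷ ds) =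
    ℕ.≤-trans bound (s≤s (roots-mergeAll (merge-Canonical ℓ (s , t) can) ds))
  where
  bound : roots ℓ n ≤ suc (roots (merge ℓ (s , t)) n)
  bound with ℓ s ℕ.≟ ℓ t
  ... | no ne = ℕ.≤-reflexive (merge-roots ℓ can ne s< t<)
  ... | yes e = ℕ.m≤n⇒m≤1+n (ℕ.≤-reflexive (≡.sym (count-congᴬ (All.universal {P = λ _ → T true} _ (upTo n))
                  (λ i _ → cong (_≡ᵇ i) (merge-same ℓ e i)))))

any-witness : ∀ (p : A → Bool) xs → any p xs ≡ true → ∃ λ x → x ∈ xs × p x ≡ true
any-witness p (x ∷ xs) e with ∨-true (p x) e
... | inj₁ px = x , here refl , px
... | inj₂ e′ with any-witness p xs e′
...   | y , y∈ , py = y , there y∈ , py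

any-true : ∀ (p : A → Bool) {xs x} → x ∈ xs → p x ≡ true → any p xs ≡ true
any-true p {y ∷ ys} (here refl) e rewrite e = refl
any-true p {y ∷ ys} (there i)   e = ≡.trans (cong (p y ∨_) (any-true p i e)) (Bool.∨-zeroʳ _)

any-cong : ∀ {P : A → Set} {p r : A → Bool} {xs} → All P xs → (∀ x → P x → p x ≡ r x) → any p xs ≡ any r xs
any-cong []       e = refl
any-cong (p ∷ ps) e = cong₂ _∨_ (e _ p) (any-cong ps e)

-- Breadth-first reachability and labels

module Reachability (n : ℕ) (D : List Edge) (below : EdgesBelow n D) (i : ℕ) (i<n : i < n) where

  hop : (ℕ → Bool) → ℕ → Edge → Bool
  hop r j e = ((proj₁ e ≡ᵇ j) ∧ r (proj₂ e)) ∨ ((proj₂ e ≡ᵇ j) ∧ r (proj₁ e))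

  step : (ℕ → Bool) → ℕ → Bool
  step r j = any (hop r j) D

  Stable : ℕ → Set
  Stable k = All (λ j → reach D (suc k) i j ≡ reach D k i j) (upTo n)

  stable-at : ∀ k {j} → Stable k → j < n → reach D (suc k) i j ≡ reach D k i j
  stable-at k st j<n = All.lookup st (∈-upTo⁺ j<n)

  stable-suc : ∀ k → Stable k → Stable (suc k)
  stable-suc k st = All.map (λ {j} e → cong₂ _∨_ e (any-cong below λ (s , t) (s< , t<) →
    cong₂ (λ a b → ((s ≡ᵇ j) ∧ a) ∨ ((t ≡ᵇ j) ∧ b)) (stable-at k st t<) (stable-at k st s<))) st

  -- Until it stabilises, the reached set gains a vertex at every step.
  grows : ∀ k → Stable k ⊎ k < count (reach D k i) (upTo n)
  grows zero = inj₂ (ℕ.≤-reflexive (≡.sym (≡.trans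
    (count-congᴬ (All.universal {P = λ _ → T true} _ (upTo n)) (λ j _ → ≡ᵇ-sym i j)) (count-point i<n))))
  grows (suc k) with grows k
  ... | inj₁ st = inj₁ (stable-suc k st)
  ... | inj₂ lt with count-grows {p = reach D k i} {reach D (suc k) i} (upTo n)
                       (λ j e → cong (_∨ step (reach D k i) j) e)
  ...   | inj₁ (st , _) = inj₁ (stable-suc k st)
  ...   | inj₂ lt′      = inj₂ (ℕ.≤-<-trans lt lt′)

  -- Without stabilisation, more than `n` of the `n` vertices would be reached after `n` rounds.
  stable : Stable n
  stable with grows n
  ... | inj₁ st = st
  ... | inj₂ lt = ⊥-elim (ℕ.<⇒≱ lt
      (subst (count (reach D n i) (upTo n) ≤_) (length-upTo n) (count-≤ _ (upTo n))))

  reach-self : ∀ k → reach D k i i ≡ true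
  reach-self zero    = ≡ᵇ-true {i} refl
  reach-self (suc k) = cong (_∨ step (reach D k i) i) (reach-self k)

  reach-edge : All (λ (s , t) → reach D n i s ≡ reach D n i t) D
  reach-edge = All.tabulate λ {(s , t)} e∈ → iff (forth e∈) (back e∈)
    where
    iff : ∀ {b c} → (b ≡ true → c ≡ true) → (c ≡ true → b ≡ true) → b ≡ c
    iff {true}          f g = ≡.sym (f refl)
    iff {false} {false} f g = refl
    iff {false} {true}  f g = g refl
    forth : ∀ {s t} → (s , t) ∈ D → reach D n i s ≡ true → reach D n i t ≡ true
    forth {s} {t} e∈ r = ≡.trans (≡.sym (stable-at n stable (proj₂ (All.lookup below e∈))))
      (≡.trans (cong (reach D n i t ∨_)
          (any-true (hop (reach D n i) t) e∈ (≡.trans (cong (((s ≡ᵇ t) ∧ reach D n i t) ∨_)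
        (cong₂ _∧_ (≡ᵇ-true {t} refl) r)) (Bool.∨-zeroʳ _)))) (Bool.∨-zeroʳ _))
    back : ∀ {s t} → (s , t) ∈ D → reach D n i t ≡ true → reach D n i s ≡ true
    back {s} {t} e∈ r = ≡.trans (≡.sym (stable-at n stable (proj₁ (All.lookup below e∈))))
      (≡.trans (cong (reach D n i s ∨_)
          (any-true (hop (reach D n i) s) e∈
              (cong (_∨ ((t ≡ᵇ s) ∧ reach D n i s)) (cong₂ _∧_ (≡ᵇ-true {s} refl) r)))) (Bool.∨-zeroʳ _))

  -- The reached set is closed under edges by `reach-edge`, hence a union of classes containing that
  -- of `i`; conversely each hop follows an edge and stays in one class.
  reach-label : ∀ {j} → reach D n i j ≡ (mergeAll id D i ≡ᵇ mergeAll id D j)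
  reach-label {j} with mergeAll id D i ℕ.≟ mergeAll id D j
  ... | yes e = ≡.trans (≡.trans (≡.sym
      (mergeAll-Saturated {χ = reach D n i} (λ x y → cong (reach D n i)) reach-edge i j e)) (reach-self n))
                        (≡.sym (≡ᵇ-true e))
  ... | no ne with reach D n i j in eq
  ...   | false = ≡.sym (≡ᵇ-false ne)
  ...   | true  = ⊥-elim (ne (sound n eq))
    where
    L = mergeAll id D
    sound : ∀ k {j} → reach D k i j ≡ true → L i ≡ L j
    sound zero    e = cong L (≡ᵇ-sound e)
    sound (suc k) {j} e with ∨-true (reach D k i j) e
    ... | inj₁ e = sound k e
    ... | inj₂ e with any-witness (hop (reach D k i) j) D e
    ...   | (s , t) , e∈ , p with ∨-true ((s ≡ᵇ j) ∧ reach D k i t) p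
    ...     | inj₁ p = ≡.trans (sound k (proj₂ (∧-true (s ≡ᵇ j) p)))
                         (≡.trans (≡.sym (All.lookup (mergeAll-joins id D) e∈))
                             (cong L (≡ᵇ-sound {s} {j} (proj₁ (∧-true (s ≡ᵇ j) p)))))
    ...     | inj₂ p = ≡.trans (sound k (proj₂ (∧-true (t ≡ᵇ j) p)))
                         (≡.trans (All.lookup (mergeAll-joins id D) e∈)
                             (cong L (≡ᵇ-sound {t} {j} (proj₁ (∧-true (t ≡ᵇ j) p)))))

Canonical-id : Canonical id
Canonical-id = (λ _ → ℕ.≤-refl) , (λ _ → refl)

-- `components` counts the vertices that no smaller vertex reaches. In terms of labels these are the
-- least vertices of the classes, that is, the fixed points of the canonical labelling.
components-roots : ∀ n D → EdgesBelow n D → components n D ≡ roots (mergeAll id D) n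
components-roots n D below = ≡.trans (count-filter _ (upTo n)) (count-congᴬ (All.all-upTo n) λ i i<n → ≡.trans
  (all-cong (All.all-upTo i) (λ j j<i →
      cong not (Reachability.reach-label n D below j (ℕ.<-trans j<i i<n)))) (least i))
  where
  L = mergeAll id D
  can = mergeAll-Canonical D Canonical-id
  least : ∀ i → all (λ j → not (L j ≡ᵇ L i)) (upTo i) ≡ (L i ≡ᵇ i)
  least i with L i ℕ.≟ i
  ... | yes e = ≡.trans (all-true (All.map (λ {j} j<i → cong not (≡ᵇ-false (λ p →
                  ℕ.<⇒≢ (ℕ.≤-<-trans (proj₁ can j) j<i) (≡.trans p e)))) (All.all-upTo i))) (≡.sym (≡ᵇ-true e))
  ... | no ne with all (λ j → not (L j ≡ᵇ L i)) (upTo i) in eq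
  ...   | false = ≡.sym (≡ᵇ-false ne)
  ...   | true  = ⊥-elim (true≢false (≡.trans (≡.sym (all-lookup (λ j → not (L j ≡ᵇ L i)) eq
                    (∈-upTo⁺ (ℕ.≤∧≢⇒< (proj₁ can i) ne)))) (cong not (≡ᵇ-true (proj₂ can i)))))

-- The Tutte polynomial of the crossing graph

sublists-All : ∀ {P : A → Set} xs → All P xs → All (All P) (sublists xs)
sublists-All []       []       = [] ∷ []
sublists-All (x ∷ xs) (p ∷ ps) = All.++⁺ (sublists-All xs ps) (All.map⁺ (All.map (p ∷_) (sublists-All xs ps)))

rank-roots : ∀ n D → EdgesBelow n D → rank n D ≡ n ∸ roots (mergeAll id D) n
rank-roots n D below = cong (n ∸_) (components-roots n D below)

roots-positive : ∀ {ℓ} n → Canonical ℓ → 1 ≤ roots ℓ (suc n)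
roots-positive n can = subst (1 ≤_) (≡.sym (roots-suc n can)) (s≤s z≤n)

roots-id : ∀ n → roots id n ≡ n
roots-id n = ≡.trans (go (upTo n)) (length-upTo n)
  where
  go : ∀ xs → count (λ i → i ≡ᵇ i) xs ≡ length xs
  go []       = refl
  go (x ∷ xs) = cong₂ (λ b n → (if b then 1 else 0) + n) (≡ᵇ-true {x} refl) (go xs)

module TutteSums (R : CommutativeRing 0ℓ 0ℓ) (w : CommutativeRing.Carrier R) where
  open CommutativeRing R renaming (_≈_ to _≋_; _+_ to _⊞_; _*_ to _⊠_; refl to ≋-refl; zero to ⊠-zero)
  open SemiringSolver commutativeSemiring
  open SetoidReasoning setoid
  open Sums R
  open GraphSums R w

  -- By deletion–contraction: an edge joining two classes lowers the number of classes,
  -- and an edge inside a class contributes the factor 1 + w.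
  connected-factor : ∀ (N : Carrier → Set) → N 0# → N 1# → (∀ {x y} → N x → N y → N (x ⊞ y)) →
    (∀ {x} → N x → N ((1# ⊞ w) ⊠ x)) → ∀ n {ℓ} E → Canonical ℓ → EdgesBelow (suc n) E →
    ∃ λ c → N c × connected (upTo (suc n)) ℓ E ≋ pow w (pred (roots ℓ (suc n))) ⊠ c
  connected-factor N N0 N1 N+ Nq n {ℓ} [] can [] with constant ℓ (upTo (suc n)) in eq
  ... | true  = 1# , N1 , trans (sym (*-identityʳ 1#))
      (*-congʳ (reflexive (cong (pow w ∘ pred) (≡.sym (constant-roots n can eq)))))
  ... | false = 0# , N0 , sym (zeroʳ _)
  connected-factor N N0 N1 N+ Nq n {ℓ} ((s , t) ∷ E) can ((s< , t<) ∷ below)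
    with connected-factor N N0 N1 N+ Nq n E can below | ℓ s ℕ.≟ ℓ t
  ... | c , Nc , e | yes ℓs≡ℓt = (1# ⊞ w) ⊠ c , Nq Nc , (begin
    connected V ℓ E ⊞ w ⊠ connected V (merge ℓ (s , t)) E
      ≈⟨ +-congˡ (*-congˡ (reflexive (connected-kernel V E (All.universal {P = λ _ → T true} _ V)
          (All.universal _ E)
           (λ x y _ _ → cong₂ _≡ᵇ_ (merge-same ℓ ℓs≡ℓt x) (merge-same ℓ ℓs≡ℓt y))))) ⟩
    connected V ℓ E ⊞ w ⊠ connected V ℓ E
      ≈⟨ +-cong e (*-congˡ e) ⟩
    p ⊠ c ⊞ w ⊠ (p ⊠ c)
      ≈⟨ solve 3 (λ p c w → p :* c :+ w :* (p :* c) := p :* ((con 1 :+ w) :* c)) ≋-refl _ _ w ⟩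
    p ⊠ ((1# ⊞ w) ⊠ c) ∎)
    where
    V = upTo (suc n)
    p = pow w (pred (roots ℓ (suc n)))
  ... | c , Nc , e | no ℓs≢ℓt with connected-factor N N0 N1 N+ Nq n E (merge-Canonical ℓ (s , t) can) below
  ...   | c′ , Nc′ , e′ = c ⊞ c′ , N+ Nc Nc′ , (begin
    connected V ℓ E ⊞ w ⊠ connected V (merge ℓ (s , t)) E
      ≈⟨ +-cong e (*-congˡ e′) ⟩
    pow w (pred (roots ℓ (suc n))) ⊠ c ⊞ w ⊠ (pow w (pred r) ⊠ c′)
      ≈⟨ +-cong (*-congʳ (reflexive (cong (pow w ∘ pred) (merge-roots ℓ can ℓs≢ℓt s< t<))))
          (sym (*-assoc _ _ _)) ⟩
    pow w r ⊠ c ⊞ pow w (suc (pred r)) ⊠ c′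
      ≈⟨ +-congˡ (*-congʳ (reflexive (cong (pow w)
          (suc-pred (roots-positive n (merge-Canonical ℓ (s , t) can)))))) ⟩
    pow w r ⊠ c ⊞ pow w r ⊠ c′
      ≈⟨ distribˡ _ _ _ ⟨
    pow w r ⊠ (c ⊞ c′)
      ≈⟨ *-congʳ (reflexive (cong (pow w ∘ pred) (merge-roots ℓ can ℓs≢ℓt s< t<))) ⟨
    pow w (pred (roots ℓ (suc n))) ⊠ (c ⊞ c′) ∎)
    where
    V = upTo (suc n)
    r = roots (merge ℓ (s , t)) (suc n)
    suc-pred : ∀ {r} → 1 ≤ r → suc (pred r) ≡ r
    suc-pred (s≤s _) = refl

  connected-sublists : ∀ (V : List A) ℓ E → connected V ℓ E ≋
    ∑ (sublists E) (λ D → indicator (constant (mergeAll ℓ D) V) ⊠ pow w (length D))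
  connected-sublists V ℓ []      = solve 1 (λ i → i := i :* con 1 :+ con 0) ≋-refl _
  connected-sublists V ℓ (e ∷ E) = begin
    connected V ℓ E ⊞ w ⊠ connected V (merge ℓ e) E
      ≈⟨ +-cong (connected-sublists V ℓ E) (*-congˡ (connected-sublists V (merge ℓ e) E)) ⟩
    ∑ (sublists E) (F ℓ) ⊞ w ⊠ ∑ (sublists E) (F (merge ℓ e))
      ≈⟨ +-congˡ (∑-scale w (sublists E) _) ⟨
    ∑ (sublists E) (F ℓ) ⊞ ∑ (sublists E) (λ D → w ⊠ F (merge ℓ e) D)
      ≈⟨ +-congˡ (∑-cong (sublists E) (λ D → solve 3 (λ w i p → w :* (i :* p) := i :* (w :* p)) ≋-refl w _ _)) ⟩
    ∑ (sublists E) (F ℓ) ⊞ ∑ (sublists E) (λ D → F ℓ (e ∷ D))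
      ≈⟨ +-congˡ (∑-map (e ∷_) (sublists E)) ⟨
    ∑ (sublists E) (F ℓ) ⊞ ∑ (map (e ∷_) (sublists E)) (F ℓ)
      ≈⟨ ∑-++ (sublists E) _ ⟨
    ∑ (sublists (e ∷ E)) (F ℓ) ∎
    where
    F : (_ → ℕ) → List _ → Carrier
    F ℓ D = indicator (constant (mergeAll ℓ D) V) ⊠ pow w (length D)

  -- With `z` in the place of `x - 1`, every edge set of smaller rank is killed. A spanning
  -- connected `D` has rank `n`, so the factor `pow w n` completes the exponent to `length D`.
  connected-tutte : ∀ z → z ≋ 0# → ∀ n E → EdgesBelow (suc n) E → constant (mergeAll id E) (upTo (suc n)) ≡
      true →
    pow w n ⊠ ∑ (sublists E) (λ D → pow z (rank (suc n) E ∸ rank (suc n) D) ⊠ pow w (length D ∸ rank (suc n) D))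
    ≋ connected (upTo (suc n)) id E
  connected-tutte z z≋0 n E below con-E = begin
    pow w n ⊠ ∑ (sublists E) (λ D → pow z (rank (suc n) E ∸ rank (suc n) D) ⊠ pow w (length D ∸ rank (suc n) D))
      ≈⟨ ∑-scale _ (sublists E) _ ⟨
    ∑ (sublists E) (λ D → pow w n ⊠ (pow z (rank (suc n) E ∸ rank (suc n) D) ⊠ pow w
        (length D ∸ rank (suc n) D)))
      ≈⟨ ∑-congᴬ (sublists-All E below) term ⟩
    ∑ (sublists E) (λ D → indicator (constant (mergeAll id D) (upTo (suc n))) ⊠ pow w (length D))
      ≈⟨ connected-sublists (upTo (suc n)) id E ⟨
    connected (upTo (suc n)) id E ∎
    where
    rank-spanning : ∀ D → EdgesBelow (suc n) D → constant (mergeAll id D) (upTo (suc n)) ≡ true →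
        rank (suc n) D ≡ n
    rank-spanning D ds c = ≡.trans (rank-roots (suc n) D ds)
        (cong (suc n ∸_) (constant-roots n (mergeAll-Canonical D Canonical-id) c))
    term : ∀ D → EdgesBelow (suc n) D →
           pow w n ⊠ (pow z (rank (suc n) E ∸ rank (suc n) D) ⊠ pow w (length D ∸ rank (suc n) D)) ≋
           indicator (constant (mergeAll id D) (upTo (suc n))) ⊠ pow w (length D)
    term D ds rewrite rank-spanning E below con-E with constant (mergeAll id D) (upTo (suc n)) in eq
    -- The exponent of `z` is 0, and `pow z 0` is 1 although `z` is zero.
    ... | true rewrite rank-spanning D ds eq | ℕ.n∸n≡0 n = begin
      pow w n ⊠ (1# ⊠ pow w (length D ∸ n))
        ≈⟨ solve 2 (λ a b → a :* (con 1 :* b) := con 1 :* (a :* b)) ≋-refl _ _ ⟩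
      1# ⊠ (pow w n ⊠ pow w (length D ∸ n))
        ≈⟨ *-congˡ (trans (sym (pow-+ w n (length D ∸ n))) (reflexive (cong (pow w) (ℕ.m+[n∸m]≡n n≤D)))) ⟩
      1# ⊠ pow w (length D) ∎
      where
      -- Reducing `suc n` classes to a single one takes at least `n` edges.
      n≤D : n ≤ length D
      n≤D = ℕ.≤-pred (subst₂ _≤_ (roots-id (suc n))
          (≡.trans (cong (length D +_) (constant-roots n (mergeAll-Canonical D Canonical-id) eq))
              (ℕ.+-comm (length D) 1))
              (roots-mergeAll Canonical-id ds))
    ... | false = trans (*-congˡ (trans (*-congʳ vanishes) (zeroˡ _))) (trans (zeroʳ _) (sym (zeroˡ _)))
      where
      can = mergeAll-Canonical D Canonical-id
      2≤roots : 2 ≤ roots (mergeAll id D) (suc n)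
      2≤roots = ℕ.≤∧≢⇒< (roots-positive n can)
          (λ e → true≢false (≡.trans (≡.sym (roots-constant n can (≡.sym e))) eq))
      positive : 1 ≤ n ∸ rank (suc n) D
      positive = subst (λ r → 1 ≤ n ∸ r) (≡.sym (rank-roots (suc n) D ds))
        (ℕ.m<n⇒0<n∸m (lt 2≤roots (subst (roots (mergeAll id D) (suc n) ≤_) (length-upTo (suc n))
            (count-≤ _ (upTo (suc n))))))
        where
        lt : ∀ {r} → 2 ≤ r → r ≤ suc n → suc n ∸ r < n
        lt {suc (suc r)} (s≤s (s≤s _)) (s≤s r<n) = ℕ.∸-monoʳ-< {n} {suc r} {0} (s≤s z≤n) r<n
      vanishes : pow z (n ∸ rank (suc n) D) ≋ 0#
      vanishes with n ∸ rank (suc n) D | positive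
      ... | suc k | _ = trans (*-congʳ z≋0) (zeroˡ _)

-- From arches to numbered vertices

filterᵇ-none : ∀ {p : A → Bool} {xs} → All (λ x → p x ≡ false) xs → filterᵇ p xs ≡ []
filterᵇ-none []       = refl
filterᵇ-none {xs = x ∷ xs} (e ∷ es) = ≡.trans (filterᵇ-skip xs e) (filterᵇ-none es)

filterᵇ-all : ∀ {p : A → Bool} {xs} → All (λ x → p x ≡ true) xs → filterᵇ p xs ≡ xs
filterᵇ-all []       = refl
filterᵇ-all {xs = x ∷ xs} (e ∷ es) = ≡.trans (filterᵇ-cons xs e) (cong (x ∷_) (filterᵇ-all es))

AllPairs-cross : ∀ {P : A → A → Set} xs {s ys} → AllPairs P (xs ++ s ∷ ys) → All (λ x → P x s) xs × All (P s) ys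
AllPairs-cross []       (p ∷ _)  = [] , p
AllPairs-cross (x ∷ xs) (p ∷ ps) with All.++⁻ʳ xs p | AllPairs-cross xs ps
... | q ∷ _ | qs , rs = q ∷ qs , rs

indexed : List Edge → List (ℕ × Edge)
indexed σ = zip (upTo (length σ)) σ

crossesᵢ : ℕ × Edge → ℕ × Edge → Bool
crossesᵢ s t = crosses (proj₂ s) (proj₂ t)

indices : (ℕ × Edge) × (ℕ × Edge) → ℕ × ℕ
indices (s , t) = proj₁ s , proj₁ t

map-proj₁-zip : ∀ {A B : Set} (xs : List A) (ys : List B) → length xs ≡ length ys → map proj₁ (zip xs ys) ≡ xs
map-proj₁-zip []       []       e = refl
map-proj₁-zip (x ∷ xs) (y ∷ ys) e = cong (x ∷_) (map-proj₁-zip xs ys (ℕ.suc-injective e))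

map-proj₂-zip : ∀ {A B : Set} (xs : List A) (ys : List B) → length xs ≡ length ys → map proj₂ (zip xs ys) ≡ ys
map-proj₂-zip []       []       e = refl
map-proj₂-zip (x ∷ xs) (y ∷ ys) e = cong (y ∷_) (map-proj₂-zip xs ys (ℕ.suc-injective e))

pairs-map : ∀ {A B : Set} (c : B → B → Bool) (f : A → B) xs →
            pairs c (map f xs) ≡ map (λ (s , t) → f s , f t) (pairs (λ x y → c (f x) (f y)) xs)
pairs-map c f []       = refl
pairs-map c f (x ∷ xs) = ≡.trans (cong₂ _++_ (go xs) (pairs-map c f xs))
    (≡.sym (map-++ _ (row (λ x y → c (f x) (f y)) x xs) _))
  where
  go : ∀ ys → row c (f x) (map f ys) ≡ map (λ (s , t) → f s , f t) (row (λ x y → c (f x) (f y)) x ys)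
  go []       = refl
  go (y ∷ ys) with c (f x) (f y)
  ... | true  = cong (_ ∷_) (go ys)
  ... | false = go ys

-- Indices increase along the list, so filtering the whole list for larger indices leaves exactly
-- the tail after the current arch; the prefix `pre` keeps track of its position.
crossingEdges-pairs : ∀ σ → AllPairs (λ s t → proj₁ s < proj₁ t) (indexed σ) →
                      crossingEdges σ ≡ map indices (pairs crossesᵢ (indexed σ))
crossingEdges-pairs σ asc = go [] (indexed σ) refl
  where
  cell : ℕ × Edge → ℕ × Edge → List Edge
  cell s t = if crosses (proj₂ s) (proj₂ t) then (proj₁ s , proj₁ t) ∷ [] else []
  line : ∀ s ys → concatMap (cell s) ys ≡ map indices (row crossesᵢ s ys)
  line s []       = refl
  line s (t ∷ ys) with crosses (proj₂ s) (proj₂ t)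
  ... | true  = cong (_ ∷_) (line s ys)
  ... | false = line s ys
  later : ∀ pre s suf → indexed σ ≡ pre ++ s ∷ suf → filterᵇ (λ t → proj₁ s <ᵇ proj₁ t) (indexed σ) ≡ suf
  later pre s suf e with AllPairs-cross pre (subst (AllPairs _) e asc)
  ... | before , after = ≡.trans (cong (filterᵇ _) e) (≡.trans (filterᵇ-++ _ pre) (cong₂ _++_
    (filterᵇ-none (All.map (λ lt → <ᵇ-false (ℕ.<⇒≤ lt)) before))
    (≡.trans (filterᵇ-skip {x = s} suf (<ᵇ-false (ℕ.≤-refl {proj₁ s}))) (filterᵇ-all (All.map <ᵇ-true after)))))
  go : ∀ pre suf → indexed σ ≡ pre ++ suf →
       concatMap (λ s → concatMap (cell s) (filterᵇ (λ t → proj₁ s <ᵇ proj₁ t) (indexed σ))) suf ≡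
           map indices (pairs crossesᵢ suf)
  go pre []        e = refl
  go pre (s ∷ suf) e = ≡.trans
    (cong₂ _++_ (≡.trans (cong (concatMap (cell s)) (later pre s suf e)) (line s suf))
                (go (pre ++ s ∷ []) suf (≡.trans e (≡.sym (++-assoc pre (s ∷ []) suf)))))
    (≡.sym (map-++ indices (row crossesᵢ s suf) _))

module _ (σ : List Edge) where

  length-indices : length (upTo (length σ)) ≡ length σ
  length-indices = length-upTo (length σ)

  indexed-indices : map proj₁ (indexed σ) ≡ upTo (length σ)
  indexed-indices = map-proj₁-zip (upTo (length σ)) σ length-indices

  indexed-arches : map proj₂ (indexed σ) ≡ σ
  indexed-arches = map-proj₂-zip (upTo (length σ)) σ length-indices

  indexed-ascending : AllPairs (λ s t → proj₁ s < proj₁ t) (indexed σ)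
  indexed-ascending = AllPairs.map⁻
      (subst (AllPairs _<_) (≡.sym indexed-indices) (AllPairs.applyUpTo⁺₁ id (length σ) (λ i<j _ → i<j)))

  crossingEdges-indices : crossingEdges σ ≡ map indices (pairs crossesᵢ (indexed σ))
  crossingEdges-indices = crossingEdges-pairs σ indexed-ascending

  crossPairs-arches : crossPairs σ ≡ map (λ (s , t) → proj₂ s , proj₂ t) (pairs crossesᵢ (indexed σ))
  crossPairs-arches = ≡.trans (cong crossPairs (≡.sym indexed-arches)) (pairs-map crosses proj₂ (indexed σ))

  crossingEdges-below : EdgesBelow (length σ) (crossingEdges σ)
  crossingEdges-below = subst (EdgesBelow (length σ)) (≡.sym crossingEdges-indices)
    (All.map⁺ (pairs-All crossesᵢ (All.map⁻
        (subst (All (_< length σ)) (≡.sym indexed-indices) (All.all-upTo (length σ))))))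

-- Both functions increase strictly along the list, so on its positions each has the trivial kernel.
AllPairs-kernel : ∀ {f g : A → ℕ} {xs} → AllPairs (λ x y → f x < f y) xs → AllPairs (λ x y → g x < g y) xs →
                  ∀ {x y} → x ∈ xs → y ∈ xs → (f x ≡ᵇ f y) ≡ (g x ≡ᵇ g y)
AllPairs-kernel {f = f} {g} (p ∷ ps) (r ∷ rs) {x} (here refl) (here refl) =
    ≡.trans (≡ᵇ-true {f x} refl) (≡.sym (≡ᵇ-true {g x} refl))
AllPairs-kernel (p ∷ ps) (r ∷ rs) (here refl) (there j) =
  ≡.trans (≡ᵇ-false (ℕ.<⇒≢ (All.lookup p j))) (≡.sym (≡ᵇ-false (ℕ.<⇒≢ (All.lookup r j))))
AllPairs-kernel (p ∷ ps) (r ∷ rs) (there i) (here refl) =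
  ≡.trans (≡ᵇ-false (ℕ.>⇒≢ (All.lookup p i))) (≡.sym (≡ᵇ-false (ℕ.>⇒≢ (All.lookup r i))))
AllPairs-kernel (p ∷ ps) (r ∷ rs) (there i) (there j) = AllPairs-kernel ps rs i j

-- The list of arches with their indices projects both to the arches and to the vertex numbers, and
-- on it the two labellings have the same kernel. `Φ` will be `connected` and `spanning`.
crossingEdges-invariant : ∀ {X : Set} (Φ : ∀ {A : Set} → List A → (A → ℕ) → List (A × A) → X) →
  (∀ {A B : Set} (f : A → B) V ℓ E → Φ (map f V) ℓ (map (λ (s , t) → f s , f t) E) ≡ Φ V (ℓ ∘ f) E) →
  (∀ {A : Set} {P : A → Set} V {ℓ ℓ′ : A → ℕ} E → All P V → All (λ (s , t) → P s × P t) E →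
    (∀ x y → P x → P y → (ℓ x ≡ᵇ ℓ y) ≡ (ℓ′ x ≡ᵇ ℓ′ y)) → Φ V ℓ E ≡ Φ V ℓ′ E) →
  ∀ σ → AllPairs (λ e f → proj₁ e < proj₁ f) σ →
  Φ σ proj₁ (crossPairs σ) ≡ Φ (upTo (length σ)) id (crossingEdges σ)
crossingEdges-invariant Φ Φ-map Φ-kernel σ asc = begin
  Φ σ proj₁ (crossPairs σ)
    ≡⟨ cong₂ (λ V E → Φ V proj₁ E) (≡.sym (indexed-arches σ)) (crossPairs-arches σ) ⟩
  Φ (map proj₂ I) proj₁ (map (λ (s , t) → proj₂ s , proj₂ t) (pairs crossesᵢ I))
    ≡⟨ Φ-map proj₂ I proj₁ (pairs crossesᵢ I) ⟩
  Φ I (proj₁ ∘ proj₂) (pairs crossesᵢ I)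
    ≡⟨ Φ-kernel {P = _∈ I} I (pairs crossesᵢ I) (All.tabulate id) (pairs-All crossesᵢ (All.tabulate id))
         (λ x y → AllPairs-kernel (AllPairs.map⁻ (subst (AllPairs _) (≡.sym (indexed-arches σ)) asc))
             (indexed-ascending σ)) ⟩
  Φ I proj₁ (pairs crossesᵢ I)
    ≡⟨ Φ-map proj₁ I id (pairs crossesᵢ I) ⟨
  Φ (map proj₁ I) id (map indices (pairs crossesᵢ I))
    ≡⟨ cong₂ (λ V E → Φ V id E) (indexed-indices σ) (≡.sym (crossingEdges-indices σ)) ⟩
  Φ (upTo (length σ)) id (crossingEdges σ) ∎
  where
  open ≡.≡-Reasoning
  I = indexed σ

spanning : List A → (A → ℕ) → List (A × A) → Bool
spanning V ℓ E = constant (mergeAll ℓ E) V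

spanning-map : ∀ {A B : Set} (f : A → B) V (ℓ : B → ℕ) E →
               spanning (map f V) ℓ (map (λ (s , t) → f s , f t) E) ≡ spanning V (ℓ ∘ f) E
spanning-map f []      ℓ []      = refl
spanning-map f (v ∷ V) ℓ []      = all-map _ f V
spanning-map f V       ℓ (e ∷ E) = spanning-map f V (merge ℓ _) E

spanning-kernel : ∀ {A : Set} {P : A → Set} V {ℓ ℓ′ : A → ℕ} E → All P V → All (λ (s , t) → P s × P t) E →
  (∀ x y → P x → P y → (ℓ x ≡ᵇ ℓ y) ≡ (ℓ′ x ≡ᵇ ℓ′ y)) → spanning V ℓ E ≡ spanning V ℓ′ E
spanning-kernel []      []      PV PE same = refl
spanning-kernel (v ∷ V) []      (Pv ∷ PV) PE same = all-cong PV (λ u Pu → same u v Pu Pv)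
spanning-kernel V {ℓ} {ℓ′} ((s , t) ∷ E) PV ((Ps , Pt) ∷ PE) same =
  spanning-kernel V E PV PE (merge-kernel-cong ℓ ℓ′ s t Ps Pt same)

-- Connected matchings and connected crossing graphs

<ᵇ-sound : ∀ m n → (m <ᵇ n) ≡ true → m < n
<ᵇ-sound m n e = ℕ.<ᵇ⇒< m n (subst T (≡.sym e) tt)

≤ᵇ-true : ∀ {m n} → m ≤ n → (m ℕ.≤ᵇ n) ≡ true
≤ᵇ-true {zero}  le = refl
≤ᵇ-true {suc m} le = <ᵇ-true le

≤ᵇ-sound : ∀ m n → (m ℕ.≤ᵇ n) ≡ true → m ≤ n
≤ᵇ-sound m n e = ℕ.≤ᵇ⇒≤ m n (subst T (≡.sym e) tt)

not-true : ∀ {b} → not b ≡ true → b ≡ false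
not-true {false} e = refl

not-false : ∀ {b} → not b ≡ false → b ≡ true
not-false {true} e = refl

≢true : ∀ {b} → b ≢ true → b ≡ false
≢true {true}  ne = ⊥-elim (ne refl)
≢true {false} ne = refl

inI-true : ∀ {a b x} → a ≤ x → x ≤ b → inI a b x ≡ true
inI-true a≤x x≤b = cong₂ _∧_ (≤ᵇ-true a≤x) (≤ᵇ-true x≤b)

inI-sound : ∀ a b x → inI a b x ≡ true → a ≤ x × x ≤ b
inI-sound a b x e with ∧-true (a ℕ.≤ᵇ x) e
... | p , r = ≤ᵇ-sound a x p , ≤ᵇ-sound x b r

all-false : ∀ (p : A → Bool) xs → all p xs ≡ false → ∃ λ x → x ∈ xs × p x ≡ false
all-false p (x ∷ xs) e with p x in eq
... | false = x , here refl , eq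
... | true with all-false p xs e
...   | y , y∈ , py = y , there y∈ , py

unionOfBlocks-sound : ∀ σ a b → unionOfBlocks σ a b ≡ true → ∀ {e} → e ∈ σ → inI a b (proj₁ e) ≡
    inI a b (proj₂ e)
unionOfBlocks-sound σ a b u {e} e∈ with inI a b (proj₁ e) | inI a b (proj₂ e) | all-lookup _ u e∈
... | true  | true  | _ = refl
... | false | false | _ = refl

unionOfBlocks-true : ∀ σ a b → (∀ {e} → e ∈ σ → inI a b (proj₁ e) ≡ inI a b (proj₂ e)) →
    unionOfBlocks σ a b ≡ true
unionOfBlocks-true σ a b h with unionOfBlocks σ a b in eq
... | true  = refl
... | false with all-false _ σ eq
...   | e , e∈ , pe with inI a b (proj₁ e) | inI a b (proj₂ e) | h e∈ | pe
...     | true  | .true  | refl | ()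
...     | false | .false | refl | ()

least : ∀ (f : ℕ → Bool) lo d → f (lo + d) ≡ true →
        ∃ λ m → lo ≤ m × m ≤ lo + d × f m ≡ true × (∀ i → lo ≤ i → i < m → f i ≡ false)
least f lo zero    e = lo + 0 , ℕ.m≤m+n lo 0 , ℕ.≤-refl , e , λ i lo≤i i<lo →
  ⊥-elim (ℕ.<⇒≱ (subst (i <_) (ℕ.+-identityʳ lo) i<lo) lo≤i)
least f lo (suc d) e with f lo in eq
... | true  = lo , ℕ.≤-refl , ℕ.m≤m+n lo _ , eq , λ i lo≤i i<lo → ⊥-elim (ℕ.<⇒≱ i<lo lo≤i)
... | false with least f (suc lo) d (subst (λ n → f n ≡ true) (ℕ.+-suc lo d) e)
...   | m , lo<m , m≤ , fm , below = m , ℕ.<⇒≤ lo<m , subst (m ≤_) (≡.sym (ℕ.+-suc lo d)) m≤ , fm , below′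
  where
  below′ : ∀ i → lo ≤ i → i < m → f i ≡ false
  below′ i lo≤i i<m with lo ℕ.≟ i
  ... | yes refl = eq
  ... | no ne    = below i (ℕ.≤∧≢⇒< lo≤i ne) i<m

Crossing : Edge → Edge → Set
Crossing (i , j) (k , l) = (i < k × k < j × j < l) ⊎ (k < i × i < l × l < j)

crosses-sound : ∀ e f → crosses e f ≡ true → Crossing e f
crosses-sound (i , j) (k , l) c with ∨-true ((i <ᵇ k) ∧ (k <ᵇ j) ∧ (j <ᵇ l)) c
... | inj₁ p = let p₁ , p′ = ∧-true (i <ᵇ k) p ; p₂ , p₃ = ∧-true (k <ᵇ j) p′
               in inj₁ (<ᵇ-sound i k p₁ , <ᵇ-sound k j p₂ , <ᵇ-sound j l p₃)
... | inj₂ p = let p₁ , p′ = ∧-true (k <ᵇ i) p ; p₂ , p₃ = ∧-true (i <ᵇ l) p′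
               in inj₂ (<ᵇ-sound k i p₁ , <ᵇ-sound i l p₂ , <ᵇ-sound l j p₃)

crosses-true : ∀ e f → Crossing e f → crosses e f ≡ true
crosses-true (i , j) (k , l) (inj₁ (p , r , s)) =
  cong (_∨ ((k <ᵇ i) ∧ (i <ᵇ l) ∧ (l <ᵇ j))) (cong₂ _∧_ (<ᵇ-true p) (cong₂ _∧_ (<ᵇ-true r) (<ᵇ-true s)))
crosses-true (i , j) (k , l) (inj₂ (p , r , s)) =
  ≡.trans (cong (((i <ᵇ k) ∧ (k <ᵇ j) ∧ (j <ᵇ l)) ∨_)
      (cong₂ _∧_ (<ᵇ-true p) (cong₂ _∧_ (<ᵇ-true r) (<ᵇ-true s)))) (Bool.∨-zeroʳ _)

Crossing-sym : ∀ e f → Crossing e f → Crossing f e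
Crossing-sym e f (inj₁ c) = inj₂ c
Crossing-sym e f (inj₂ c) = inj₁ c

pairs-related : ∀ (c : A → A → Bool) xs → All (λ (s , t) → c s t ≡ true) (pairs c xs)
pairs-related c []       = []
pairs-related c (x ∷ xs) = All.++⁺ (go xs) (pairs-related c xs)
  where
  go : ∀ ys → All (λ (s , t) → c s t ≡ true) (row c x ys)
  go []       = []
  go (y ∷ ys) with c x y in eq
  ... | true  = eq ∷ go ys
  ... | false = go ys

row-complete : ∀ (c : A → A → Bool) x {ys y} → y ∈ ys → c x y ≡ true → (x , y) ∈ row c x ys
row-complete c x {y ∷ ys} (here refl) e rewrite e = here refl
row-complete c x {z ∷ ys} (there i)   e = ∈-++⁺ʳ (if c x z then (x , z) ∷ [] else []) (row-complete c x i e)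

pairs-complete : ∀ (c : A → A → Bool) {xs x y} → x ∈ xs → y ∈ xs → c x y ≡ true → c y x ≡ true →
                 x ≡ y ⊎ (x , y) ∈ pairs c xs ⊎ (y , x) ∈ pairs c xs
pairs-complete c (here refl) (here refl) e e′ = inj₁ refl
pairs-complete c (here refl) (there j)   e e′ = inj₂ (inj₁ (∈-++⁺ˡ (row-complete c _ j e)))
pairs-complete c (there i)   (here refl) e e′ = inj₂ (inj₂ (∈-++⁺ˡ (row-complete c _ i e′)))
pairs-complete c {z ∷ xs} (there i) (there j) e e′ with pairs-complete c i j e e′
... | inj₁ p        = inj₁ p
... | inj₂ (inj₁ p) = inj₂ (inj₁ (∈-++⁺ʳ (row c z xs) p))
... | inj₂ (inj₂ p) = inj₂ (inj₂ (∈-++⁺ʳ (row c z xs) p))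

Disjoint : Edge → Edge → Set
Disjoint (i , j) (k , l) = (i ≢ k × i ≢ l) × (j ≢ k × j ≢ l)

Disjoint-sym : ∀ e f → Disjoint e f → Disjoint f e
Disjoint-sym e f ((a , b) , (c , d)) = (a ∘ ≡.sym , c ∘ ≡.sym) , (b ∘ ≡.sym , d ∘ ≡.sym)

Pick-≢ : ∀ {y : A} {xs ys} → Pick y xs ys → AllPairs _≢_ xs → All (y ≢_) ys
Pick-≢ here      (p ∷ ps) = p
Pick-≢ (there i) (p ∷ ps) = (proj₁ (Pick-All i p) ∘ ≡.sym) ∷ Pick-≢ i ps

Pick-∈ : ∀ {y : A} {xs ys z} → Pick y xs ys → z ∈ xs → z ≡ y ⊎ z ∈ ys
Pick-∈ here      (here e)  = inj₁ e
Pick-∈ here      (there j) = inj₂ j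
Pick-∈ (there i) (here e)  = inj₂ (here e)
Pick-∈ (there i) (there j) with Pick-∈ i j
... | inj₁ e = inj₁ e
... | inj₂ k = inj₂ (there k)

Pairing-disjoint : ∀ {xs σ} → Pairing xs σ → AllPairs _≢_ xs → AllPairs Disjoint σ
Pairing-disjoint []      []         = []
Pairing-disjoint (i ∷ r) (x≢ ∷ un) =
  All.zip (Pairing-All r (proj₂ (Pick-All i x≢)) , Pairing-All r (Pick-≢ i un)) ∷ Pairing-disjoint r
      (Pick-AllPairs i un)

Pairing-forward : ∀ {xs σ} → Pairing xs σ → AllPairs _<_ xs → All (λ e → proj₁ e < proj₂ e) σ
Pairing-forward []      []         = []
Pairing-forward (i ∷ r) (x< ∷ asc) = proj₁ (Pick-All i x<) ∷ Pairing-forward r (Pick-AllPairs i asc)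

Endpoint : ℕ → Edge → Set
Endpoint p e = proj₁ e ≡ p ⊎ proj₂ e ≡ p

Pairing-covers : ∀ {xs σ p} → Pairing xs σ → p ∈ xs → ∃ λ e → e ∈ σ × Endpoint p e
Pairing-covers (i ∷ r) (here refl) = _ , here refl , inj₁ refl
Pairing-covers (i ∷ r) (there j) with Pick-∈ i j
... | inj₁ e = _ , here refl , inj₂ (≡.sym e)
... | inj₂ k with Pairing-covers r k
...   | e , e∈ , end = e , there e∈ , end

Pairing-length : ∀ {xs σ} → Pairing xs σ → length xs ≡ length σ + length σ
Pairing-length []                = refl
Pairing-length {σ = _ ∷ σ} (i ∷ r) = cong suc (≡.trans (Pick-length i)
  (≡.trans (cong suc (Pairing-length r)) (≡.sym (ℕ.+-suc (length σ) (length σ)))))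

module _ (n : ℕ) (σ : List Edge) (pairing : Pairing (map suc (upTo (n + n))) σ) where

  private
    N : ℕ
    N = n + n

    Point : ℕ → Set
    Point p = 1 ≤ p × p ≤ N

    all-points : All Point (map suc (upTo N))
    all-points = All.map⁺ {P = Point} (All.map (λ p<N → s≤s z≤n , p<N) (All.all-upTo N))

    point-∈ : ∀ {p} → 1 ≤ p → p ≤ N → p ∈ map suc (upTo N)
    point-∈ {suc p} _ p<N = ∈-map⁺ suc (∈-upTo⁺ p<N)

    ascending : AllPairs _<_ (map suc (upTo N))
    ascending = AllPairs.map⁺ (AllPairs.applyUpTo⁺₁ id N (λ i<j _ → s≤s i<j))

    arch-points : ∀ {e} → e ∈ σ → Point (proj₁ e) × Point (proj₂ e)
    arch-points = All.lookup (Pairing-All pairing all-points)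

    forward : ∀ {e} → e ∈ σ → proj₁ e < proj₂ e
    forward = All.lookup (Pairing-forward pairing ascending)

    covered : ∀ {p} → 1 ≤ p → p ≤ N → ∃ λ e → e ∈ σ × Endpoint p e
    covered 1≤p p≤N = Pairing-covers pairing (point-∈ 1≤p p≤N)

    same-or-disjoint : ∀ {e f} → e ∈ σ → f ∈ σ → e ≡ f ⊎ Disjoint e f
    same-or-disjoint = go (Pairing-disjoint pairing (AllPairs.map ℕ.<⇒≢ ascending))
      where
      go : ∀ {σ e f} → AllPairs Disjoint σ → e ∈ σ → f ∈ σ → e ≡ f ⊎ Disjoint e f
      go (d ∷ ds) (here refl) (here refl) = inj₁ refl
      go (d ∷ ds) (here refl) (there j)   = inj₂ (All.lookup d j)
      go (d ∷ ds) (there i)   (here refl) = inj₂ (Disjoint-sym _ _ (All.lookup d i))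
      go (d ∷ ds) (there i)   (there j)   = go ds i j

    same-arch : ∀ {e f p} → e ∈ σ → f ∈ σ → Endpoint p e → Endpoint p f → e ≡ f
    same-arch e∈ f∈ p∈e p∈f with same-or-disjoint e∈ f∈
    ... | inj₁ e = e
    ... | inj₂ ((a , b) , (c , d)) with p∈e | p∈f
    ...   | inj₁ p | inj₁ r = ⊥-elim (a (≡.trans p (≡.sym r)))
    ...   | inj₁ p | inj₂ r = ⊥-elim (b (≡.trans p (≡.sym r)))
    ...   | inj₂ p | inj₁ r = ⊥-elim (c (≡.trans p (≡.sym r)))
    ...   | inj₂ p | inj₂ r = ⊥-elim (d (≡.trans p (≡.sym r)))

    isBlockInterval : ℕ → ℕ → Bool
    isBlockInterval a b = (a ℕ.≤ᵇ b) ∧ not ((a ≡ᵇ 1) ∧ (b ≡ᵇ N)) ∧ unionOfBlocks σ a b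

  -- No arch inside a proper interval that is a union of blocks crosses an arch outside it.
  disconnected-weight : ∀ (R : CommutativeRing 0ℓ 0ℓ) (w : CommutativeRing.Carrier R) → isConnected n σ ≡
      false →
    CommutativeRing._≈_ R (Exponential.connectedWeight R w σ) (CommutativeRing.0# R)
  disconnected-weight R w dis with all-false _ (map suc (upTo N)) dis
  ... | a , a∈ , dis′ with all-false _ (map suc (upTo N)) dis′
  ...   | b , b∈ , found = connected-zero χ (proj₁ (proj₂ inner)) (proj₁ (proj₂ outer))
          (λ e → true≢false (≡.trans (≡.sym (proj₂ (proj₂ inner))) (≡.trans e (proj₂ (proj₂ outer)))))
          (λ e f → cong (inI a b)) (crossPairs σ)
          (All.map (λ {(e , f)} (c , e∈ , f∈) → respects e f (crosses-sound e f c) (blocks e∈) (blocks f∈))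
            (All.zip (pairs-related crosses σ , pairs-All crosses (All.tabulate id))))
    where
    open GraphSums R w
    χ : Edge → Bool
    χ e = inI a b (proj₁ e)
    parts = ∧-true (a ℕ.≤ᵇ b) (not-false found)
    a≤b : a ≤ b
    a≤b = ≤ᵇ-sound a b (proj₁ parts)
    parts′ = ∧-true (not ((a ≡ᵇ 1) ∧ (b ≡ᵇ N))) (proj₂ parts)
    proper : (a ≡ᵇ 1) ∧ (b ≡ᵇ N) ≡ false
    proper = not-true (proj₁ parts′)
    blocks : ∀ {e} → e ∈ σ → inI a b (proj₁ e) ≡ inI a b (proj₂ e)
    blocks = unionOfBlocks-sound σ a b (proj₂ parts′)
    range : ∀ {p} → p ∈ map suc (upTo N) → Point p
    range p∈ = All.lookup all-points p∈
    arch-at : ∀ {p} → Point p → ∃ λ e → e ∈ σ × χ e ≡ inI a b p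
    arch-at (1≤p , p≤N) with covered 1≤p p≤N
    ... | e , e∈ , inj₁ refl = e , e∈ , refl
    ... | e , e∈ , inj₂ refl = e , e∈ , blocks e∈
    inner : ∃ λ e → e ∈ σ × χ e ≡ true
    inner with arch-at (range a∈)
    ... | e , e∈ , eq = e , e∈ , ≡.trans eq (inI-true {a} {b} ℕ.≤-refl a≤b)
    outside : ∃ λ p → Point p × inI a b p ≡ false
    -- A proper interval misses the first point or the last one.
    outside with a ℕ.≟ 1 | b ℕ.≟ N
    ... | no a≢1 | _ = 1 , (ℕ.≤-refl , ℕ.≤-trans (proj₁ (range a∈)) (proj₂ (range a∈))) , ≢true (λ e →
                         a≢1 (ℕ.≤-antisym (proj₁ (inI-sound a b 1 e)) (proj₁ (range a∈))))
    ... | _ | no b≢N = N , (ℕ.≤-trans (proj₁ (range a∈)) (proj₂ (range a∈)) , ℕ.≤-refl) , ≢true (λ e →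
                         b≢N (ℕ.≤-antisym (proj₂ (range b∈)) (proj₂ (inI-sound a b N e))))
    ... | yes a≡1 | yes b≡N = ⊥-elim
        (true≢false (≡.trans (≡.sym (cong₂ _∧_ (≡ᵇ-true a≡1) (≡ᵇ-true b≡N))) proper))
    outer : ∃ λ e → e ∈ σ × χ e ≡ false
    outer with outside
    ... | p , pt , out with arch-at pt
    ...   | e , e∈ , eq = e , e∈ , ≡.trans eq out
    between : ∀ x y z → inI a b x ≡ true → inI a b z ≡ true → x < y → y < z → inI a b y ≡ true
    between x y z ix iz x<y y<z = inI-true (ℕ.≤-trans (proj₁ (inI-sound a b x ix)) (ℕ.<⇒≤ x<y))
                                           (ℕ.≤-trans (ℕ.<⇒≤ y<z) (proj₂ (inI-sound a b z iz)))
    respects : ∀ e f → Crossing e f → inI a b (proj₁ e) ≡ inI a b (proj₂ e) → inI a b (proj₁ f) ≡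
        inI a b (proj₂ f) → χ e ≡ χ f
    -- If just one of two crossing arches lies in the interval, an end of the other lies between its
    -- two ends and hence in the interval as well.
    respects (i , j) (k , l) c p r with inI a b i in eqi | inI a b k in eqk
    ... | true  | true  = refl
    ... | false | false = refl
    respects (i , j) (k , l) (inj₁ (i<k , k<j , j<l)) p r | true  | false =
      ≡.trans (≡.sym (between i k j eqi (≡.sym p) i<k k<j)) eqk
    respects (i , j) (k , l) (inj₂ (k<i , i<l , l<j)) p r | true  | false =
      ≡.trans (≡.sym (between i l j eqi (≡.sym p) i<l l<j)) (≡.sym r)
    respects (i , j) (k , l) (inj₁ (i<k , k<j , j<l)) p r | false | true  =
      ≡.trans p (between k j l eqk (≡.sym r) k<j j<l)
    respects (i , j) (k , l) (inj₂ (k<i , i<l , l<j)) p r | false | true  =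
      ≡.trans (≡.sym eqi) (between k i l eqk (≡.sym r) k<i i<l)

  -- Suppose the component of the arch at 1 misses an arch, and let [a , b] be a maximal interval
  -- of points outside that component.  An arch leaving [a , b] would have points of the component
  -- under it, hence would be crossed by the component, so [a , b] is a union of blocks.
  connected-spanning : 1 ≤ n → isConnected n σ ≡ true → spanning σ proj₁ (crossPairs σ) ≡ true
  connected-spanning 1≤n conn with spanning σ proj₁ (crossPairs σ) in eq
  ... | true  = refl
  ... | false = ⊥-elim (true≢false (≡.trans (≡.sym conn) isolated))
    where
    L : Edge → ℕ
    L = mergeAll proj₁ (crossPairs σ)

    1≤N : 1 ≤ N
    1≤N = ℕ.≤-trans 1≤n (ℕ.m≤m+n n n)

    first : ∃ λ e → e ∈ σ × Endpoint 1 e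
    first = covered ℕ.≤-refl 1≤N

    e₀ : Edge
    e₀ = proj₁ first
    e₀∈ : e₀ ∈ σ
    e₀∈ = proj₁ (proj₂ first)

    κ : Edge → Bool
    κ e = L e ≡ᵇ L e₀

    crossing-L : ∀ {e f} → e ∈ σ → f ∈ σ → Crossing e f → L e ≡ L f
    crossing-L {e} {f} e∈ f∈ c with pairs-complete crosses e∈ f∈ (crosses-true e f c)
        (crosses-true f e (Crossing-sym e f c))
    ... | inj₁ refl     = refl
    ... | inj₂ (inj₁ p) = All.lookup (mergeAll-joins proj₁ (crossPairs σ)) p
    ... | inj₂ (inj₂ p) = ≡.sym (All.lookup (mergeAll-joins proj₁ (crossPairs σ)) p)

    crossing-C : ∀ {e f} → e ∈ σ → f ∈ σ → Crossing e f → κ e ≡ κ f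
    crossing-C e∈ f∈ c = cong (_≡ᵇ L e₀) (crossing-L e∈ f∈ c)

    inC : ℕ → Bool
    inC p = any (λ e → κ e ∧ ((proj₁ e ≡ᵇ p) ∨ (proj₂ e ≡ᵇ p))) σ

    inC-witness : ∀ {p} → inC p ≡ true → ∃ λ e → e ∈ σ × Endpoint p e × κ e ≡ true
    inC-witness {p} c with any-witness _ σ c
    ... | e , e∈ , q with ∧-true (κ e) q
    ...   | Ce , end with ∨-true (proj₁ e ≡ᵇ p) end
    ...     | inj₁ r = e , e∈ , inj₁ (≡ᵇ-sound r) , Ce
    ...     | inj₂ r = e , e∈ , inj₂ (≡ᵇ-sound r) , Ce

    endpointᵇ : ∀ {p} e → Endpoint p e → (proj₁ e ≡ᵇ p) ∨ (proj₂ e ≡ᵇ p) ≡ true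
    endpointᵇ {p} e (inj₁ r) = cong (_∨ (proj₂ e ≡ᵇ p)) (≡ᵇ-true r)
    endpointᵇ {p} e (inj₂ r) = ≡.trans (cong ((proj₁ e ≡ᵇ p) ∨_) (≡ᵇ-true r)) (Bool.∨-zeroʳ _)

    inC-arch : ∀ {e p} → e ∈ σ → Endpoint p e → inC p ≡ κ e
    inC-arch {e} {p} e∈ end with κ e in eqC
    ... | true  = any-true _ e∈ (cong₂ _∧_ eqC (endpointᵇ e end))
    ... | false = ≢true λ c → let f , f∈ , end′ , Cf = inC-witness c in
                  true≢false (≡.trans (≡.sym Cf) (≡.trans (cong κ (same-arch f∈ e∈ end′ end)) eqC))

    -- Here the arch from `x` to `y` is outside the component of `e₀`. No arch of the component
    -- crosses it, so an arch of the component with one end under it lies entirely under it.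
    module Under {x y} (α∈ : (x , y) ∈ σ) (¬Cα : κ (x , y) ≡ false) where

      Inside : Edge → Set
      Inside (k , l) = x < k × l < y

      inside : Edge → Bool
      inside (k , l) = (x <ᵇ k) ∧ (l <ᵇ y)

      inside-sound : ∀ e → inside e ≡ true → Inside e
      inside-sound (k , l) p = let p₁ , p₂ = ∧-true (x <ᵇ k) p in <ᵇ-sound x k p₁ , <ᵇ-sound l y p₂

      inside-true : ∀ e → Inside e → inside e ≡ true
      inside-true e (p , q) = cong₂ _∧_ (<ᵇ-true p) (<ᵇ-true q)

      avoids : ∀ {e} → e ∈ σ → κ e ≡ true → ¬ Crossing (x , y) e × Disjoint (x , y) e
      avoids e∈ Ce = (λ c → true≢false (≡.trans (≡.sym Ce) (≡.trans (≡.sym (crossing-C α∈ e∈ c)) ¬Cα))) ,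
          disjoint
        where
        disjoint : Disjoint (x , y) _
        disjoint with same-or-disjoint α∈ e∈
        ... | inj₁ refl = ⊥-elim (true≢false (≡.trans (≡.sym Ce) ¬Cα))
        ... | inj₂ d    = d

      enter : ∀ {e p} → e ∈ σ → κ e ≡ true → Endpoint p e → x < p → p < y → Inside e
      enter {k , l} e∈ Ce (inj₁ refl) x<k k<y =
          x<k , ℕ.≤∧≢⇒< (ℕ.≮⇒≥ (λ y<l → proj₁ (avoids e∈ Ce) (inj₁ (x<k , k<y , y<l))))
                                                                (proj₂ (proj₂ (proj₂ (avoids e∈ Ce))) ∘ ≡.sym)
      enter {k , l} e∈ Ce (inj₂ refl) x<l l<y =
          ℕ.≤∧≢⇒< (ℕ.≮⇒≥ (λ k<x → proj₁ (avoids e∈ Ce) (inj₂ (k<x , x<l , l<y))))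
                                                          (proj₁ (proj₁ (proj₂ (avoids e∈ Ce)))) , l<y

      spread : ∀ {e f} → e ∈ σ → f ∈ σ → κ f ≡ true → Crossing e f → Inside e → Inside f
      spread e∈ f∈ Cf (inj₁ (i<k , k<j , j<l)) (x<i , j<y) =
        enter f∈ Cf (inj₁ refl) (ℕ.<-trans x<i i<k) (ℕ.<-trans k<j j<y)
      spread e∈ f∈ Cf (inj₂ (k<i , i<l , l<j)) (x<i , j<y) =
        enter f∈ Cf (inj₂ refl) (ℕ.<-trans x<i i<l) (ℕ.<-trans l<j j<y)

      χ : Edge → Bool
      χ e = κ e ∧ inside e

      χ-crossing : ∀ {e f} → e ∈ σ → f ∈ σ → Crossing e f → χ e ≡ χ f
      χ-crossing {e} {f} e∈ f∈ c with κ e in eqe | κ f in eqf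
      ... | false | false = refl
      ... | true  | false = ⊥-elim (true≢false (≡.trans (≡.sym eqe) (≡.trans (crossing-C e∈ f∈ c) eqf)))
      ... | false | true  = ⊥-elim (true≢false (≡.trans (≡.sym eqf) (≡.trans (≡.sym (crossing-C e∈ f∈ c)) eqe)))
      ... | true  | true with inside e in eqi | inside f in eqj
      ...   | true  | true  = refl
      ...   | false | false = refl
      ...   | true  | false = ≡.trans (≡.sym (inside-true f (spread e∈ f∈ eqf c (inside-sound e eqi)))) eqj
      ...   | false | true  = ≡.trans (≡.sym eqi)
          (inside-true e (spread f∈ e∈ eqe (Crossing-sym e f c) (inside-sound f eqj)))

      -- Lying under the given arch passes along crossings within the component, so it holds for all
      -- arches of the component or for none.
      χ-constant : ∀ {e} → e ∈ σ → L e ≡ L e₀ → χ e ≡ χ e₀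
      χ-constant {e} e∈ = mergeAll-saturated {P = _∈ σ} {χ = χ} {ℓ = proj₁}
        (λ e f e∈ f∈ p → cong χ (same-arch e∈ f∈ (inj₁ p) (inj₁ refl)))
        (pairs-All crosses (All.tabulate id))
        (All.map (λ {(e , f)} (c , e∈ , f∈) → χ-crossing e∈ f∈ (crosses-sound e f c))
          (All.zip (pairs-related crosses σ , pairs-All crosses (All.tabulate id))))
        e e₀ e∈ e₀∈

      χ-e₀ : χ e₀ ≡ false
      χ-e₀ = ≢true λ c → ℕ.<⇒≱ (leftmost (proj₁ (inside-sound e₀ (proj₂ (∧-true (κ e₀) c)))))
          (proj₁ (proj₁ (arch-points α∈)))
        where
        leftmost : x < proj₁ e₀ → x < 1
        leftmost x< with proj₂ (proj₂ first)
        ... | inj₁ e = subst (x <_) e x<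
        ... | inj₂ e = ℕ.<-trans x< (subst (proj₁ e₀ <_) e (forward e₀∈))

      -- A point of the component under the arch would force `e₀` under it too, but `e₀` has the
      -- point 1 as an end.
      nothing-under : ∀ {p} → x < p → p < y → inC p ≡ false
      nothing-under x<p p<y = ≢true λ c → let e , e∈ , end , Ce = inC-witness c in
        true≢false (≡.trans (≡.sym (cong₂ _∧_ Ce (inside-true e (enter e∈ Ce end x<p p<y))))
                            (≡.trans (χ-constant e∈ (≡ᵇ-sound Ce)) χ-e₀))

    C-e₀ : κ e₀ ≡ true
    C-e₀ = ≡ᵇ-true {L e₀} refl

    inC-1 : inC 1 ≡ true
    inC-1 = ≡.trans (inC-arch e₀∈ (proj₂ (proj₂ first))) C-e₀

    other : ∃ λ e → e ∈ σ × κ e ≡ false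
    other with all κ σ in eqa
    ... | false = all-false κ σ eqa
    ... | true  = ⊥-elim (true≢false (≡.trans (≡.sym (constant-true L {σ} λ x∈ y∈ →
                    ≡.trans (≡ᵇ-sound (all-lookup κ eqa x∈)) (≡.sym (≡ᵇ-sound (all-lookup κ eqa y∈))))) eq))

    e₁ : Edge
    e₁ = proj₁ other
    e₁∈ : e₁ ∈ σ
    e₁∈ = proj₁ (proj₂ other)

    isolated : isConnected n σ ≡ false
    -- The search for `a` starts at 1, and the left end of `e₁`, an arch outside the component,
    -- guarantees that it stops.
    isolated = case-gap (least (not ∘ inC) 1 (pred (proj₁ e₁))
        (subst (λ p → not (inC p) ≡ true) (≡.sym (suc-pred (proj₁ (proj₁ (arch-points e₁∈)))))
          (cong not (≡.trans (inC-arch e₁∈ (inj₁ refl)) (proj₂ (proj₂ other))))))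
      where
      suc-pred : ∀ {p} → 1 ≤ p → suc (pred p) ≡ p
      suc-pred (s≤s _) = refl
      case-gap : (∃ λ a → 1 ≤ a × a ≤ 1 + pred (proj₁ e₁) × not (inC a) ≡
          true × (∀ i → 1 ≤ i → i < a → not (inC i) ≡ false)) →
                 isConnected n σ ≡ false
      case-gap (a , 1≤a , a≤e₁ , ¬Ca , before) =
          case-end (least stop a (suc N ∸ a) (≡.trans (cong stop (ℕ.m+[n∸m]≡n a≤1+N))
          (≡.trans (cong (inC (suc N) ∨_) (≡ᵇ-true {suc N} refl)) (Bool.∨-zeroʳ _))))
        where
        -- The value `suc N` is a sentinel for a gap that extends to the last point.
        stop : ℕ → Bool
        stop p = inC p ∨ (p ≡ᵇ suc N)
        a≤N : a ≤ N
        a≤N = ℕ.≤-trans a≤e₁ (ℕ.≤-trans (ℕ.≤-reflexive (suc-pred (proj₁ (proj₁ (arch-points e₁∈)))))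
            (proj₂ (proj₁ (arch-points e₁∈))))
        a≤1+N : a ≤ suc N
        a≤1+N = ℕ.m≤n⇒m≤1+n a≤N
        case-end : (∃ λ b → a ≤ b × b ≤ a + (suc N ∸ a) × stop b ≡
            true × (∀ i → a ≤ i → i < b → stop i ≡ false)) →
                   isConnected n σ ≡ false
        -- The search returns the position just after the gap; it is positive because `a` is, so the
        -- gap ends at its predecessor `b`.
        case-end (zero , a≤0 , _) = ⊥-elim (ℕ.<⇒≱ 1≤a a≤0)
        case-end (suc b , a≤1+b , b≤ , stops , gap) = ≢true λ conn → true≢false (≡.trans (≡.sym blockInterval)
            (not-true (all-lookup _ {map suc (upTo N)}
                (all-lookup _ {map suc (upTo N)} conn (point-∈ 1≤a a≤N)) (point-∈ (ℕ.≤-trans 1≤a a≤b) b≤N))))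
          where
          b≤N : b ≤ N
          b≤N = ℕ.≤-pred (subst (suc b ≤_) (ℕ.m+[n∸m]≡n a≤1+N) b≤)
          a≢1+b : a ≢ suc b
          a≢1+b refl with ∨-true (inC a) stops
          ... | inj₁ c = true≢false (≡.trans (≡.sym c) (not-true ¬Ca))
          ... | inj₂ e = ℕ.<⇒≢ (s≤s a≤N) (≡ᵇ-sound e)
          a≤b : a ≤ b
          a≤b = ℕ.≤-pred (ℕ.≤∧≢⇒< a≤1+b a≢1+b)
          in-gap : ∀ {p} → inI a b p ≡ true → inC p ≡ false
          in-gap {p} i with inI-sound a b p i
          ... | a≤p , p≤b with inC p | gap p a≤p (s≤s p≤b)
          ...   | false | _ = refl
          before-gap : ∀ {p} → 1 ≤ p → p < a → inC p ≡ true
          before-gap 1≤p p<a = not-false (before _ 1≤p p<a)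
          after-gap : b < N → inC (suc b) ≡ true
          after-gap b<N with ∨-true (inC (suc b)) stops
          ... | inj₁ c = c
          ... | inj₂ e = ⊥-elim (ℕ.<⇒≢ (s≤s b<N) (≡ᵇ-sound e))
          a≢1 : a ≢ 1
          a≢1 refl = true≢false (≡.trans (≡.sym inC-1) (not-true ¬Ca))
          block : ∀ {e} → e ∈ σ → inI a b (proj₁ e) ≡ inI a b (proj₂ e)
          block {i , j} e∈ with inI a b i in eqi | inI a b j in eqj
          ... | true  | true  = refl
          ... | false | false = refl
          -- An arch leaving the gap to the right passes over `suc b`, a point of the component,
          -- contrary to `nothing-under`.
          ... | true  | false = ⊥-elim (true≢false (≡.trans (≡.sym (after-gap (ℕ.<-≤-trans b<j j≤N)))
                  (Under.nothing-under e∈ ¬Ce (s≤s (proj₂ (inI-sound a b i eqi))) (ℕ.≤∧≢⇒< b<j 1+b≢j))))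
            where
            ¬Ce : κ (i , j) ≡ false
            ¬Ce = ≡.trans (≡.sym (inC-arch e∈ (inj₁ refl))) (in-gap eqi)
            j≤N = proj₂ (proj₂ (arch-points e∈))
            b<j : b < j
            b<j = ℕ.≰⇒> (λ j≤b → true≢false (≡.trans (≡.sym (inI-true
                    (ℕ.≤-trans (proj₁ (inI-sound a b i eqi)) (ℕ.<⇒≤ (forward e∈))) j≤b)) eqj))
            1+b≢j : suc b ≢ j
            1+b≢j refl = true≢false (≡.trans (≡.sym (after-gap (ℕ.<-≤-trans b<j j≤N)))
                (≡.trans (inC-arch e∈ (inj₂ refl)) ¬Ce))
          -- An arch entering the gap from the left starts before `a`, hence belongs to the
          -- component, although its right end does not.
          ... | false | true  = ⊥-elim (true≢false (≡.trans (≡.sym (≡.trans (inC-arch e∈ (inj₂ refl))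
                  (≡.trans (≡.sym (inC-arch e∈ (inj₁ refl)))
                      (before-gap (proj₁ (proj₁ (arch-points e∈))) i<a)))) (in-gap eqj)))
            where
            i<a : i < a
            i<a = ℕ.≰⇒> (λ a≤i → true≢false (≡.trans (≡.sym (inI-true a≤i
                    (ℕ.≤-trans (ℕ.<⇒≤ (forward e∈)) (proj₂ (inI-sound a b j eqj))))) eqi))
          blockInterval : isBlockInterval a b ≡ true
          blockInterval = cong₂ _∧_ (≤ᵇ-true a≤b)
              (cong₂ _∧_ (cong (λ c → not (c ∧ (b ≡ᵇ N))) (≡ᵇ-false a≢1)) (unionOfBlocks-true σ a b block))

-- Cumulants

double-injective : ∀ m n → m + m ≡ n + n → m ≡ n
double-injective zero    zero    e = refl
double-injective (suc m) (suc n) e = cong suc (double-injective m n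
  (ℕ.suc-injective (≡.trans (≡.sym (ℕ.+-suc m m)) (≡.trans (ℕ.suc-injective e) (ℕ.+-suc n n)))))

module CumulantSums (R : CommutativeRing 0ℓ 0ℓ) (w : CommutativeRing.Carrier R) where
  open CommutativeRing R renaming (_≈_ to _≋_; _+_ to _⊞_; _*_ to _⊠_; refl to ≋-refl; zero to ⊠-zero)
  open SetoidReasoning setoid
  open Convolution R using (conv)
  open Sums R
  open Exponential R w
  open GraphSums R w using (connected; connected-map; connected-kernel)
  open TutteSums R w using (connected-factor; connected-tutte)
  open Moments R q using (bracket; moment-crossings)
  open Mult +-monoid using () renaming (_×_ to _ˣ_)

  ∑-factor : ∀ {A : Set} {N : Carrier → Set} → N 0# → (∀ {x y} → N x → N y → N (x ⊞ y)) →
    ∀ p {F : A → Carrier} {xs} → All (λ x → ∃ λ c → N c × F x ≋ p ⊠ c) xs → ∃ λ c → N c × ∑ xs F ≋ p ⊠ c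
  ∑-factor N0 N+ p []                  = 0# , N0 , sym (zeroʳ p)
  ∑-factor N0 N+ p ((c , Nc , e) ∷ es) with ∑-factor N0 N+ p es
  ... | d , Nd , f = c ⊞ d , N+ Nc Nd , trans (+-cong e f) (sym (distribˡ p c d))

  ∑-filter : ∀ {A : Set} (b : A → Bool) {F : A → Carrier} {xs} → All (λ x → b x ≡ false → F x ≋ 0#) xs →
      ∑ xs F ≋ ∑ (filterᵇ b xs) F
  ∑-filter b []       = ≋-refl
  ∑-filter b {xs = x ∷ xs} (z ∷ zs) with b x
  ... | true  = +-congˡ (∑-filter b zs)
  ... | false = trans (+-cong (z refl) (∑-filter b zs)) (+-identityˡ _)

  -- The subset expansion of the Tutte polynomial at `x = 1 + z`, `y = 1 + w`.
  tutteSum : Carrier → ℕ → List Edge → Carrier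
  tutteSum z v E = ∑ (sublists E) (λ D → pow z (rank v E ∸ rank v D) ⊠ pow w (length D ∸ rank v D))

  module _ (a : ℕ → ℕ → Carrier) (a0 : ∀ h → a h 0 ≋ 1#) (a1 : ∀ h → a h 1 ≋ 0#)
           (a2 : ∀ h n → a h (suc (suc n)) ≋
               bracket (suc h) ⊠ ∑ (upTo (suc n)) (λ i → a (suc h) i ⊠ a h (n ∸ i)))
           (k : ℕ → Carrier)
           (cumulants : ∀ n → a 0 (suc n) ≋ ∑ (upTo (suc n)) (λ i → (n C i) ˣ (k (suc i) ⊠ a 0 (n ∸ i))))
           (n : ℕ) where

    xs : List ℕ
    xs = map suc (upTo (suc n + suc n))

    xs-ascending : AllPairs _<_ xs
    xs-ascending = AllPairs.map⁺ (AllPairs.applyUpTo⁺₁ id (suc n + suc n) (λ i<j _ → s≤s i<j))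

    xs-length : length xs ≡ suc n + suc n
    xs-length = ≡.trans (length-map suc (upTo (suc n + suc n))) (length-upTo (suc n + suc n))

    matchings-pairings : matchings (suc n) ≡ pairings xs
    matchings-pairings = matchingsOf-pairings (suc n) xs xs-length

    matchings-Pairing : All (Pairing xs) (matchings (suc n))
    matchings-Pairing = subst (All (Pairing xs)) (≡.sym matchings-pairings) (pairings-Pairing xs)

    cumulant-connected : k (suc n + suc n) ≋ ∑ (matchings (suc n)) connectedWeight
    cumulant-connected = begin
      k (suc n + suc n)
        ≈⟨ reflexive (cong k (≡.sym xs-length)) ⟩
      k (length xs)
        ≈⟨ connectedMoment-unique (a 0) k (a0 0)
             (moment-crossings a a0 a1 (λ h n → trans (a2 h n) (*-congˡ (∑-conv (a (suc h)) (a h) n))))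
             (λ xs → trans (cumulants (length xs))
                 (∑-binomial-splits xs (suc (length xs)) ℕ.≤-refl (λ i j → k (suc i) ⊠ a 0 j)))
             (length xs) 1 _ (ℕ.n≤1+n _) xs-ascending ⟨
      connectedMoment xs
        ≈⟨ reflexive (cong (λ l → ∑ l connectedWeight) (≡.sym matchings-pairings)) ⟩
      ∑ (matchings (suc n)) connectedWeight ∎

    module _ {σ} (pairing : Pairing xs σ) where

      σ-length : length σ ≡ suc n
      σ-length = double-injective (length σ) (suc n) (≡.trans (≡.sym (Pairing-length pairing)) xs-length)

      σ-ascending : AllPairs (λ e f → proj₁ e < proj₁ f) σ
      σ-ascending = Pairing-ascending pairing xs-ascending

      weight-graph : connectedWeight σ ≡ connected (upTo (length σ)) id (crossingEdges σ)
      weight-graph = crossingEdges-invariant connected connected-map connected-kernel σ σ-ascending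

      weight-tutte : ∀ z → z ≋ 0# → isConnected (suc n) σ ≡ true →
                     connectedWeight σ ≋ pow w n ⊠ tutteSum z (length σ) (crossingEdges σ)
      weight-tutte z z≋0 conn = graph-tutte (length σ) (crossingEdges σ) σ-length (crossingEdges-below σ)
          weight-graph
        (≡.trans (≡.sym (crossingEdges-invariant spanning spanning-map spanning-kernel σ σ-ascending))
                 (connected-spanning (suc n) σ pairing (s≤s z≤n) conn))
        where
        -- The length of `σ` is generalised to a variable `v`, so that its equation with `suc n` can
        -- be matched.
        graph-tutte : ∀ v E → v ≡ suc n → EdgesBelow v E → connectedWeight σ ≡ connected (upTo v) id E →
                      spanning (upTo v) id E ≡ true → connectedWeight σ ≋ pow w n ⊠ tutteSum z v E
        graph-tutte v E refl below e span = trans (reflexive e) (sym (connected-tutte z z≋0 n E below span))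

      weight-factor : ∀ {N : Carrier → Set} → N 0# → N 1# → (∀ {x y} → N x → N y → N (x ⊞ y)) →
          (∀ {x} → N x → N (q ⊠ x)) →
                      ∃ λ c → N c × connectedWeight σ ≋ pow w n ⊠ c
      weight-factor {N} N0 N1 N+ Nq =
          graph-factor (length σ) (crossingEdges σ) σ-length (crossingEdges-below σ) weight-graph
        where
        graph-factor : ∀ v E → v ≡ suc n → EdgesBelow v E → connectedWeight σ ≡ connected (upTo v) id E →
                       ∃ λ c → N c × connectedWeight σ ≋ pow w n ⊠ c
        graph-factor v E refl below e with connected-factor N N0 N1 N+ Nq n E Canonical-id below
        ... | c , Nc , f = c , Nc , trans (reflexive e)
            (trans f (*-congʳ (reflexive (cong (pow w ∘ pred) (roots-id (suc n))))))

    cumulant-tutte : ∀ z → z ≋ 0# → k (suc n + suc n) ≋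
      pow w n ⊠ ∑ (connectedMatchings (suc n)) (λ σ → tutteSum z (length σ) (crossingEdges σ))
    cumulant-tutte z z≋0 = begin
      k (suc n + suc n)
        ≈⟨ cumulant-connected ⟩
      ∑ (matchings (suc n)) connectedWeight
        ≈⟨ ∑-filter (isConnected (suc n))
            (All.map (λ {σ} pairing → disconnected-weight (suc n) σ pairing R w) matchings-Pairing) ⟩
      ∑ (connectedMatchings (suc n)) connectedWeight
        ≈⟨ ∑-congᴬ (All.zip (All.filter⁺ _ matchings-Pairing , filterᵇ-All (isConnected (suc n))
            (matchings (suc n))))
             (λ σ (pairing , conn) → weight-tutte pairing z z≋0 conn) ⟩
      ∑ (connectedMatchings (suc n)) (λ σ → pow w n ⊠ tutteSum z (length σ) (crossingEdges σ))
        ≈⟨ ∑-scale (pow w n) (connectedMatchings (suc n)) _ ⟩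
      pow w n ⊠ ∑ (connectedMatchings (suc n)) (λ σ → tutteSum z (length σ) (crossingEdges σ)) ∎

    -- Deletion-contraction builds the cofactor from 0 and 1 by sums and multiplication by `q` only,
    -- so any property `N` closed under these passes to it. The sum here is over all matchings.
    cumulant-factor : ∀ {N : Carrier → Set} → N 0# → N 1# → (∀ {x y} → N x → N y → N (x ⊞ y)) →
        (∀ {x} → N x → N (q ⊠ x)) →
                      ∃ λ c → N c × k (suc n + suc n) ≋ pow w n ⊠ c
    cumulant-factor N0 N1 N+ Nq with ∑-factor N0 N+ (pow w n)
        (All.map (λ pairing → weight-factor pairing N0 N1 N+ Nq) matchings-Pairing)
    ... | c , Nc , e = c , Nc , trans cumulant-connected e

-- Specialisation to polynomials in `q`

private
  module P = CommutativeRing polyRing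

open Sums polyRing using (∑; ∑-cong; pow)

𝕨 : Poly
𝕨 = 𝕢 ⊖ 𝟙

q̂ : Poly
q̂ = 𝟙 ⊕ 𝕨

open CumulantSums polyRing 𝕨
open Moments polyRing q̂ using (bracket)
open Mult P.+-monoid using () renaming (_×_ to _ˣ_)

pow-^ : ∀ p n → pow p n ≡ p ^ n
pow-^ p zero    = refl
pow-^ p (suc n) = cong (p ⊗_) (pow-^ p n)

q̂≈𝕢 : q̂ ≈ 𝕢
q̂≈𝕢 zero          = refl
q̂≈𝕢 (suc zero)    = refl
q̂≈𝕢 (suc (suc i)) = refl

𝕢⊗ : ∀ p → 𝕢 ⊗ p ≈ ℤ.+ 0 ∷ p
𝕢⊗ p i = ≡.trans (coeff-⊕ (ℤ.+ 0 · p) (ℤ.+ 0 ∷ 𝟙 ⊗ p) i) (≡.trans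
  (cong (ℤ._+ coeff (ℤ.+ 0 ∷ 𝟙 ⊗ p) i) (≡.trans (coeff-· (ℤ.+ 0) p i) (ℤ.*-zeroˡ (coeff p i))))
  (≡.trans (ℤ.+-identityˡ _) (shift i)))
  where
  shift : ∀ i → coeff (ℤ.+ 0 ∷ 𝟙 ⊗ p) i ≡ coeff (ℤ.+ 0 ∷ p) i
  shift zero    = refl
  shift (suc i) = ⊗-identityˡ p i

q̂⊗ : ∀ {p r} → p ≈ r → q̂ ⊗ p ≈ ℤ.+ 0 ∷ r
q̂⊗ {p} {r} e i = ≡.trans (⊗-cong {q̂} {𝕢} {p} {r} q̂≈𝕢 e i) (𝕢⊗ r i)

bracket-[]q : ∀ h → bracket h ≈ [ h ]q
bracket-[]q zero    i = refl
bracket-[]q (suc h) i = ≡.trans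
    (⊕-cong {𝟙} {𝟙} {q̂ ⊗ bracket h} {ℤ.+ 0 ∷ [ h ]q} (λ _ → refl)
        (q̂⊗ {bracket h} {[ h ]q} (bracket-[]q h)) i) (add i)
  where
  add : 𝟙 ⊕ (ℤ.+ 0 ∷ [ h ]q) ≈ [ suc h ]q
  add zero    = refl
  add (suc i) = refl

·-ˣ : ∀ n p → (ℤ.+ n) · p ≈ n ˣ p
·-ˣ zero    p i = ≡.trans (coeff-· (ℤ.+ 0) p i) (ℤ.*-zeroˡ (coeff p i))
·-ˣ (suc n) p i = ≡.trans (coeff-· (ℤ.+ suc n) p i) (≡.trans (ℤ.*-distribʳ-+ (coeff p i) (ℤ.+ 1) (ℤ.+ n))
  (≡.trans (cong₂ ℤ._+_ (ℤ.*-identityˡ (coeff p i)) (≡.trans (≡.sym (coeff-· (ℤ.+ n) p i)) (·-ˣ n p i)))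
      (≡.sym (coeff-⊕ p (n ˣ p) i))))

addℕ : List ℕ → List ℕ → List ℕ
addℕ []       ys       = ys
addℕ (x ∷ xs) []       = x ∷ xs
addℕ (x ∷ xs) (y ∷ ys) = (x + y) ∷ addℕ xs ys

fromℕs-⊕ : ∀ xs ys → fromℕs (addℕ xs ys) ≡ fromℕs xs ⊕ fromℕs ys
fromℕs-⊕ []       ys       = refl
fromℕs-⊕ (x ∷ xs) []       = refl
fromℕs-⊕ (x ∷ xs) (y ∷ ys) = cong ((ℤ.+ (x + y)) ∷_) (fromℕs-⊕ xs ys)

NonNegative : Poly → Set
NonNegative p = ∃ λ c → p ≈ fromℕs c

NonNegative-⊕ : ∀ {p r} → NonNegative p → NonNegative r → NonNegative (p ⊕ r)
NonNegative-⊕ {p} {r} (c , e) (d , f) = addℕ c d , λ i →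
  ≡.trans (⊕-cong {p} {fromℕs c} {r} {fromℕs d} e f i) (cong (λ s → coeff s i) (≡.sym (fromℕs-⊕ c d)))

NonNegative-q̂⊗ : ∀ {p} → NonNegative p → NonNegative (q̂ ⊗ p)
NonNegative-q̂⊗ {p} (c , e) = 0 ∷ c , q̂⊗ {p} {fromℕs c} e

tutte-tutteSum : ∀ σ → tutteSum (𝟙 ⊖ 𝟙) (length σ) (crossingEdges σ) ≈ tutteCrossing1q σ
tutte-tutteSum σ = ∑-cong (sublists (crossingEdges σ)) {F} {F′} (λ D →
  P.reflexive {F D} {F′ D} (cong₂ _⊗_ (pow-^ (𝟙 ⊖ 𝟙) (r D)) (pow-^ 𝕨 (s D))))
  where
  r s : List Edge → ℕ
  r D = rank (length σ) (crossingEdges σ) ∸ rank (length σ) D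
  s D = length D ∸ rank (length σ) D
  F F′ : List Edge → Poly
  F  D = pow (𝟙 ⊖ 𝟙) (r D) ⊗ pow 𝕨 (s D)
  F′ D = ((𝟙 ⊖ 𝟙) ^ r D) ⊗ (𝕨 ^ s D)

theorem3p4 : (a : ℕ → ℕ → Poly) → IsQSemicircleCF a →
    (k : ℕ → Poly) → IsCumulants (a 0) k →
    (n : ℕ) → 1 ≤ n →
    (k (n + n) ≈ ((𝕢 ⊖ 𝟙) ^ (n ∸ 1)) ⊗ ΣP (map tutteCrossing1q (connectedMatchings n)))
    × ∃ (λ (c : List ℕ) → k (n + n) ≈ ((𝕢 ⊖ 𝟙) ^ (n ∸ 1)) ⊗ fromℕs c)
theorem3p4 a (a0 , a1 , a2) k cumulants (suc n) _ = tutteFormula , nonNegative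
  where
  a2′ : ∀ h n → a h (suc (suc n)) ≈ bracket (suc h) ⊗ ∑ (upTo (suc n)) (λ i → a (suc h) i ⊗ a h (n ∸ i))
  a2′ h n = P.trans {a h (suc (suc n))} {[ suc h ]q ⊗ S} {bracket (suc h) ⊗ S} (a2 h n)
    (P.*-congʳ {S} {[ suc h ]q} {bracket (suc h)} (P.sym {bracket (suc h)} {[ suc h ]q} (bracket-[]q (suc h))))
    where
    S = ∑ (upTo (suc n)) (λ i → a (suc h) i ⊗ a h (n ∸ i))

  cumulants′ : ∀ n → a 0 (suc n) ≈ ∑ (upTo (suc n)) (λ i → (n C i) ˣ (k (suc i) ⊗ a 0 (n ∸ i)))
  cumulants′ n = P.trans {a 0 (suc n)} {∑ (upTo (suc n)) F} {∑ (upTo (suc n)) F′} (cumulants n)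
    (∑-cong (upTo (suc n)) {F} {F′} (λ i → ·-ˣ (n C i) (k (suc i) ⊗ a 0 (n ∸ i))))
    where
    F F′ : ℕ → Poly
    F  i = (ℤ.+ (n C i)) · (k (suc i) ⊗ a 0 (n ∸ i))
    F′ i = (n C i) ˣ (k (suc i) ⊗ a 0 (n ∸ i))

  t t′ : List Edge → Poly
  t  = tutteCrossing1q
  t′ σ = tutteSum (𝟙 ⊖ 𝟙) (length σ) (crossingEdges σ)

  𝕋 𝕋′ : Poly
  𝕋 = ∑ (connectedMatchings (suc n)) t
  𝕋′ = ∑ (connectedMatchings (suc n)) t′

  tutteFormula : k (suc n + suc n) ≈ (𝕨 ^ n) ⊗ 𝕋
  tutteFormula = P.trans {k (suc n + suc n)} {pow 𝕨 n ⊗ 𝕋′} {(𝕨 ^ n) ⊗ 𝕋}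
    -- `𝟙 ⊖ 𝟙` is a list with one zero entry, equal to `𝟘` only coefficientwise; hence the separate
    -- argument `z`.
    (cumulant-tutte a a0 a1 a2′ k cumulants′ n (𝟙 ⊖ 𝟙) (P.-‿inverseʳ 𝟙))
    (P.*-cong {pow 𝕨 n} {𝕨 ^ n} {𝕋′} {𝕋} (P.reflexive {pow 𝕨 n} {𝕨 ^ n} (pow-^ 𝕨 n))
        (∑-cong (connectedMatchings (suc n)) {t′} {t} tutte-tutteSum))

  nonNegative : ∃ λ c → k (suc n + suc n) ≈ (𝕨 ^ n) ⊗ fromℕs c
  nonNegative with cumulant-factor a a0 a1 a2′ k cumulants′ n {NonNegative}
                     ([] , λ _ → refl) (1 ∷ [] , λ _ → refl) (λ {p} {r} → NonNegative-⊕ {p} {r})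
                         (λ {p} → NonNegative-q̂⊗ {p})
  ... | p , (c , p≈c) , e = c , P.trans {k (suc n + suc n)} {pow 𝕨 n ⊗ p} {(𝕨 ^ n) ⊗ fromℕs c} e
    (P.*-cong {pow 𝕨 n} {𝕨 ^ n} {p} {fromℕs c} (P.reflexive {pow 𝕨 n} {𝕨 ^ n} (pow-^ 𝕨 n)) p≈c)
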